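{- Let $q\in\mathbb{C}$ with $|q|<1$. Then $$\sum_{n=0}^{\infty}\frac{(-1)^{n}q^{n^2+2n}(q;q^2)_{n}}{(-q;q^2)_{n}(q^4;q^4)_{n}} =\frac{(-q;q^5)_{\infty}(-q^4;q^5)_{\infty}(q^5;q^5)_{\infty}(q;q^2)_{\infty}}{(q^2;q^2)_{\infty}}.$$
   Context: For $|q|<1$, $x\in\mathbb{C}$ and an integer $n\ge 0$: $(x;q)_n=\prod_{j=0}^{n-1}(1-xq^j)$ (so $(x;q)_0=1$) and $(x;q)_\infty=\prod_{j=0}^{\infty}(1-xq^j)$. The same notation is used with base $q^m$ in place of $q$. -}

module Defs where

open import Algebra.Bundles using (RawRing)
open import Data.Fin.Base using (toℕ)
open import Data.Nat.Base as ℕ using (ℕ)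
import Data.Nat.Properties as ℕₚ
open import Data.Product.Base using (∃-syntax; _×_; _,_)
open import Data.Rational.Base as ℚ using (ℚ; 0ℚ; 1ℚ; ½)
import Data.Rational.Properties as ℚₚ
open import Data.Rational.Solver using (module +-*-Solver)
open import Level using (0ℓ)
open import Relation.Binary.PropositionalEquality
  using (_≡_; refl; sym; trans; cong; cong₂; subst; subst₂)
open import Relation.Nullary.Decidable using (yes; no)
open import Relation.Nullary.Negation using (contradiction)

------------------------------------------------------------------------
-- Auxiliary facts about ℚ

-- The convention recip 0 = 0 is only there to make recip total; see invᵣ.
recip : ℚ → ℚ
recip p with p ℚₚ.≟ 0ℚ
... | yes _   = 0ℚ
... | no  p≢0 = ℚ.1/_ p {{ℚ.≢-nonZero p≢0}}

recip-inverseʳ : ∀ {p} → 0ℚ ℚ.< p → p ℚ.* recip p ≡ 1ℚ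
recip-inverseʳ {p} 0<p with p ℚₚ.≟ 0ℚ
... | yes p≡0 = contradiction (sym p≡0) (ℚₚ.<⇒≢ 0<p)
... | no  p≢0 = ℚₚ.*-inverseʳ p {{ℚ.≢-nonZero p≢0}}

recip-pos : ∀ {p} → 0ℚ ℚ.< p → 0ℚ ℚ.< recip p
recip-pos {p} 0<p with p ℚₚ.≟ 0ℚ
... | yes p≡0 = contradiction (sym p≡0) (ℚₚ.<⇒≢ 0<p)
... | no  p≢0 = ℚₚ.positive⁻¹ _ {{ℚₚ.1/pos⇒pos p {{ℚ.positive 0<p}}}}

*-pos : ∀ {p q} → 0ℚ ℚ.< p → 0ℚ ℚ.< q → 0ℚ ℚ.< p ℚ.* q
*-pos {p} {q} 0<p 0<q = subst (ℚ._< p ℚ.* q) (ℚₚ.*-zeroʳ p)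
  (ℚₚ.*-monoʳ-<-pos p {{ℚ.positive 0<p}} 0<q)

½-pos : ∀ {p} → 0ℚ ℚ.< p → 0ℚ ℚ.< ½ ℚ.* p
½-pos = *-pos (ℚₚ.positive⁻¹ ½)

*-mono-≤ : ∀ {p q r s} → 0ℚ ℚ.≤ q → 0ℚ ℚ.≤ r → p ℚ.≤ q → r ℚ.≤ s →
           p ℚ.* r ℚ.≤ q ℚ.* s
*-mono-≤ {p} {q} {r} {s} 0≤q 0≤r p≤q r≤s = ℚₚ.≤-trans
  (ℚₚ.*-monoʳ-≤-nonNeg r {{ℚ.nonNegative 0≤r}} p≤q)
  (ℚₚ.*-monoˡ-≤-nonNeg q {{ℚ.nonNegative 0≤q}} r≤s)

halves : ∀ p → ½ ℚ.* p ℚ.+ ½ ℚ.* p ≡ p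
halves p = trans (sym (ℚₚ.*-distribʳ-+ p ½ ½)) (ℚₚ.*-identityˡ p)

recip-anti : ∀ {p q} → 0ℚ ℚ.< p → p ℚ.≤ q → recip q ℚ.≤ recip p
recip-anti {p} {q} 0<p p≤q = subst₂ ℚ._≤_ eq₁ eq₂
  (ℚₚ.*-monoˡ-≤-nonNeg (recip p ℚ.* recip q) {{ℚ.nonNegative 0≤}} p≤q)
  where
  open +-*-Solver
  0<q = ℚₚ.<-≤-trans 0<p p≤q
  0≤ = ℚₚ.<⇒≤ (*-pos (recip-pos 0<p) (recip-pos 0<q))
  eq₁ : (recip p ℚ.* recip q) ℚ.* p ≡ recip q
  eq₁ = trans (solve 3 (λ a b c → (a :* b) :* c := (c :* a) :* b) refl (recip p) (recip q) p)
    (trans (cong (ℚ._* recip q) (recip-inverseʳ 0<p)) (ℚₚ.*-identityˡ _))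
  eq₂ : (recip p ℚ.* recip q) ℚ.* q ≡ recip p
  eq₂ = trans (solve 3 (λ a b c → (a :* b) :* c := (c :* b) :* a) refl (recip p) (recip q) q)
    (trans (cong (ℚ._* recip p) (recip-inverseʳ 0<q)) (ℚₚ.*-identityˡ _))

recip-diff : ∀ {p q} → 0ℚ ℚ.< p → 0ℚ ℚ.< q →
             recip p ℚ.- recip q ≡ (recip p ℚ.* recip q) ℚ.* (q ℚ.- p)
recip-diff {p} {q} 0<p 0<q = sym (trans
  (solve 4 (λ a b c d → (a :* b) :* (d :- c) := a :* (d :* b) :- b :* (c :* a)) refl
    (recip p) (recip q) p q)
  (cong₂ ℚ._-_
    (trans (cong (recip p ℚ.*_) (recip-inverseʳ 0<q)) (ℚₚ.*-identityʳ (recip p)))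
    (trans (cong (recip q ℚ.*_) (recip-inverseʳ 0<p)) (ℚₚ.*-identityʳ (recip q)))))
  where open +-*-Solver

------------------------------------------------------------------------
-- Real numbers: Cauchy sequences of rationals, with equality _≈ᵣ_

record ℝ : Set where
  constructor mkℝ
  field
    seq    : ℕ → ℚ
    cauchy : ∀ ε → 0ℚ ℚ.< ε →
             ∃[ N ] (∀ m n → N ℕ.≤ m → N ℕ.≤ n → ℚ.∣ seq m ℚ.- seq n ∣ ℚ.< ε)

open ℝ public

infix 4 _≈ᵣ_ _<ᵣ_

_≈ᵣ_ : ℝ → ℝ → Set
x ≈ᵣ y = ∀ ε → 0ℚ ℚ.< ε →
         ∃[ N ] (∀ n → N ℕ.≤ n → ℚ.∣ seq x n ℚ.- seq y n ∣ ℚ.< ε)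

-- The positive gap δ is needed: an eventual strict inequality of the
-- terms would only give x ≤ y in the limit.
_<ᵣ_ : ℝ → ℝ → Set
x <ᵣ y = ∃[ δ ] 0ℚ ℚ.< δ × ∃[ N ] (∀ n → N ℕ.≤ n → seq x n ℚ.+ δ ℚ.≤ seq y n)

fromℚ : ℚ → ℝ
fromℚ p = mkℝ (λ _ → p) λ ε 0<ε → 0 , λ _ _ _ _ →
  subst (ℚ._< ε) (sym (cong ℚ.∣_∣ (ℚₚ.+-inverseʳ p))) 0<ε

infixl 6 _+ᵣ_
infixl 7 _*ᵣ_
infix  8 -ᵣ_

_+ᵣ_ : ℝ → ℝ → ℝ
x +ᵣ y = mkℝ (λ n → seq x n ℚ.+ seq y n) λ ε 0<ε →
  let (M , x-close) = cauchy x (½ ℚ.* ε) (½-pos 0<ε)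
      (N , y-close) = cauchy y (½ ℚ.* ε) (½-pos 0<ε)
  in M ℕ.⊔ N , λ m n ≤m ≤n → begin-strict
    ℚ.∣ (seq x m ℚ.+ seq y m) ℚ.- (seq x n ℚ.+ seq y n) ∣
      ≡⟨ cong ℚ.∣_∣ (solve 4 (λ a b c d → (a :+ b) :- (c :+ d) := (a :- c) :+ (b :- d))
           refl (seq x m) (seq y m) (seq x n) (seq y n)) ⟩
    ℚ.∣ (seq x m ℚ.- seq x n) ℚ.+ (seq y m ℚ.- seq y n) ∣
      ≤⟨ ℚₚ.∣p+q∣≤∣p∣+∣q∣ (seq x m ℚ.- seq x n) (seq y m ℚ.- seq y n) ⟩
    ℚ.∣ seq x m ℚ.- seq x n ∣ ℚ.+ ℚ.∣ seq y m ℚ.- seq y n ∣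
      <⟨ ℚₚ.+-mono-<
           (x-close m n (ℕₚ.m⊔n≤o⇒m≤o M N ≤m) (ℕₚ.m⊔n≤o⇒m≤o M N ≤n))
           (y-close m n (ℕₚ.m⊔n≤o⇒n≤o M N ≤m) (ℕₚ.m⊔n≤o⇒n≤o M N ≤n)) ⟩
    ½ ℚ.* ε ℚ.+ ½ ℚ.* ε
      ≡⟨ halves ε ⟩
    ε ∎
  where
  open ℚₚ.≤-Reasoning
  open +-*-Solver

-ᵣ_ : ℝ → ℝ
-ᵣ x = mkℝ (λ n → ℚ.- seq x n) λ ε 0<ε →
  let (N , x-close) = cauchy x ε 0<ε
  in N , λ m n ≤m ≤n → subst (ℚ._< ε)
    (trans (sym (ℚₚ.∣-p∣≡∣p∣ (seq x m ℚ.- seq x n)))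
      (cong ℚ.∣_∣ (solve 2 (λ a b → :- (a :- b) := (:- a) :- (:- b)) refl (seq x m) (seq x n))))
    (x-close m n ≤m ≤n)
  where open +-*-Solver

eventually-bounded : ∀ x →
  ∃[ B ] 0ℚ ℚ.< B × ∃[ N ] (∀ n → N ℕ.≤ n → ℚ.∣ seq x n ∣ ℚ.≤ B)
eventually-bounded x =
  let (N , close) = cauchy x 1ℚ 0<1
  in 1ℚ ℚ.+ ℚ.∣ seq x N ∣
   , ℚₚ.+-mono-<-≤ 0<1 (ℚₚ.0≤∣p∣ (seq x N))
   , N
   , λ n N≤n → begin
    ℚ.∣ seq x n ∣
      ≡⟨ cong ℚ.∣_∣ (solve 2 (λ a b → a := (a :- b) :+ b) refl (seq x n) (seq x N)) ⟩
    ℚ.∣ (seq x n ℚ.- seq x N) ℚ.+ seq x N ∣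
      ≤⟨ ℚₚ.∣p+q∣≤∣p∣+∣q∣ (seq x n ℚ.- seq x N) (seq x N) ⟩
    ℚ.∣ seq x n ℚ.- seq x N ∣ ℚ.+ ℚ.∣ seq x N ∣
      ≤⟨ ℚₚ.+-monoˡ-≤ ℚ.∣ seq x N ∣ (ℚₚ.<⇒≤ (close n N N≤n ℕₚ.≤-refl)) ⟩
    1ℚ ℚ.+ ℚ.∣ seq x N ∣ ∎
  where
  open ℚₚ.≤-Reasoning
  open +-*-Solver
  0<1 = ℚₚ.positive⁻¹ 1ℚ

_*ᵣ_ : ℝ → ℝ → ℝ
x *ᵣ y = mkℝ (λ n → seq x n ℚ.* seq y n) λ ε 0<ε →
  let (B , 0<B , K , x≤B) = eventually-bounded x
      (C , 0<C , L , y≤C) = eventually-bounded y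
      (M , x-close) = cauchy x ((½ ℚ.* ε) ℚ.* recip C) (*-pos (½-pos 0<ε) (recip-pos 0<C))
      (N , y-close) = cauchy y ((½ ℚ.* ε) ℚ.* recip B) (*-pos (½-pos 0<ε) (recip-pos 0<B))
  in (K ℕ.⊔ L) ℕ.⊔ (M ℕ.⊔ N) , λ m n ≤m ≤n →
  let KL≤n = ℕₚ.m⊔n≤o⇒m≤o (K ℕ.⊔ L) (M ℕ.⊔ N) ≤n
      KL≤m = ℕₚ.m⊔n≤o⇒m≤o (K ℕ.⊔ L) (M ℕ.⊔ N) ≤m
      MN≤n = ℕₚ.m⊔n≤o⇒n≤o (K ℕ.⊔ L) (M ℕ.⊔ N) ≤n
      MN≤m = ℕₚ.m⊔n≤o⇒n≤o (K ℕ.⊔ L) (M ℕ.⊔ N) ≤m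
      dx = seq x m ℚ.- seq x n
      dy = seq y m ℚ.- seq y n
      dx< = x-close m n (ℕₚ.m⊔n≤o⇒m≤o M N MN≤m) (ℕₚ.m⊔n≤o⇒m≤o M N MN≤n)
      dy< = y-close m n (ℕₚ.m⊔n≤o⇒n≤o M N MN≤m) (ℕₚ.m⊔n≤o⇒n≤o M N MN≤n)
  in begin-strict
    ℚ.∣ seq x m ℚ.* seq y m ℚ.- seq x n ℚ.* seq y n ∣
      ≡⟨ cong ℚ.∣_∣ (solve 4
           (λ a b c d → a :* b :- c :* d := (b :- d) :* a :+ (a :- c) :* d)
           refl (seq x m) (seq y m) (seq x n) (seq y n)) ⟩
    ℚ.∣ dy ℚ.* seq x m ℚ.+ dx ℚ.* seq y n ∣
      ≤⟨ ℚₚ.∣p+q∣≤∣p∣+∣q∣ (dy ℚ.* seq x m) (dx ℚ.* seq y n) ⟩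
    ℚ.∣ dy ℚ.* seq x m ∣ ℚ.+ ℚ.∣ dx ℚ.* seq y n ∣
      ≡⟨ cong₂ ℚ._+_ (ℚₚ.∣p*q∣≡∣p∣*∣q∣ dy (seq x m)) (ℚₚ.∣p*q∣≡∣p∣*∣q∣ dx (seq y n)) ⟩
    ℚ.∣ dy ∣ ℚ.* ℚ.∣ seq x m ∣ ℚ.+ ℚ.∣ dx ∣ ℚ.* ℚ.∣ seq y n ∣
      ≤⟨ ℚₚ.+-mono-≤
           (ℚₚ.*-monoˡ-≤-nonNeg ℚ.∣ dy ∣ {{ℚₚ.∣-∣-nonNeg dy}}
             (x≤B m (ℕₚ.m⊔n≤o⇒m≤o K L KL≤m)))
           (ℚₚ.*-monoˡ-≤-nonNeg ℚ.∣ dx ∣ {{ℚₚ.∣-∣-nonNeg dx}}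
             (y≤C n (ℕₚ.m⊔n≤o⇒n≤o K L KL≤n))) ⟩
    ℚ.∣ dy ∣ ℚ.* B ℚ.+ ℚ.∣ dx ∣ ℚ.* C
      <⟨ ℚₚ.+-mono-<
           (ℚₚ.*-monoˡ-<-pos B {{ℚ.positive 0<B}} dy<)
           (ℚₚ.*-monoˡ-<-pos C {{ℚ.positive 0<C}} dx<) ⟩
    ((½ ℚ.* ε) ℚ.* recip B) ℚ.* B ℚ.+ ((½ ℚ.* ε) ℚ.* recip C) ℚ.* C
      ≡⟨ cong₂ ℚ._+_ (cancel (½ ℚ.* ε) 0<B) (cancel (½ ℚ.* ε) 0<C) ⟩
    ½ ℚ.* ε ℚ.+ ½ ℚ.* ε
      ≡⟨ halves ε ⟩
    ε ∎
  where
  open ℚₚ.≤-Reasoning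
  open +-*-Solver
  cancel : ∀ p {q} → 0ℚ ℚ.< q → (p ℚ.* recip q) ℚ.* q ≡ p
  cancel p {q} 0<q = trans
    (solve 3 (λ a b c → (a :* b) :* c := a :* (c :* b)) refl p (recip q) q)
    (trans (cong (p ℚ.*_) (recip-inverseʳ 0<q)) (ℚₚ.*-identityʳ p))

-- Only finitely many terms of a positive real can be ≤ 0, so the value of
-- recip there is irrelevant to the real number defined.
invᵣ : ∀ x → fromℚ 0ℚ <ᵣ x → ℝ
invᵣ x (δ , 0<δ , K , δ≤x) = mkℝ (λ n → recip (seq x n)) λ ε 0<ε →
  let (N , x-close) = cauchy x (ε ℚ.* (δ ℚ.* δ)) (*-pos 0<ε (*-pos 0<δ 0<δ))
  in K ℕ.⊔ N , λ m n ≤m ≤n →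
  let a = seq x m
      b = seq x n
      δ≤a = δ≤ m (ℕₚ.m⊔n≤o⇒m≤o K N ≤m)
      δ≤b = δ≤ n (ℕₚ.m⊔n≤o⇒m≤o K N ≤n)
      0<a = ℚₚ.<-≤-trans 0<δ δ≤a
      0<b = ℚₚ.<-≤-trans 0<δ δ≤b
      0≤r = ℚₚ.<⇒≤ (recip-pos 0<δ)
      0≤ra = ℚₚ.<⇒≤ (recip-pos 0<a)
      0≤rb = ℚₚ.<⇒≤ (recip-pos 0<b)
      0<rr = *-pos (recip-pos 0<δ) (recip-pos 0<δ)
      ba< = x-close n m (ℕₚ.m⊔n≤o⇒n≤o K N ≤n) (ℕₚ.m⊔n≤o⇒n≤o K N ≤m)
  in begin-strict
    ℚ.∣ recip a ℚ.- recip b ∣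
      ≡⟨ cong ℚ.∣_∣ (recip-diff 0<a 0<b) ⟩
    ℚ.∣ (recip a ℚ.* recip b) ℚ.* (b ℚ.- a) ∣
      ≡⟨ ℚₚ.∣p*q∣≡∣p∣*∣q∣ (recip a ℚ.* recip b) (b ℚ.- a) ⟩
    ℚ.∣ recip a ℚ.* recip b ∣ ℚ.* ℚ.∣ b ℚ.- a ∣
      ≡⟨ cong (ℚ._* ℚ.∣ b ℚ.- a ∣)
           (ℚₚ.0≤p⇒∣p∣≡p (ℚₚ.<⇒≤ (*-pos (recip-pos 0<a) (recip-pos 0<b)))) ⟩
    (recip a ℚ.* recip b) ℚ.* ℚ.∣ b ℚ.- a ∣
      ≤⟨ ℚₚ.*-monoʳ-≤-nonNeg ℚ.∣ b ℚ.- a ∣ {{ℚₚ.∣-∣-nonNeg (b ℚ.- a)}}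
           (*-mono-≤ 0≤r 0≤rb (recip-anti 0<δ δ≤a) (recip-anti 0<δ δ≤b)) ⟩
    (recip δ ℚ.* recip δ) ℚ.* ℚ.∣ b ℚ.- a ∣
      <⟨ ℚₚ.*-monoʳ-<-pos (recip δ ℚ.* recip δ) {{ℚ.positive 0<rr}} ba< ⟩
    (recip δ ℚ.* recip δ) ℚ.* (ε ℚ.* (δ ℚ.* δ))
      ≡⟨ solve 3 (λ r e d → (r :* r) :* (e :* (d :* d)) := e :* ((d :* r) :* (d :* r)))
           refl (recip δ) ε δ ⟩
    ε ℚ.* ((δ ℚ.* recip δ) ℚ.* (δ ℚ.* recip δ))
      ≡⟨ cong (ε ℚ.*_) (cong₂ ℚ._*_ (recip-inverseʳ 0<δ) (recip-inverseʳ 0<δ)) ⟩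
    ε ℚ.* (1ℚ ℚ.* 1ℚ)
      ≡⟨ ℚₚ.*-identityʳ ε ⟩
    ε ∎
  where
  open ℚₚ.≤-Reasoning
  open +-*-Solver
  δ≤ : ∀ n → K ℕ.≤ n → δ ℚ.≤ seq x n
  δ≤ n K≤n = subst (ℚ._≤ seq x n) (ℚₚ.+-identityˡ δ) (δ≤x n K≤n)

------------------------------------------------------------------------
-- Complex numbers

infixl 6 _+i_

record ℂ : Set where
  constructor _+i_
  field
    re : ℝ
    im : ℝ

open ℂ public

infix 4 _≈_

_≈_ : ℂ → ℂ → Set
z ≈ w = re z ≈ᵣ re w × im z ≈ᵣ im w

ℂ-rawRing : RawRing 0ℓ 0ℓ
ℂ-rawRing = record
  { Carrier = ℂ
  ; _≈_     = _≈_
  ; _+_     = λ z w → (re z +ᵣ re w) +i (im z +ᵣ im w)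
  ; _*_     = λ z w → (re z *ᵣ re w +ᵣ -ᵣ (im z *ᵣ im w))
                   +i (re z *ᵣ im w +ᵣ im z *ᵣ re w)
  ; -_      = λ z → (-ᵣ re z) +i (-ᵣ im z)
  ; 0#      = fromℚ 0ℚ +i fromℚ 0ℚ
  ; 1#      = fromℚ 1ℚ +i fromℚ 0ℚ
  }

open RawRing ℂ-rawRing public
  using (_+_; _*_; -_; 0#; 1#)
open import Algebra.Definitions.RawSemiring (RawRing.rawSemiring ℂ-rawRing) public
  using (_^_; sum; product)

infixl 6 _-_

_-_ : ℂ → ℂ → ℂ
z - w = z + (- w)

∣_∣² : ℂ → ℝ
∣ z ∣² = re z *ᵣ re z +ᵣ im z *ᵣ im z

-- |z| < r, stated without a square root; meaningful for r ≥ 0 only.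
infix 4 ∣_∣<_

∣_∣<_ : ℂ → ℚ → Set
∣ z ∣< r = ∣ z ∣² <ᵣ fromℚ (r ℚ.* r)

-- Apartness from zero, the constructive form of z ≠ 0.
infix 4 _#0

_#0 : ℂ → Set
z #0 = fromℚ 0ℚ <ᵣ ∣ z ∣²

-- z⁻¹ is the conjugate of z divided by |z|².
inv : ∀ z → z #0 → ℂ
inv z z#0 = (re z *ᵣ invᵣ ∣ z ∣² z#0) +i (-ᵣ im z *ᵣ invᵣ ∣ z ∣² z#0)

infixl 7 _/_[_]

_/_[_] : ℂ → (w : ℂ) → w #0 → ℂ
z / w [ w#0 ] = z * inv w w#0

------------------------------------------------------------------------
-- Limits and series

infix 4 _⟶_

_⟶_ : (ℕ → ℂ) → ℂ → Set
s ⟶ L = ∀ ε → 0ℚ ℚ.< ε → ∃[ N ] (∀ n → N ℕ.≤ n → ∣ s n - L ∣< ε)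

HasSum : (ℕ → ℂ) → ℂ → Set
HasSum f S = (λ n → sum {n} (λ i → f (toℕ i))) ⟶ S

------------------------------------------------------------------------
-- q-Pochhammer symbols

-- (x;q)ₙ
poch : ℂ → ℂ → ℕ → ℂ
poch x q n = product {n} (λ j → 1# - x * q ^ toℕ j)

-- P is the value of the infinite product (x;q)_∞.
IsPoch∞ : ℂ → ℂ → ℂ → Set
IsPoch∞ x q P = poch x q ⟶ P

{-# OPTIONS --safe #-}

module Submission where

-- Put p = q². By a WZ recurrence, 1/((−q;p)ₙ(q⁴;q⁴)ₙ) is the sum over r ≤ n of
-- (−1)^r q^(r(3r−1)/2) (1−q^(4r+2)) / ((p;p)ₙ₋ᵣ(p;p)ₙ₊ᵣ₊₁). Inserting this in the series weighted
-- by (p;p)_N/(p;p)_{N−n} and summing over n first (the q-Chu–Vandermonde sum) gives, for every N,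
-- (q;p)_{N+1} times the sum over −N−1 ≤ r ≤ N of q^(r(5r+3)/2) (p;p)_N / ((p;p)_{N−r}(p;p)_{N+r+1}).
-- The finite Jacobi triple product evaluates the same sum with 1/((p;p)_{N−r}(p;p)_{N+r+1})
-- replaced by its analogue in base q⁵. In either base the weights are 1 + O(ρ^(N−r)) up to a
-- common factor while the terms are O(ρ^(2r)), so both sums approach the same theta series as
-- N → ∞, and comparing the limits gives the identity. All limits are taken in a complete normed
-- ring, of which ℂ is an instance.

-- The algebra is free of division: 1/(x;x)_n enters as a sequence `u` with u n = (1 - x^(n+1)) u
-- (n+1), so each finite identity reduces, once powers and reciprocals are named, to a polynomial
-- identity in an arbitrary commutative ring. Bilateral sums have to be run over natural numbers.
-- This works because the weight 1/((x;x)_(N-r)(x;x)_(N+r+1)) is invariant under r ↦ -1-r, so the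
-- terms r and -1-r can be joined; a certificate for the bilateral sum then turns into the
-- difference of its values at r and -r, which vanishes at r = 0 and so leaves no boundary term
-- there. The passage to the limit is constructive: |q| < 1 is replaced by a rational bound ρ < 1,
-- products and reciprocals converge at the explicit rate ρ^n, and the apartness from zero that the
-- statement asks for is read off from the reciprocals, which exist by the geometric series.

import Defs
open import Algebra.Bundles using (CommutativeRing; RawRing; Semiring)
open import Data.Fin.Base using (toℕ)
open import Data.Nat.Base as ℕ using (ℕ; zero; suc; z≤n; s≤s)
import Data.Nat.Properties as ℕₚ
open import Data.Product.Base using (Σ-syntax; ∃-syntax; _×_; _,_; proj₁; proj₂)
open import Data.Rational.Base as ℚ using (ℚ; 0ℚ; 1ℚ; ½)
import Data.Rational.Properties as ℚₚ
open import Level using (0ℓ)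
import Relation.Binary.PropositionalEquality as ≡
open ≡ using (_≡_)
import Data.Nat.Solver as ℕSolver
import Algebra.Construct.Pointwise as Pointwise
import Algebra.Definitions.RawMonoid as RawMonoidDefinitions
import Algebra.Morphism.RingMonomorphism as RingMonomorphism
import Data.Vec.Functional as Vector

-- A ring solver with integer coefficients over any commutative ring

module ℤ-Solver (R : CommutativeRing 0ℓ 0ℓ) where
  open import Algebra.Solver.Ring.AlmostCommutativeRing using (fromCommutativeRing; _-Raw-AlmostCommutative⟶_)
  open import Data.Integer.Base as ℤ using (ℤ; +_; -[1+_])
  import Data.Integer.Properties as ℤₚ
  open import Data.Maybe.Base using (just; nothing)
  open import Relation.Nullary.Decidable using (yes; no)
  open import Relation.Binary.Definitions using (WeaklyDecidable)
  open CommutativeRing R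
  open import Algebra.Properties.Ring ring
  open import Algebra.Properties.Semiring.Mult.TCOptimised semiring renaming (_×_ to _×ᴿ_)
  open import Relation.Binary.Reasoning.Setoid setoid

  fromℤ : ℤ → Carrier
  fromℤ (+ n)    = n ×ᴿ 1#
  fromℤ -[1+ n ] = - (suc n ×ᴿ 1#)

  fromℤ-neg : ∀ n → fromℤ (ℤ.- (+ n)) ≈ - (n ×ᴿ 1#)
  fromℤ-neg zero    = sym -0#≈0#
  fromℤ-neg (suc n) = refl

  fromℤ-⊖ : ∀ m n → fromℤ (m ℤ.⊖ n) ≈ m ×ᴿ 1# - n ×ᴿ 1#
  fromℤ-⊖ m zero = sym (trans (+-congˡ -0#≈0#) (+-identityʳ _))
  fromℤ-⊖ zero (suc n) = sym (+-identityˡ _)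
  fromℤ-⊖ (suc m) (suc n) = begin
    fromℤ (suc m ℤ.⊖ suc n)                ≡⟨ ≡.cong fromℤ (ℤₚ.[1+m]⊖[1+n]≡m⊖n m n) ⟩
    fromℤ (m ℤ.⊖ n)                        ≈⟨ fromℤ-⊖ m n ⟩
    m ×ᴿ 1# - n ×ᴿ 1#                        ≈⟨ +-congʳ (+-identityʳ _) ⟨
    (m ×ᴿ 1# + 0#) - n ×ᴿ 1#                 ≈⟨ +-congʳ (+-congˡ (-‿inverseʳ 1#)) ⟨
    (m ×ᴿ 1# + (1# - 1#)) - n ×ᴿ 1#          ≈⟨ +-congʳ (+-assoc _ _ _) ⟨
    (m ×ᴿ 1# + 1# - 1#) - n ×ᴿ 1#            ≈⟨ +-assoc _ _ _ ⟩
    (m ×ᴿ 1# + 1#) + (- 1# - n ×ᴿ 1#)        ≈⟨ +-cong (+-comm _ _) (-‿+-comm _ _) ⟩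
    (1# + m ×ᴿ 1#) - (1# + n ×ᴿ 1#)          ≈⟨ +-cong (1+× m 1#) (-‿cong (1+× n 1#)) ⟨
    suc m ×ᴿ 1# - suc n ×ᴿ 1#                ∎

  fromℤ-+ : ∀ i j → fromℤ (i ℤ.+ j) ≈ fromℤ i + fromℤ j
  fromℤ-+ (+ m)    (+ n)    = ×-homo-+ 1# m n
  fromℤ-+ (+ m)    -[1+ n ] = fromℤ-⊖ m (suc n)
  fromℤ-+ -[1+ m ] (+ n)    = trans (fromℤ-⊖ n (suc m)) (+-comm _ _)
  fromℤ-+ -[1+ m ] -[1+ n ] = begin
    - (suc (suc (m ℕ.+ n)) ×ᴿ 1#)      ≡⟨ ≡.cong (λ k → - (suc k ×ᴿ 1#)) (ℕₚ.+-suc m n) ⟨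
    - ((suc m ℕ.+ suc n) ×ᴿ 1#)        ≈⟨ -‿cong (×-homo-+ 1# (suc m) (suc n)) ⟩
    - (suc m ×ᴿ 1# + suc n ×ᴿ 1#)       ≈⟨ -‿+-comm _ _ ⟨
    - (suc m ×ᴿ 1#) - suc n ×ᴿ 1#       ∎

  fromℤ-‿- : ∀ i → fromℤ (ℤ.- i) ≈ - fromℤ i
  fromℤ-‿- (+ n)    = fromℤ-neg n
  fromℤ-‿- -[1+ n ] = sym (-‿involutive _)

  fromℤ-* : ∀ i j → fromℤ (i ℤ.* j) ≈ fromℤ i * fromℤ j
  fromℤ-* (+ m) (+ n) = trans (reflexive (≡.cong fromℤ (≡.sym (ℤₚ.pos-* m n)))) (×1-homo-* m n)
  fromℤ-* (+ m) -[1+ n ] = begin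
    fromℤ (+ m ℤ.* -[1+ n ])          ≡⟨ ≡.cong fromℤ (ℤₚ.neg-distribʳ-* (+ m) (+ suc n)) ⟨
    fromℤ (ℤ.- (+ m ℤ.* + suc n))     ≈⟨ fromℤ-‿- (+ m ℤ.* + suc n) ⟩
    - fromℤ (+ m ℤ.* + suc n)         ≈⟨ -‿cong (fromℤ-* (+ m) (+ suc n)) ⟩
    - (m ×ᴿ 1# * suc n ×ᴿ 1#)           ≈⟨ -‿distribʳ-* _ _ ⟩
    m ×ᴿ 1# * - (suc n ×ᴿ 1#)           ∎
  fromℤ-* -[1+ m ] (+ n) = begin
    fromℤ (-[1+ m ] ℤ.* + n)          ≡⟨ ≡.cong fromℤ (ℤₚ.neg-distribˡ-* (+ suc m) (+ n)) ⟨
    fromℤ (ℤ.- (+ suc m ℤ.* + n))     ≈⟨ fromℤ-‿- (+ suc m ℤ.* + n) ⟩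
    - fromℤ (+ suc m ℤ.* + n)         ≈⟨ -‿cong (fromℤ-* (+ suc m) (+ n)) ⟩
    - (suc m ×ᴿ 1# * n ×ᴿ 1#)           ≈⟨ -‿distribˡ-* _ _ ⟩
    - (suc m ×ᴿ 1#) * n ×ᴿ 1#           ∎
  fromℤ-* -[1+ m ] -[1+ n ] = begin
    (suc m ℕ.* suc n) ×ᴿ 1#            ≈⟨ ×1-homo-* (suc m) (suc n) ⟩
    suc m ×ᴿ 1# * suc n ×ᴿ 1#           ≈⟨ -‿involutive _ ⟨
    - - (suc m ×ᴿ 1# * suc n ×ᴿ 1#)     ≈⟨ -‿cong (-‿distribˡ-* _ _) ⟩
    - (- (suc m ×ᴿ 1#) * suc n ×ᴿ 1#)   ≈⟨ -‿distribʳ-* _ _ ⟩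
    - (suc m ×ᴿ 1#) * - (suc n ×ᴿ 1#)   ∎

  ℤ⟶R : ℤ.+-*-rawRing -Raw-AlmostCommutative⟶ fromCommutativeRing R
  ℤ⟶R = record
    { ⟦_⟧ = fromℤ ; +-homo = fromℤ-+ ; *-homo = fromℤ-* ; -‿homo = fromℤ-‿-
    ; 0-homo = refl ; 1-homo = refl }

  -- Distinct integers may have equal images in `R`, so only positive answers are given.
  fromℤ≟ : WeaklyDecidable (λ i j → fromℤ i ≈ fromℤ j)
  fromℤ≟ i j with i ℤₚ.≟ j
  ... | yes i≡j = just (reflexive (≡.cong fromℤ i≡j))
  ... | no  _   = nothing

  open import Algebra.Solver.Ring ℤ.+-*-rawRing (fromCommutativeRing R) ℤ⟶R fromℤ≟ public
    using (solve; _:=_; _:+_; _:*_; _:-_; :-_; _:^_; con; Polynomial)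

  infix 9 #_
  #_ : ∀ {n} → ℕ → Polynomial n
  # k = con (+ k)

-- Finite sums, antidiagonal sums and q-Pochhammer symbols

module FiniteSums (R : CommutativeRing 0ℓ 0ℓ) where
  open CommutativeRing R
  open ℤ-Solver R
  open import Algebra.Properties.Semiring.Exp semiring public
    using (_^_; ^-homo-*; ^-congˡ; ^-assocʳ)
  open import Algebra.Definitions.RawSemiring (Semiring.rawSemiring semiring) public
    using (sum; product)
  open import Algebra.Properties.CommutativeSemiring.Exp commutativeSemiring public
    using (^-distrib-*)
  open import Relation.Binary.Reasoning.Setoid setoid

  product-snoc : ∀ n (f : ℕ → Carrier) →
    product {suc n} (λ i → f (toℕ i)) ≈ product {n} (λ i → f (toℕ i)) * f n
  product-snoc zero    f = *-comm _ _
  product-snoc (suc n) f = begin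
    f 0 * product {suc n} (λ i → f (suc (toℕ i)))
      ≈⟨ *-congˡ (product-snoc n (λ i → f (suc i))) ⟩
    f 0 * (product {n} (λ i → f (suc (toℕ i))) * f (suc n))
      ≈⟨ *-assoc _ _ _ ⟨
    f 0 * product {n} (λ i → f (suc (toℕ i))) * f (suc n) ∎

  product-cong : ∀ n {f g : ℕ → Carrier} → (∀ i → f i ≈ g i) →
    product {n} (λ i → f (toℕ i)) ≈ product {n} (λ i → g (toℕ i))
  product-cong zero    f≈g = refl
  product-cong (suc n) f≈g = *-cong (f≈g 0) (product-cong n (λ i → f≈g (suc i)))

  sum-cong : ∀ n {f g : ℕ → Carrier} → (∀ i → f i ≈ g i) →
    sum {n} (λ i → f (toℕ i)) ≈ sum {n} (λ i → g (toℕ i))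
  sum-cong zero    f≈g = refl
  sum-cong (suc n) f≈g = +-cong (f≈g 0) (sum-cong n (λ i → f≈g (suc i)))

  sum-snoc : ∀ n (f : ℕ → Carrier) →
    sum {suc n} (λ i → f (toℕ i)) ≈ sum {n} (λ i → f (toℕ i)) + f n
  sum-snoc zero    f = +-comm _ _
  sum-snoc (suc n) f = trans (+-congˡ (sum-snoc n (λ i → f (suc i)))) (sym (+-assoc _ _ _))

  -- The sum of `f r k` over all r + k = n. Keeping k = n - r as an argument of its own avoids
  -- truncated subtraction in the indices.
  convolve : (ℕ → ℕ → Carrier) → ℕ → Carrier
  convolve f zero    = f 0 0
  convolve f (suc n) = convolve (λ r k → f r (suc k)) n + f (suc n) 0

  convolve-cong : ∀ n {f g : ℕ → ℕ → Carrier} →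
    (∀ r k → r ℕ.+ k ≡ n → f r k ≈ g r k) → convolve f n ≈ convolve g n
  convolve-cong zero    f≈g = f≈g 0 0 ≡.refl
  convolve-cong (suc n) f≈g = +-cong
    (convolve-cong n (λ r k eq → f≈g r (suc k) (≡.trans (ℕₚ.+-suc r k) (≡.cong suc eq))))
    (f≈g (suc n) 0 (ℕₚ.+-identityʳ (suc n)))

  convolve-+ : ∀ n (f g : ℕ → ℕ → Carrier) →
    convolve (λ r k → f r k + g r k) n ≈ convolve f n + convolve g n
  convolve-+ zero    f g = refl
  convolve-+ (suc n) f g = trans
    (+-congʳ (convolve-+ n _ _))
    (solve 4 (λ a b c d → (a :+ b) :+ (c :+ d) := (a :+ c) :+ (b :+ d)) refl _ _ _ _)

  convolve-* : ∀ n c (f : ℕ → ℕ → Carrier) →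
    convolve (λ r k → c * f r k) n ≈ c * convolve f n
  convolve-* zero    c f = refl
  convolve-* (suc n) c f = trans (+-congʳ (convolve-* n c _)) (sym (distribˡ c _ _))

  convolve-const : ∀ n (f : ℕ → Carrier) →
    convolve (λ r _ → f r) n ≈ sum {suc n} (λ i → f (toℕ i))
  convolve-const zero    f = sym (+-identityʳ _)
  convolve-const (suc n) f = trans (+-congʳ (convolve-const n f)) (sym (sum-snoc (suc n) f))

  -- Both sides run over the triples r + k + l = n; this is the interchange of summations in
  -- `finite-identity`.
  convolve-assoc : ∀ n (h : ℕ → ℕ → ℕ → Carrier) →
    convolve (λ m l → convolve (λ r k → h r k l) m) n ≈
    convolve (λ r m → convolve (λ k l → h r k l) m) n
  convolve-assoc zero    h = refl
  convolve-assoc (suc n) h = begin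
    convolve (λ m l → convolve (λ r k → h r k (suc l)) m) n
      + (convolve (λ r k → h r (suc k) 0) n + h (suc n) 0 0)
      ≈⟨ +-congʳ (convolve-assoc n (λ r k l → h r k (suc l))) ⟩
    convolve (λ r m → convolve (λ k l → h r k (suc l)) m) n
      + (convolve (λ r k → h r (suc k) 0) n + h (suc n) 0 0)
      ≈⟨ +-assoc _ _ _ ⟨
    convolve (λ r m → convolve (λ k l → h r k (suc l)) m) n
      + convolve (λ r k → h r (suc k) 0) n + h (suc n) 0 0
      ≈⟨ +-congʳ (convolve-+ n _ _) ⟨
    convolve (λ r m → convolve (λ k l → h r k (suc l)) m + h r (suc m) 0) n + h (suc n) 0 0 ∎

  -- Every value of `G` strictly inside the antidiagonal r + k = n + 1 occurs once on each side, so
  -- only the two corner values survive.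
  telescope : ∀ n (f g G : ℕ → ℕ → Carrier) →
    (∀ r k → r ℕ.+ k ≡ n → f r (suc k) + G (suc r) k ≈ g r k + G r (suc k)) →
    convolve (λ r k → f r (suc k)) n + G (suc n) 0 ≈ convolve g n + G 0 (suc n)
  telescope zero    f g G step = step 0 0 ≡.refl
  telescope (suc n) f g G step = begin
    X + f (suc n) 1 + G (suc (suc n)) 0
      ≈⟨ +-assoc _ _ _ ⟩
    X + (f (suc n) 1 + G (suc (suc n)) 0)
      ≈⟨ +-congˡ (step (suc n) 0 (ℕₚ.+-identityʳ (suc n))) ⟩
    X + (g (suc n) 0 + G (suc n) 1)
      ≈⟨ solve 3 (λ a b c → a :+ (b :+ c) := (a :+ c) :+ b) refl _ _ _ ⟩
    X + G (suc n) 1 + g (suc n) 0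
      ≈⟨ +-congʳ (telescope n (λ r k → f r (suc k)) (λ r k → g r (suc k)) (λ r k → G r (suc k))
           (λ r k eq → step r (suc k) (≡.trans (ℕₚ.+-suc r k) (≡.cong suc eq)))) ⟩
    convolve (λ r k → g r (suc k)) n + G 0 (suc (suc n)) + g (suc n) 0
      ≈⟨ solve 3 (λ a b c → (a :+ b) :+ c := (a :+ c) :+ b) refl _ _ _ ⟩
    convolve (λ r k → g r (suc k)) n + g (suc n) 0 + G 0 (suc (suc n)) ∎
    where X = convolve (λ r k → f r (suc (suc k))) n

  -- The form in which a WZ certificate G proves a first-order recurrence.
  convolve-step : ∀ n (f g G : ℕ → ℕ → Carrier) →
    (∀ r k → r ℕ.+ k ≡ n → f r (suc k) + G (suc r) k ≈ g r k + G r (suc k)) →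
    f (suc n) 0 ≈ G (suc n) 0 → G 0 (suc n) ≈ 0# →
    convolve f (suc n) ≈ convolve g n
  convolve-step n f g G step last first = begin
    convolve (λ r k → f r (suc k)) n + f (suc n) 0  ≈⟨ +-congˡ last ⟩
    convolve (λ r k → f r (suc k)) n + G (suc n) 0  ≈⟨ telescope n f g G step ⟩
    convolve g n + G 0 (suc n)                      ≈⟨ +-congˡ first ⟩
    convolve g n + 0#                               ≈⟨ +-identityʳ _ ⟩
    convolve g n                                    ∎

  poch : Carrier → Carrier → ℕ → Carrier
  poch a x n = product {n} (λ j → 1# - a * x ^ toℕ j)

  poch-suc : ∀ a x n → poch a x (suc n) ≈ poch a x n * (1# - a * x ^ n)
  poch-suc a x n = product-snoc n (λ j → 1# - a * x ^ j)

  poch-cong : ∀ {a b x y} n → a ≈ b → x ≈ y → poch a x n ≈ poch b y n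
  poch-cong n a≈b x≈y = product-cong n (λ j → +-congˡ (-‿cong (*-cong a≈b (^-congˡ j x≈y))))

  poch-front : ∀ a x n → poch a x (suc n) ≈ (1# - a) * poch (a * x) x n
  poch-front a x n = *-cong (+-congˡ (-‿cong (*-identityʳ a)))
    (product-cong n (λ j → +-congˡ (-‿cong (sym (*-assoc a x (x ^ j))))))

  poch-+ : ∀ a x m n → poch a x (m ℕ.+ n) ≈ poch a x m * poch (a * x ^ m) x n
  poch-+ a x zero    n = trans (poch-cong n (sym (*-identityʳ a)) refl) (sym (*-identityˡ _))
  poch-+ a x (suc m) n = begin
    poch a x (suc (m ℕ.+ n))
      ≈⟨ poch-front a x (m ℕ.+ n) ⟩
    (1# - a) * poch (a * x) x (m ℕ.+ n)
      ≈⟨ *-congˡ (poch-+ (a * x) x m n) ⟩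
    (1# - a) * (poch (a * x) x m * poch (a * x * x ^ m) x n)
      ≈⟨ *-assoc _ _ _ ⟨
    (1# - a) * poch (a * x) x m * poch (a * x * x ^ m) x n
      ≈⟨ *-cong (sym (poch-front a x m)) (poch-cong n (*-assoc a x (x ^ m)) refl) ⟩
    poch a x (suc m) * poch (a * x ^ suc m) x n ∎

  -- `R` may have zero divisors, so cancellation takes an inverse of the factor as a witness; in the
  -- q-identities `Reciprocal` supplies it.
  cancelˡ : ∀ {c y z} i → c * i ≈ 1# → c * y ≈ c * z → y ≈ z
  cancelˡ {c} {y} {z} i ci≈1 eq = begin
    y            ≈⟨ *-identityˡ y ⟨
    1# * y       ≈⟨ *-congʳ ci≈1 ⟨
    c * i * y    ≈⟨ swap c i y ⟩
    i * (c * y)  ≈⟨ *-congˡ eq ⟩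
    i * (c * z)  ≈⟨ swap c i z ⟨
    c * i * z    ≈⟨ *-congʳ ci≈1 ⟩
    1# * z       ≈⟨ *-identityˡ z ⟩
    z            ∎
    where
    swap : ∀ a b d → a * b * d ≈ b * (a * d)
    swap = solve 3 (λ a b d → (a :* b) :* d := b :* (a :* d)) refl

  square-^ : ∀ x n → (x ^ 2) ^ n ≈ x ^ n * x ^ n
  square-^ x n = trans (^-distrib-* x (x * 1#) n) (*-congˡ (^-congˡ n (*-identityʳ x)))

-- By recursion, so that `double (suc n)` reduces to two successors and `u-suc` applies twice in a
-- row.
double : ℕ → ℕ
double zero    = zero
double (suc n) = suc (suc (double n))

double≡+ : ∀ n → double n ≡ n ℕ.+ n
double≡+ zero    = ≡.refl
double≡+ (suc n) = ≡.cong suc (≡.trans (≡.cong suc (double≡+ n)) (≡.sym (ℕₚ.+-suc n n)))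

-- The number n(n - 1)/2, without division; the values at 0 and 1 are both 0.
triangle : ℕ → ℕ
triangle zero    = zero
triangle (suc n) = n ℕ.+ triangle n

-- Finite q-identities

module QIdentities (R : CommutativeRing 0ℓ 0ℓ) where
  open CommutativeRing R
  open ℤ-Solver R
  open FiniteSums R
  open import Relation.Binary.Reasoning.Setoid setoid

  -- u n = 1/(x;x)ₙ.
  record Reciprocal (x : Carrier) (u : ℕ → Carrier) : Set where
    field
      u-zero : u 0 ≈ 1#
      u-suc  : ∀ n → u n ≈ (1# - x ^ suc n) * u (suc n)

    u-inverse : ∀ n → poch x x n * u n ≈ 1#
    u-inverse zero    = trans (*-identityˡ _) u-zero
    u-inverse (suc n) = begin
      poch x x (suc n) * u (suc n)                ≈⟨ *-congʳ (poch-suc x x n) ⟩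
      poch x x n * (1# - x ^ suc n) * u (suc n)   ≈⟨ *-assoc _ _ _ ⟩
      poch x x n * ((1# - x ^ suc n) * u (suc n)) ≈⟨ *-congˡ (u-suc n) ⟨
      poch x x n * u n                            ≈⟨ u-inverse n ⟩
      1#                                          ∎

    -- Trades a reciprocal whose index moves with the summation for a fixed one times a finite
    -- product; this brings the inner sum of `finite-identity` into the form of `chu-vandermonde`.
    u-shift : ∀ n l → u n ≈ poch (x ^ suc n) x l * u (n ℕ.+ l)
    u-shift n zero    = trans (reflexive (≡.cong u (≡.sym (ℕₚ.+-identityʳ n)))) (sym (*-identityˡ _))
    u-shift n (suc l) = begin
      u n
        ≈⟨ u-shift n l ⟩
      poch (x ^ suc n) x l * u (n ℕ.+ l)
        ≈⟨ *-congˡ (u-suc (n ℕ.+ l)) ⟩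
      poch (x ^ suc n) x l * ((1# - x ^ (suc n ℕ.+ l)) * u (suc (n ℕ.+ l)))
        ≈⟨ *-congˡ (*-cong (+-congˡ (-‿cong (^-homo-* x (suc n) l)))
             (reflexive (≡.cong u (≡.sym (ℕₚ.+-suc n l))))) ⟩
      poch (x ^ suc n) x l * ((1# - x ^ suc n * x ^ l) * u (n ℕ.+ suc l))
        ≈⟨ *-assoc _ _ _ ⟨
      poch (x ^ suc n) x l * (1# - x ^ suc n * x ^ l) * u (n ℕ.+ suc l)
        ≈⟨ *-congʳ (poch-suc (x ^ suc n) x l) ⟨
      poch (x ^ suc n) x (suc l) * u (n ℕ.+ suc l) ∎

    1-x^-inverse : ∀ n → (1# - x ^ suc n) * (u (suc n) * poch x x n) ≈ 1#
    1-x^-inverse n = begin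
      (1# - x ^ suc n) * (u (suc n) * poch x x n)
        ≈⟨ solve 3 (λ a b c → a :* (b :* c) := c :* a :* b) refl _ _ _ ⟩
      poch x x n * (1# - x ^ suc n) * u (suc n)
        ≈⟨ *-congʳ (poch-suc x x n) ⟨
      poch x x (suc n) * u (suc n)
        ≈⟨ u-inverse (suc n) ⟩
      1# ∎

  -- The q-Chu-Vandermonde sum

  module _ {x : Carrier} {u : ℕ → Carrier} (rec : Reciprocal x u) where
    open Reciprocal rec

    -- The factor (b d x^m;x)_l stands for (b d;x)_n/(b d;x)_m, so that no reciprocal in `b` or `d`
    -- occurs. Both sides satisfy (1 - x^(n+1)) S(n+1, d) = (1 - d) S(n, d x), hence the induction
    -- on `n` with `d` varying. For the sum the recurrence is certified by `G`, the summand times 1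
    -- - x^m.
    chu-vandermonde : ∀ n b d →
      convolve (λ m l → u m * u l * ((- d) ^ m * x ^ triangle m) * poch b x m * poch (b * d * x ^ m) x l) n
        ≈ poch d x n * u n
    chu-vandermonde zero b d = begin
      u 0 * u 0 * (1# * 1#) * 1# * 1#  ≈⟨ *-congʳ (*-congʳ (*-congʳ (*-congʳ u-zero))) ⟩
      1# * u 0 * (1# * 1#) * 1# * 1#   ≈⟨ solve 1 (λ a → # 1 :* a :* (# 1 :* # 1) :* # 1 :* # 1 := # 1 :* a) refl _ ⟩
      1# * u 0                         ∎
    chu-vandermonde (suc n) b d = cancelˡ (u (suc n) * poch x x n) (1-x^-inverse n) (begin
      c * convolve (τ d) (suc n)
        ≈⟨ convolve-* (suc n) c (τ d) ⟨
      convolve (λ m l → c * τ d m l) (suc n)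
        ≈⟨ convolve-step n (λ m l → c * τ d m l) (λ m l → (1# - d) * τ (d * x) m l) G step last first ⟩
      convolve (λ m l → (1# - d) * τ (d * x) m l) n
        ≈⟨ convolve-* n (1# - d) (τ (d * x)) ⟩
      (1# - d) * convolve (τ (d * x)) n
        ≈⟨ *-congˡ (chu-vandermonde n b (d * x)) ⟩
      (1# - d) * (poch (d * x) x n * u n)
        ≈⟨ *-assoc _ _ _ ⟨
      (1# - d) * poch (d * x) x n * u n
        ≈⟨ *-cong (sym (poch-front d x n)) (u-suc n) ⟩
      poch d x (suc n) * (c * u (suc n))
        ≈⟨ solve 3 (λ p q r → p :* (q :* r) := q :* (p :* r)) refl _ _ _ ⟩
      c * (poch d x (suc n) * u (suc n)) ∎)
      where
      c = 1# - x ^ suc n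
      κ : Carrier → ℕ → Carrier
      κ e m = (- e) ^ m * x ^ triangle m
      τ : Carrier → ℕ → ℕ → Carrier
      τ e m l = u m * u l * κ e m * poch b x m * poch (b * e * x ^ m) x l
      G : ℕ → ℕ → Carrier
      G m l = (1# - x ^ m) * τ d m l

      κ-suc : ∀ m → κ d (suc m) ≈ κ d m * (- d * x ^ m)
      κ-suc m = trans (*-congˡ (^-homo-* x m (triangle m)))
        (solve 4 (λ d k X t → d :* k :* (X :* t) := k :* t :* (d :* X)) refl _ _ _ _)
      κ-shift : ∀ m → κ (d * x) m ≈ κ d m * x ^ m
      κ-shift m = begin
        (- (d * x)) ^ m * x ^ triangle m     ≈⟨ *-congʳ (^-congˡ m (solve 2 (λ d x → :- (d :* x) := (:- d) :* x) refl d x)) ⟩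
        (- d * x) ^ m * x ^ triangle m       ≈⟨ *-congʳ (^-distrib-* (- d) x m) ⟩
        (- d) ^ m * x ^ m * x ^ triangle m   ≈⟨ solve 3 (λ p q r → p :* q :* r := p :* r :* q) refl _ _ _ ⟩
        κ d m * x ^ m                        ∎

      step : ∀ m l → m ℕ.+ l ≡ n →
        c * τ d m (suc l) + G (suc m) l ≈ (1# - d) * τ (d * x) m l + G m (suc l)
      step m l eq = begin
        c * τ d m (suc l) + G (suc m) l
          ≈⟨ +-cong
               (*-cong c≈ (*-congˡ (poch-front (b * d * X) x l)))
               (trans (solve 6 (λ a v k p P z → a :* (v :* k :* p :* P :* z) := (a :* v) :* k :* p :* P :* z) refl _ _ _ _ _ _)
                 (*-cong (*-cong (*-cong (*-cong (sym (u-suc m)) (u-suc l)) (κ-suc m)) (poch-suc b x m))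
                   (poch-cong l (solve 4 (λ b d x X → b :* d :* (x :* X) := b :* d :* X :* x) refl b d x X) refl))) ⟩
        (1# - x * (X * Y)) * (U * W * K * B * ((1# - b * d * X) * P))
          + U * ((1# - x * Y) * W) * (K * (- d * X)) * (B * (1# - b * X)) * P
          -- Each reciprocal has been reduced to `u m` or `u (suc l)`, which are now free variables;
          -- what remains is a polynomial identity.
          ≈⟨ solve 10 (λ x X Y U W K B b d P →
               (# 1 :- x :* (X :* Y)) :* (U :* W :* K :* B :* ((# 1 :- b :* d :* X) :* P))
                 :+ U :* ((# 1 :- x :* Y) :* W) :* (K :* (:- d :* X)) :* (B :* (# 1 :- b :* X)) :* P
               := (# 1 :- d) :* (U :* ((# 1 :- x :* Y) :* W) :* (K :* X) :* B :* P)
                 :+ (# 1 :- X) :* (U :* W :* K :* B :* ((# 1 :- b :* d :* X) :* P)))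
               refl x X Y U W K B b d P ⟩
        (1# - d) * (U * ((1# - x * Y) * W) * (K * X) * B * P)
          + (1# - X) * (U * W * K * B * ((1# - b * d * X) * P))
          ≈⟨ +-cong
               (*-congˡ (*-cong (*-congʳ (*-cong (*-congˡ (sym (u-suc l))) (sym (κ-shift m))))
                 (poch-cong l (solve 4 (λ b d x X → b :* d :* X :* x := b :* (d :* x) :* X) refl b d x X) refl)))
               (*-congˡ (*-congˡ (sym (poch-front (b * d * X) x l)))) ⟩
        (1# - d) * τ (d * x) m l + G m (suc l) ∎
        where
        X = x ^ m
        Y = x ^ l
        U = u m
        W = u (suc l)
        K = κ d m
        B = poch b x m
        P = poch (b * d * X * x) x l
        c≈ : c ≈ 1# - x * (X * Y)
        c≈ = +-congˡ (-‿cong (*-congˡ (trans (reflexive (≡.cong (x ^_) (≡.sym eq))) (^-homo-* x m l))))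

      last : c * τ d (suc n) 0 ≈ G (suc n) 0
      last = refl
      first : G 0 (suc n) ≈ 0#
      first = trans (*-congʳ (-‿inverseʳ 1#)) (zeroˡ _)

  -- The finite Jacobi triple product

  power-swap : ∀ x m n → (x ^ m) ^ n ≈ (x ^ n) ^ m
  power-swap x m n = trans (^-assocʳ x m n)
    (trans (reflexive (≡.cong (x ^_) (ℕₚ.*-comm m n))) (sym (^-assocʳ x n m)))

  ^-double : ∀ y n → y ^ double n ≈ y ^ n * y ^ n
  ^-double y n = trans (reflexive (≡.cong (y ^_) (double≡+ n))) (^-homo-* y n n)

  -- The terms k = r and k = -1-r of Ramanujan's theta function, the sum of a^(k(k-1)/2)
  -- b^(k(k+1)/2) over all integers k. For a = q and b = q⁴ the exponent is k(5k+3)/2.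
  thetaTerm : Carrier → Carrier → ℕ → Carrier
  thetaTerm a b r = (a * b) ^ triangle r * b ^ r * (1# + a * (a ^ r * a ^ r))

  module _ (a b : Carrier) {u : ℕ → Carrier} (rec : Reciprocal (a * b) u) where
    open Reciprocal rec

    -- The terms r and −1−r of the bilateral sum are paired in thetaTerm.
    finite-triple-product : ∀ n →
      convolve (λ r k → thetaTerm a b r * (u k * u (suc (double r ℕ.+ k)))) n
        ≈ poch (- a) (a * b) (suc n) * poch (- b) (a * b) n * u (suc (double n))
    finite-triple-product zero = begin
      1# * 1# * (1# + a * (1# * 1#)) * (u 0 * u 1)
        ≈⟨ *-congˡ (*-congʳ u-zero) ⟩
      1# * 1# * (1# + a * (1# * 1#)) * (1# * u 1)
        ≈⟨ solve 2 (λ a v → # 1 :* # 1 :* (# 1 :+ a :* (# 1 :* # 1)) :* (# 1 :* v)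
                         := (# 1 :- (:- a) :* # 1) :* # 1 :* # 1 :* v) refl a (u 1) ⟩
      (1# - - a * 1#) * 1# * 1# * u 1 ∎
    finite-triple-product (suc n) = cancelˡ (u (suc (double (suc n))) * poch x x (suc (double n))) c₁-inverse (begin
      c₁ * convolve f (suc n)
        ≈⟨ convolve-* (suc n) c₁ f ⟨
      convolve (λ r k → c₁ * f r k) (suc n)
        ≈⟨ convolve-step n (λ r k → c₁ * f r k) (λ r k → c₂ * f r k) G step last first ⟩
      convolve (λ r k → c₂ * f r k) n
        ≈⟨ convolve-* n c₂ f ⟩
      c₂ * convolve f n
        ≈⟨ *-congˡ (finite-triple-product n) ⟩
      c₂ * (poch (- a) x (suc n) * poch (- b) x n * u (suc (double n)))
        ≈⟨ *-congˡ (*-congˡ u-double) ⟩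
      c₂ * (poch (- a) x (suc n) * poch (- b) x n * (c₁ * u (suc (double (suc n)))))
        ≈⟨ solve 8 (λ a b s X P Q c v →
             (# 1 :+ a :* s) :* (# 1 :+ b :* X) :* (P :* Q :* (c :* v))
               := c :* (P :* (# 1 :- (:- a) :* s) :* (Q :* (# 1 :- (:- b) :* X)) :* v))
             refl a b (x * X) X _ _ c₁ _ ⟩
      c₁ * (poch (- a) x (suc n) * (1# - - a * (x * X)) * (poch (- b) x n * (1# - - b * X)) * u (suc (double (suc n))))
        ≈⟨ *-congˡ (*-congʳ (*-cong (poch-suc (- a) x (suc n)) (poch-suc (- b) x n))) ⟨
      c₁ * (poch (- a) x (suc (suc n)) * poch (- b) x (suc n) * u (suc (double (suc n)))) ∎)
      where
      x = a * b
      X = x ^ n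
      -- The right-hand sides at n + 1 and n have ratio `c₂` over `c₁`: the new factors of the two
      -- products are (1 + a x^(n+1))(1 + b x^n), and the reciprocal loses (1 - x^(2n+2))(1 -
      -- x^(2n+3)).
      c₁ = (1# - x * (x * (X * X))) * (1# - x * (x * (x * (X * X))))
      c₂ = (1# + a * (x * X)) * (1# + b * X)
      f : ℕ → ℕ → Carrier
      f r k = thetaTerm a b r * (u k * u (suc (double r ℕ.+ k)))
      -- The two halves are a certificate of the bilateral sum at r and at -r. On r + k = n + 1 the
      -- product `u k * u (double r ℕ.+ k)` is even in r, x^(r(r-1)/2) gains the factor x^r = A B
      -- under r ↦ -r, and Y = x^k becomes A B x^(n+1). Joining the terms r and -1-r leaves the
      -- difference, which vanishes at r = 0; that is `first`.
      bracket : Carrier → Carrier → Carrier → Carrier → Carrier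
      bracket A B Y X =
        B * (a * (x * X) * (1# + b * X) - (1# + a * (x * X)) * Y)
          - A * (a * (x * X) * (1# + b * X) - (1# + a * (x * X)) * (A * B * (x * X)))
      bracket-cong : ∀ A B {Y X X′} → X ≈ X′ → bracket A B Y X ≈ bracket A B Y X′
      bracket-cong A B e = +-cong
        (*-congˡ (+-cong (*-cong (*-congˡ (*-congˡ e)) (+-congˡ (*-congˡ e))) (-‿cong (*-congʳ (+-congˡ (*-congˡ (*-congˡ e)))))))
        (-‿cong (*-congˡ (+-cong (*-cong (*-congˡ (*-congˡ e)) (+-congˡ (*-congˡ e)))
          (-‿cong (*-cong (+-congˡ (*-congˡ (*-congˡ e))) (*-congˡ (*-congˡ e)))))))
      G : ℕ → ℕ → Carrier
      G r k = - (u k * u (double r ℕ.+ k) * x ^ triangle r * bracket (a ^ r) (b ^ r) (x ^ k) X)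

      u-double : u (suc (double n)) ≈ c₁ * u (suc (double (suc n)))
      u-double = begin
        u (suc (double n))
          ≈⟨ trans (u-suc _) (*-congˡ (u-suc _)) ⟩
        (1# - x ^ suc (suc (double n))) * ((1# - x ^ suc (suc (suc (double n)))) * u (suc (double (suc n))))
          ≈⟨ *-assoc _ _ _ ⟨
        (1# - x ^ suc (suc (double n))) * (1# - x ^ suc (suc (suc (double n)))) * u (suc (double (suc n)))
          ≈⟨ *-congʳ (*-cong (+-congˡ (-‿cong (*-congˡ (*-congˡ (^-double x n)))))
                             (+-congˡ (-‿cong (*-congˡ (*-congˡ (*-congˡ (^-double x n))))))) ⟩
        c₁ * u (suc (double (suc n))) ∎

      c₁-inverse : c₁ * (u (suc (double (suc n))) * poch x x (suc (double n))) ≈ 1#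
      c₁-inverse = begin
        c₁ * (u (suc (double (suc n))) * poch x x (suc (double n)))
          ≈⟨ solve 3 (λ c u p → c :* (u :* p) := p :* (c :* u)) refl _ _ _ ⟩
        poch x x (suc (double n)) * (c₁ * u (suc (double (suc n))))
          ≈⟨ *-congˡ u-double ⟨
        poch x x (suc (double n)) * u (suc (double n))
          ≈⟨ u-inverse (suc (double n)) ⟩
        1# ∎

      step : ∀ r k → r ℕ.+ k ≡ n →
        c₁ * f r (suc k) + G (suc r) k ≈ c₂ * f r k + G r (suc k)
      step r k eq = begin
        c₁ * f r (suc k) + G (suc r) k
          ≈⟨ +-cong (*-cong (*-cong (+-congˡ (-‿cong (*-congˡ (*-congˡ X²≈)))) (+-congˡ (-‿cong (*-congˡ (*-congˡ (*-congˡ X²≈))))))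
                       (*-congˡ (*-congˡ (reflexive (≡.cong (λ i → u (suc i)) (ℕₚ.+-suc (double r) k))))))
                    (-‿cong (*-cong (*-cong (*-congʳ (u-suc k)) (trans (^-homo-* x r (triangle r)) (*-congʳ x^r≈)))
                       (bracket-cong (a * A) (b * B) X≈))) ⟩
        (1# - x * (x * (XX * XX))) * (1# - x * (x * (x * (XX * XX)))) * (g * B * (1# + a * (A * A)) * (W * V))
          - (1# - x * Y) * W * V * (A * B * g) * bracket (a * A) (b * B) Y XX
          ≈⟨ solve 8 (λ a b A B g Y W V →
               let x = a :* b
                   X = A :* B :* Y
                   br = λ A B Y → B :* (a :* (x :* X) :* (# 1 :+ b :* X) :- (# 1 :+ a :* (x :* X)) :* Y)
                      :- A :* (a :* (x :* X) :* (# 1 :+ b :* X) :- (# 1 :+ a :* (x :* X)) :* (A :* B :* (x :* X)))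
               in
               (# 1 :- x :* (x :* (X :* X))) :* (# 1 :- x :* (x :* (x :* (X :* X)))) :* (g :* B :* (# 1 :+ a :* (A :* A)) :* (W :* V))
                 :- (# 1 :- x :* Y) :* W :* V :* (A :* B :* g) :* br (a :* A) (b :* B) Y
               := (# 1 :+ a :* (x :* X)) :* (# 1 :+ b :* X) :* (g :* B :* (# 1 :+ a :* (A :* A)) :* ((# 1 :- x :* Y) :* W :* ((# 1 :- x :* (x :* (A :* B :* (A :* B) :* Y))) :* V)))
                 :- W :* ((# 1 :- x :* (x :* (A :* B :* (A :* B) :* Y))) :* V) :* g :* br A B (x :* Y))
               refl a b A B g Y W V ⟩
        (1# + a * (x * XX)) * (1# + b * XX) * (g * B * (1# + a * (A * A)) * ((1# - x * Y) * W * ((1# - x * (x * (A * B * (A * B) * Y))) * V)))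
          - W * ((1# - x * (x * (A * B * (A * B) * Y))) * V) * g * bracket A B (x * Y) XX
          ≈⟨ +-cong (*-cong (*-cong (+-congˡ (*-congˡ (*-congˡ (sym X≈)))) (+-congˡ (*-congˡ (sym X≈))))
                       (*-congˡ (*-cong (sym (u-suc k)) u-r≈)))
                    (-‿cong (*-cong (*-congʳ (*-congˡ (trans u-r≈ (reflexive (≡.cong u (≡.sym (ℕₚ.+-suc (double r) k)))))))
                       (sym (bracket-cong A B X≈)))) ⟩
        c₂ * f r k + G r (suc k) ∎
        where
        A = a ^ r
        B = b ^ r
        g = x ^ triangle r
        Y = x ^ k
        W = u (suc k)
        V = u (suc (suc (double r ℕ.+ k)))
        XX = A * B * Y
        x^r≈ : x ^ r ≈ A * B
        x^r≈ = ^-distrib-* a b r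
        X≈ : X ≈ XX
        X≈ = trans (reflexive (≡.cong (x ^_) (≡.sym eq))) (trans (^-homo-* x r k) (*-congʳ x^r≈))
        X²≈ : X * X ≈ XX * XX
        X²≈ = *-cong X≈ X≈
        u-r≈ : (1# - x * (x * (A * B * (A * B) * Y))) * V ≈ u (suc (double r ℕ.+ k))
        u-r≈ = sym (trans (u-suc _) (*-congʳ (+-congˡ (-‿cong (*-congˡ (*-congˡ
          (trans (^-homo-* x (double r) k) (*-congʳ (trans (^-double x r) (*-cong x^r≈ x^r≈))))))))))

      last : c₁ * f (suc n) 0 ≈ G (suc n) 0
      last = begin
        c₁ * f (suc n) 0
          ≈⟨ *-congʳ (*-cong (+-congˡ (-‿cong (*-congˡ (*-congˡ (*-cong X≈ X≈))))) (+-congˡ (-‿cong (*-congˡ (*-congˡ (*-congˡ (*-cong X≈ X≈))))))) ⟩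
        (1# - x * (x * (A * B * (A * B)))) * (1# - x * (x * (x * (A * B * (A * B))))) * (g * (b * B) * (1# + a * (a * A * (a * A))) * (W * V))
          ≈⟨ solve 7 (λ a b A B g W V →
               let x = a :* b
                   X = A :* B
                   br = λ A B Y → B :* (a :* (x :* X) :* (# 1 :+ b :* X) :- (# 1 :+ a :* (x :* X)) :* Y)
                      :- A :* (a :* (x :* X) :* (# 1 :+ b :* X) :- (# 1 :+ a :* (x :* X)) :* (A :* B :* (x :* X)))
               in
               (# 1 :- x :* (x :* (X :* X))) :* (# 1 :- x :* (x :* (x :* (X :* X)))) :* (g :* (b :* B) :* (# 1 :+ a :* (a :* A :* (a :* A))) :* (W :* V))
               := :- (W :* ((# 1 :- x :* (x :* (x :* (X :* X :* # 1)))) :* V) :* g :* br (a :* A) (b :* B) (# 1)))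
               refl a b A B g W V ⟩
        - (W * ((1# - x * (x * (x * (A * B * (A * B) * 1#)))) * V) * g * bracket (a * A) (b * B) 1# (A * B))
          ≈⟨ -‿cong (*-cong (*-congʳ (*-congˡ (sym u≈))) (sym (bracket-cong (a * A) (b * B) X≈))) ⟩
        G (suc n) 0 ∎
        where
        A = a ^ n
        B = b ^ n
        g = x ^ triangle (suc n)
        W = u 0
        V = u (suc (double (suc n) ℕ.+ 0))
        X≈ : X ≈ A * B
        X≈ = ^-distrib-* a b n
        u≈ : u (double (suc n) ℕ.+ 0) ≈ (1# - x * (x * (x * (A * B * (A * B) * 1#)))) * V
        u≈ = trans (u-suc _) (*-congʳ (+-congˡ (-‿cong (*-congˡ (*-congˡ (*-congˡ
          (trans (^-homo-* x (double n) 0) (*-congʳ (trans (^-double x n) (*-cong X≈ X≈))))))))))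

      first : G 0 (suc n) ≈ 0#
      first = solve 5 (λ a b X v w →
        let x = a :* b
            br = λ A B Y → B :* (a :* (x :* X) :* (# 1 :+ b :* X) :- (# 1 :+ a :* (x :* X)) :* Y)
               :- A :* (a :* (x :* X) :* (# 1 :+ b :* X) :- (# 1 :+ a :* (x :* X)) :* (A :* B :* (x :* X)))
        in :- (v :* w :* # 1 :* br (# 1) (# 1) (x :* X)) := # 0) refl a b X (u (suc n)) (u (suc n))

  -- The Bailey pair

  module _ (q : Carrier) where
    private
      p : Carrier
      p = q ^ 2

    pentagonal : ℕ → Carrier
    pentagonal zero    = 1#
    pentagonal (suc r) = - (pentagonal r * (q * (q ^ r * q ^ r * q ^ r)))

    oddPower : ℕ → Carrier
    oddPower r = q * (q ^ r * q ^ r)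

    -- The terms k = r and k = -1-r of Euler's pentagonal series, the sum of (-1)^k q^(k(3k-1)/2):
    -- their exponents differ by 4r + 2 and their signs are opposite.
    bailey : ℕ → Carrier
    bailey r = pentagonal r * (1# - oddPower r * oddPower r)

    module _ {u : ℕ → Carrier} (rec : Reciprocal p u) where
      open Reciprocal rec

      -- pentagonal r is (−1)^r q^(r(3r−1)/2), so this is a Bailey pair relative to q² in base q².
      bailey-pair : ∀ n →
        convolve (λ r k → bailey r * (u k * u (suc (double r ℕ.+ k)))) n
          ≈ poch q p n * u (double n)
      bailey-pair zero = begin
        1# * (1# - q * (1# * 1#) * (q * (1# * 1#))) * (u 0 * u 1)
          ≈⟨ solve 3 (λ q v w → # 1 :* (# 1 :- q :* (# 1 :* # 1) :* (q :* (# 1 :* # 1))) :* (v :* w)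
                             := v :* ((# 1 :- q :^ 2 :* # 1) :* w)) refl q (u 0) (u 1) ⟩
        u 0 * ((1# - p * 1#) * u 1)
          ≈⟨ *-cong u-zero (sym (u-suc 0)) ⟩
        1# * u 0 ∎
      bailey-pair (suc n) = cancelˡ ((1# - q * NN) * (u (double (suc n)) * poch p p (double n))) d-inverse (begin
        d * convolve f (suc n)
          ≈⟨ convolve-* (suc n) d f ⟨
        convolve (λ r k → d * f r k) (suc n)
          ≈⟨ convolve-step n (λ r k → d * f r k) f G step last first ⟩
        convolve f n
          ≈⟨ bailey-pair n ⟩
        poch q p n * u (double n)
          ≈⟨ *-congˡ u-double ⟩
        poch q p n * (d * ((1# - q * NN) * u (double (suc n))))
          ≈⟨ solve 4 (λ P d c v → P :* (d :* (c :* v)) := d :* (P :* c :* v)) refl _ _ _ _ ⟩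
        d * (poch q p n * (1# - q * NN) * u (double (suc n)))
          ≈⟨ *-congˡ (*-congʳ (*-congˡ (+-congˡ (-‿cong (*-congˡ (square-^ q n)))))) ⟨
        d * (poch q p n * (1# - q * p ^ n) * u (double (suc n)))
          ≈⟨ *-congˡ (*-congʳ (poch-suc q p n)) ⟨
        d * (poch q p (suc n) * u (double (suc n))) ∎)
        where
        N = q ^ n
        NN = N * N
        -- The new denominator is (1 - q^(4n+2))(1 - q^(4n+4)). Its factor 1 - q^(2n+1) cancels
        -- against the new factor of (q;q²), and `d` is what remains.
        d = (1# - q * q * (q * q) * (NN * NN)) * (1# + q * NN)
        f : ℕ → ℕ → Carrier
        f r k = bailey r * (u k * u (suc (double r ℕ.+ k)))
        -- Again a bilateral certificate at r minus its value at -r: the pentagonal power gains the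
        -- factor q^r = x under r ↦ -r, and y = qN/x becomes qNx. The terms match in pairs, -y² with
        -- N²q²x³, -N³q²y with N⁴q³x², and -1 with x.
        bracket : Carrier → Carrier → Carrier → Carrier
        bracket x y N = N * N * (q * q) * (x * x * x) - y * y + N * N * (N * N) * (q * q * q) * (x * x)
          - N * N * N * (q * q) * y + (N * N * q - N * N * (N * N) * (q * q * (q * q))) * (x - 1#)
        bracket-cong : ∀ x y {N N′} → N ≈ N′ → bracket x y N ≈ bracket x y N′
        bracket-cong x y e = +-cong
          (+-cong (+-cong (+-congʳ (*-congʳ (*-congʳ ee))) (*-congʳ (*-congʳ (*-cong ee ee))))
            (-‿cong (*-congʳ (*-congʳ (*-cong ee e)))))
          (*-congʳ (+-cong (*-congʳ ee) (-‿cong (*-congʳ (*-cong ee ee)))))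
          where ee = *-cong e e
        G : ℕ → ℕ → Carrier
        G r k = - (u k * u (double r ℕ.+ k) * pentagonal r * bracket (q ^ r) (q ^ k) N)

        p^double : ∀ r → p ^ double r ≈ q ^ r * q ^ r * (q ^ r * q ^ r)
        p^double r = trans (^-double p r) (*-cong (square-^ q r) (square-^ q r))

        u-double : u (double n) ≈ d * ((1# - q * NN) * u (double (suc n)))
        u-double = begin
          u (double n)
            ≈⟨ trans (u-suc _) (*-congˡ (u-suc _)) ⟩
          (1# - p * p ^ double n) * ((1# - p * (p * p ^ double n)) * u (double (suc n)))
            ≈⟨ *-cong (+-congˡ (-‿cong (*-congˡ (p^double n))))
                 (*-congʳ (+-congˡ (-‿cong (*-congˡ (*-congˡ (p^double n)))))) ⟩
          (1# - p * (NN * NN)) * ((1# - p * (p * (NN * NN))) * u (double (suc n)))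
            ≈⟨ solve 3 (λ q m v →
                 (# 1 :- q :^ 2 :* (m :* m)) :* ((# 1 :- q :^ 2 :* (q :^ 2 :* (m :* m))) :* v)
                 := (# 1 :- q :* q :* (q :* q) :* (m :* m)) :* (# 1 :+ q :* m) :* ((# 1 :- q :* m) :* v))
                 refl q NN _ ⟩
          d * ((1# - q * NN) * u (double (suc n))) ∎

        d-inverse : d * ((1# - q * NN) * (u (double (suc n)) * poch p p (double n))) ≈ 1#
        d-inverse = begin
          d * ((1# - q * NN) * (u (double (suc n)) * poch p p (double n)))
            ≈⟨ solve 4 (λ d c v P → d :* (c :* (v :* P)) := P :* (d :* (c :* v))) refl _ _ _ _ ⟩
          poch p p (double n) * (d * ((1# - q * NN) * u (double (suc n))))
            ≈⟨ *-congˡ u-double ⟨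
          poch p p (double n) * u (double n)
            ≈⟨ u-inverse (double n) ⟩
          1# ∎

        step : ∀ r k → r ℕ.+ k ≡ n → d * f r (suc k) + G (suc r) k ≈ f r k + G r (suc k)
        step r k eq = begin
          d * f r (suc k) + G (suc r) k
            ≈⟨ +-cong
                 (*-cong (*-cong (+-congˡ (-‿cong (*-congˡ (*-cong NN≈ NN≈)))) (+-congˡ (*-congˡ NN≈)))
                   (*-congˡ (*-congˡ (reflexive (≡.cong (λ i → u (suc i)) (ℕₚ.+-suc (double r) k))))))
                 (-‿cong (*-cong (*-congʳ (*-congʳ (trans (u-suc k) (*-congʳ (+-congˡ (-‿cong (*-congˡ (square-^ q k))))))))
                   (bracket-cong (q * x) y N≈))) ⟩
          (1# - q * q * (q * q) * (x * y * (x * y) * (x * y * (x * y)))) * (1# + q * (x * y * (x * y)))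
              * (g * (1# - q * (x * x) * (q * (x * x))) * (W * V))
            - (1# - p * (y * y)) * W * V * (- (g * (q * (x * x * x)))) * bracket (q * x) y (x * y)
            ≈⟨ solve 6 (λ q x y g W V →
                 let N = x :* y
                     br = λ x y → N :* N :* (q :* q) :* (x :* x :* x) :- y :* y :+ N :* N :* (N :* N) :* (q :* q :* q) :* (x :* x)
                       :- N :* N :* N :* (q :* q) :* y :+ (N :* N :* q :- N :* N :* (N :* N) :* (q :* q :* (q :* q))) :* (x :- # 1)
                     v = (# 1 :- q :^ 2 :* (q :^ 2 :* (x :* x :* (x :* x) :* (y :* y)))) :* V
                     z = # 1 :- q :* (x :* x) :* (q :* (x :* x))
                 in
                 (# 1 :- q :* q :* (q :* q) :* (N :* N :* (N :* N))) :* (# 1 :+ q :* (N :* N)) :* (g :* z :* (W :* V))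
                   :- (# 1 :- q :^ 2 :* (y :* y)) :* W :* V :* (:- (g :* (q :* (x :* x :* x)))) :* br (q :* x) y
                 := g :* z :* ((# 1 :- q :^ 2 :* (y :* y)) :* W :* v)
                   :- W :* v :* g :* br x (q :* y))
                 refl q x y g W V ⟩
          g * (1# - q * (x * x) * (q * (x * x))) * ((1# - p * (y * y)) * W * ((1# - p * (p * (x * x * (x * x) * (y * y)))) * V))
            - W * ((1# - p * (p * (x * x * (x * x) * (y * y)))) * V) * g * bracket x (q * y) (x * y)
            ≈⟨ +-cong
                 (*-congˡ (*-cong (sym (trans (u-suc k) (*-congʳ (+-congˡ (-‿cong (*-congˡ (square-^ q k))))))) u-r≈))
                 (-‿cong (*-cong (*-congʳ (*-congˡ (trans u-r≈ (reflexive (≡.cong u (≡.sym (ℕₚ.+-suc (double r) k)))))))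
                   (sym (bracket-cong x (q * y) N≈)))) ⟩
          f r k + G r (suc k) ∎
          where
          x = q ^ r
          y = q ^ k
          g = pentagonal r
          W = u (suc k)
          V = u (suc (suc (double r ℕ.+ k)))
          N≈ : N ≈ x * y
          N≈ = trans (reflexive (≡.cong (q ^_) (≡.sym eq))) (^-homo-* q r k)
          NN≈ : NN ≈ x * y * (x * y)
          NN≈ = *-cong N≈ N≈
          u-r≈ : (1# - p * (p * (x * x * (x * x) * (y * y)))) * V ≈ u (suc (double r ℕ.+ k))
          u-r≈ = sym (trans (u-suc _) (*-congʳ (+-congˡ (-‿cong (*-congˡ (*-congˡ
            (trans (^-homo-* p (double r) k) (*-cong (p^double r) (square-^ q k)))))))))

        last : d * f (suc n) 0 ≈ G (suc n) 0
        last = begin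
          d * f (suc n) 0
            ≈⟨ solve 5 (λ q N g W V →
                 let z = q :* (q :* N :* (q :* N))
                     x = q :* N
                     br = N :* N :* (q :* q) :* (x :* x :* x) :- # 1 :* # 1 :+ N :* N :* (N :* N) :* (q :* q :* q) :* (x :* x)
                       :- N :* N :* N :* (q :* q) :* # 1 :+ (N :* N :* q :- N :* N :* (N :* N) :* (q :* q :* (q :* q))) :* (x :- # 1)
                 in
                 (# 1 :- q :* q :* (q :* q) :* (N :* N :* (N :* N))) :* (# 1 :+ q :* (N :* N)) :* (g :* (# 1 :- z :* z) :* (W :* V))
                 := :- (W :* ((# 1 :- q :^ 2 :* (q :^ 2 :* (q :^ 2 :* (N :* N :* (N :* N) :* # 1)))) :* V) :* g :* br))
                 refl q N (pentagonal (suc n)) (u 0) V ⟩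
          - (u 0 * ((1# - p * (p * (p * (N * N * (N * N) * 1#)))) * V) * pentagonal (suc n) * bracket (q * N) 1# N)
            ≈⟨ -‿cong (*-congʳ (*-congʳ (*-congˡ u≈))) ⟨
          G (suc n) 0 ∎
          where
          V = u (suc (double (suc n) ℕ.+ 0))
          u≈ : u (double (suc n) ℕ.+ 0) ≈ (1# - p * (p * (p * (N * N * (N * N) * 1#)))) * V
          u≈ = trans (u-suc _) (*-congʳ (+-congˡ (-‿cong (*-congˡ (*-congˡ (*-congˡ
            (trans (^-homo-* p (double n) 0) (*-congʳ (p^double n)))))))))

        first : G 0 (suc n) ≈ 0#
        first = solve 4 (λ q N v w →
          let y = q :* N
              br = N :* N :* (q :* q) :* (# 1 :* # 1 :* # 1) :- y :* y :+ N :* N :* (N :* N) :* (q :* q :* q) :* (# 1 :* # 1)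
                 :- N :* N :* N :* (q :* q) :* y :+ (N :* N :* q :- N :* N :* (N :* N) :* (q :* q :* (q :* q))) :* (# 1 :- # 1)
          in :- (v :* w :* # 1 :* br) := # 0) refl q N (u (suc n)) (u (suc n))

    -- The finite form of the series identity

    signedPower : ℕ → Carrier
    signedPower n = (- 1#) ^ n * q ^ (n ℕ.^ 2 ℕ.+ 2 ℕ.* n)

    signedPower-suc : ∀ n → signedPower (suc n) ≈ signedPower n * - (oddPower n * p)
    signedPower-suc n = begin
      - 1# * (- 1#) ^ n * q ^ (suc n ℕ.^ 2 ℕ.+ 2 ℕ.* suc n)
        ≈⟨ *-congˡ (trans (reflexive (≡.cong (q ^_) exponent)) (trans (^-homo-* q (n ℕ.^ 2 ℕ.+ 2 ℕ.* n) _)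
             (*-congˡ (*-congˡ (*-congˡ (*-congˡ (^-homo-* q n n))))))) ⟩
      - 1# * (- 1#) ^ n * (q ^ (n ℕ.^ 2 ℕ.+ 2 ℕ.* n) * (q * (q * (q * (q ^ n * q ^ n)))))
        ≈⟨ solve 4 (λ s Q q x → :- # 1 :* s :* (Q :* (q :* (q :* (q :* (x :* x))))) := s :* Q :* :- (q :* (x :* x) :* q :^ 2)) refl _ _ q (q ^ n) ⟩
      signedPower n * - (oddPower n * p) ∎
      where
      exponent : suc n ℕ.^ 2 ℕ.+ 2 ℕ.* suc n ≡ n ℕ.^ 2 ℕ.+ 2 ℕ.* n ℕ.+ (3 ℕ.+ (n ℕ.+ n))
      exponent = S.solve 1 (λ n → (S.con 1 S.:+ n) S.:^ 2 S.:+ S.con 2 S.:* (S.con 1 S.:+ n)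
        S.:= n S.:^ 2 S.:+ S.con 2 S.:* n S.:+ (S.con 3 S.:+ (n S.:+ n))) ≡.refl n
        where module S = ℕSolver.+-*-Solver

    oddPower-+ : ∀ r m → oddPower (r ℕ.+ m) ≈ oddPower r * p ^ m
    oddPower-+ r m = trans (*-congˡ (*-cong (^-homo-* q r m) (^-homo-* q r m)))
      (trans (solve 3 (λ q x y → q :* (x :* y :* (x :* y)) := q :* (x :* x) :* (y :* y)) refl _ _ _)
        (*-congˡ (sym (square-^ q m))))

    -- The quadratic exponent is split at `r` so that the part in `m` has the shape (-d)^m
    -- p^(m(m-1)/2) of `chu-vandermonde`, with d = q^(2r+3).
    signedPower-+ : ∀ r m →
      signedPower (r ℕ.+ m) ≈ signedPower r * ((- (oddPower r * p)) ^ m * p ^ triangle m)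
    signedPower-+ r zero    = trans (reflexive (≡.cong signedPower (ℕₚ.+-identityʳ r)))
      (solve 1 (λ s → s := s :* (# 1 :* # 1)) refl _)
    signedPower-+ r (suc m) = begin
      signedPower (r ℕ.+ suc m)
        ≡⟨ ≡.cong signedPower (ℕₚ.+-suc r m) ⟩
      signedPower (suc (r ℕ.+ m))
        ≈⟨ signedPower-suc (r ℕ.+ m) ⟩
      signedPower (r ℕ.+ m) * - (oddPower (r ℕ.+ m) * p)
        ≈⟨ *-cong (signedPower-+ r m) (-‿cong (*-congʳ (oddPower-+ r m))) ⟩
      signedPower r * ((- (oddPower r * p)) ^ m * p ^ triangle m) * - (oddPower r * p ^ m * p)
        ≈⟨ solve 6 (λ s k t z y p → s :* (k :* t) :* :- (z :* y :* p) := s :* (:- (z :* p) :* k :* (y :* t))) refl _ _ _ _ _ p ⟩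
      signedPower r * (- (oddPower r * p) * (- (oddPower r * p)) ^ m * (p ^ m * p ^ triangle m))
        ≈⟨ *-congˡ (*-congˡ (^-homo-* p m (triangle m))) ⟨
      signedPower r * ((- (oddPower r * p)) ^ suc m * p ^ triangle (suc m)) ∎

    -- The signs cancel and r² + 2r + r(3r-1)/2 = r(5r+3)/2. This is where the base q⁵ = q · q⁴
    -- comes from.
    signedPower-pentagonal : ∀ r →
      signedPower r * pentagonal r ≈ (q * q ^ 4) ^ triangle r * (q ^ 4) ^ r
    signedPower-pentagonal zero    = solve 0 (# 1 :* # 1 :* # 1 := # 1 :* # 1) refl
    signedPower-pentagonal (suc r) = begin
      signedPower (suc r) * pentagonal (suc r)
        ≈⟨ *-congʳ (signedPower-suc r) ⟩
      signedPower r * - (oddPower r * p) * - (pentagonal r * (q * (x * x * x)))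
        ≈⟨ solve 4 (λ s g q x → s :* :- (q :* (x :* x) :* q :^ 2) :* :- (g :* (q :* (x :* x :* x)))
             := x :* x :^ 4 :* q :^ 4 :* (s :* g)) refl _ _ q x ⟩
      x * x ^ 4 * q ^ 4 * (signedPower r * pentagonal r)
        ≈⟨ *-cong (*-congʳ (*-congˡ (power-swap q r 4))) (signedPower-pentagonal r) ⟩
      x * (q ^ 4) ^ r * q ^ 4 * ((q * q ^ 4) ^ triangle r * (q ^ 4) ^ r)
        ≈⟨ solve 4 (λ x y t q → x :* y :* q :* (t :* y) := x :* y :* t :* (q :* y)) refl _ _ _ _ ⟩
      x * (q ^ 4) ^ r * (q * q ^ 4) ^ triangle r * (q ^ 4) ^ suc r
        ≈⟨ *-congʳ (trans (^-homo-* (q * q ^ 4) r (triangle r)) (*-congʳ (^-distrib-* q (q ^ 4) r))) ⟨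
      (q * q ^ 4) ^ triangle (suc r) * (q ^ 4) ^ suc r ∎
      where
      x = q ^ r

    module _ {u : ℕ → Carrier} (rec : Reciprocal p u) where
      open Reciprocal rec

      -- The summand of the series: by `poch-double` the last factor, (q;q²)_n/(q²;q²)_(2n), is the
      -- reciprocal of (-q;q²)_n (q⁴;q⁴)_n.
      seriesTerm : ℕ → Carrier
      seriesTerm n = signedPower n * poch q p n * (poch q p n * u (double n))

      -- For fixed r the sum over the series index is `chu-vandermonde` with b = z and d = z p,
      -- where z = q^(2r+1). The parameters fit because b d = p^(2r+2), the first factor that
      -- `u-shift` splits off from the reciprocal at 2r + 1 + k when k = 0.
      finite-identity : ∀ n →
        convolve (λ m l → u l * seriesTerm m) n
          ≈ poch q p (suc n) * convolve (λ r k → thetaTerm q (q ^ 4) r * (u k * u (suc (double r ℕ.+ k)))) n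
      finite-identity n = begin
        convolve (λ m l → u l * seriesTerm m) n
          ≈⟨ convolve-cong n (λ m l _ → trans
               (trans (sym (*-assoc _ _ _)) (*-congˡ (sym (bailey-pair rec m))))
               (sym (convolve-* m (u l * (signedPower m * poch q p m)) _))) ⟩
        convolve (λ m l → convolve (λ r k → u l * (signedPower m * poch q p m) * (bailey r * (u k * u (suc (double r ℕ.+ k))))) m) n
          -- Writing `m` as `r ℕ.+ k` makes the summand a function of the triple, as
          -- `convolve-assoc` requires.
          ≈⟨ convolve-cong n (λ m l _ → convolve-cong m (λ r k r+k≡m →
               reflexive (≡.cong (λ i → u l * (signedPower i * poch q p i) * (bailey r * (u k * u (suc (double r ℕ.+ k))))) (≡.sym r+k≡m)))) ⟩
        convolve (λ m l → convolve (λ r k → h r k l) m) n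
          ≈⟨ convolve-assoc n h ⟩
        convolve (λ r m → convolve (λ k l → h r k l) m) n
          ≈⟨ convolve-cong n (λ r m r+m≡n → trans (inner r m)
               (reflexive (≡.cong (λ i → poch q p i * (thetaTerm q (q ^ 4) r * (u m * u (suc (double r ℕ.+ m)))))
                 (≡.trans (ℕₚ.+-suc r m) (≡.cong suc r+m≡n))))) ⟩
        convolve (λ r k → poch q p (suc n) * (thetaTerm q (q ^ 4) r * (u k * u (suc (double r ℕ.+ k))))) n
          ≈⟨ convolve-* n (poch q p (suc n)) _ ⟩
        poch q p (suc n) * convolve (λ r k → thetaTerm q (q ^ 4) r * (u k * u (suc (double r ℕ.+ k)))) n ∎
        where
        h : ℕ → ℕ → ℕ → Carrier
        h r k l = u l * (signedPower (r ℕ.+ k) * poch q p (r ℕ.+ k)) * (bailey r * (u k * u (suc (double r ℕ.+ k))))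

        inner : ∀ r m → convolve (λ k l → h r k l) m
          ≈ poch q p (r ℕ.+ suc m) * (thetaTerm q (q ^ 4) r * (u m * u (suc (double r ℕ.+ m))))
        inner r m = begin
          convolve (λ k l → h r k l) m
            ≈⟨ convolve-cong m (λ k l k+l≡m → begin
                 h r k l
                   ≈⟨ *-cong (*-congˡ (*-cong (signedPower-+ r k)
                        (trans (poch-+ q p r k) (*-congˡ (poch-cong k q*p^r≈ refl)))))
                        (*-congˡ (*-congˡ (trans (u-shift (suc (double r ℕ.+ k)) l)
                          (*-cong (poch-cong l (exponent k) refl) (reflexive (≡.cong (λ i → u (suc i))
                            (≡.trans (ℕₚ.+-assoc (double r) k l) (≡.cong (double r ℕ.+_) k+l≡m)))))))) ⟩
                 u l * (signedPower r * κ k * (poch q p r * poch z p k))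
                     * (bailey r * (u k * (poch (z * (z * p) * p ^ k) p l * v)))
                   ≈⟨ solve 9 (λ w s k P Q b y T v → w :* (s :* k :* (P :* Q)) :* (b :* (y :* (T :* v)))
                        := s :* P :* b :* v :* (y :* w :* k :* Q :* T)) refl _ _ _ _ _ _ _ _ _ ⟩
                 c * (u k * u l * κ k * poch z p k * poch (z * (z * p) * p ^ k) p l) ∎) ⟩
          convolve (λ k l → c * (u k * u l * κ k * poch z p k * poch (z * (z * p) * p ^ k) p l)) m
            ≈⟨ convolve-* m c _ ⟩
          c * convolve (λ k l → u k * u l * κ k * poch z p k * poch (z * (z * p) * p ^ k) p l) m
            ≈⟨ *-congˡ (chu-vandermonde rec m z (z * p)) ⟩
          signedPower r * poch q p r * (pentagonal r * (1# - z * z)) * v * (poch (z * p) p m * u m)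
            -- The factor 1 - q^(4r+2) = (1 - z)(1 + z) is shared out: 1 - z completes (q;p) to n +
            -- 1 factors, a length independent of r, and 1 + z joins the two theta terms.
            ≈⟨ solve 7 (λ s P g z v T y → s :* P :* (g :* (# 1 :- z :* z)) :* v :* (T :* y)
                 := P :* ((# 1 :- z) :* T) :* (s :* g :* (# 1 :+ z) :* (y :* v))) refl _ _ _ z _ _ _ ⟩
          poch q p r * ((1# - z) * poch (z * p) p m) * (signedPower r * pentagonal r * (1# + z) * (u m * v))
            ≈⟨ *-cong
                 (trans (*-congˡ (trans (sym (poch-front z p m)) (poch-cong (suc m) (sym q*p^r≈) refl)))
                   (sym (poch-+ q p r (suc m))))
                 (*-congʳ (*-congʳ (signedPower-pentagonal r))) ⟩
          poch q p (r ℕ.+ suc m) * (thetaTerm q (q ^ 4) r * (u m * v)) ∎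
          where
          z = oddPower r
          v = u (suc (double r ℕ.+ m))
          κ : ℕ → Carrier
          κ k = (- (z * p)) ^ k * p ^ triangle k
          c = signedPower r * poch q p r * bailey r * v
          q*p^r≈ : q * p ^ r ≈ z
          q*p^r≈ = *-congˡ (square-^ q r)
          exponent : ∀ k → p ^ suc (suc (double r ℕ.+ k)) ≈ z * (z * p) * p ^ k
          exponent k = trans (*-congˡ (*-congˡ (trans (^-homo-* p (double r) k)
              (*-congʳ (trans (^-double p r) (*-cong (square-^ q r) (square-^ q r)))))))
            (solve 3 (λ q x y → q :^ 2 :* (q :^ 2 :* (x :* x :* (x :* x) :* y))
               := q :* (x :* x) :* (q :* (x :* x) :* q :^ 2) :* y) refl q (q ^ r) (p ^ k))

  -- Of the factors of (q²;q²)_(2n), those with exponent 4j + 2 split as (1 - q^(2j+1))(1 +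
  -- q^(2j+1)), and those with exponent 4j + 4 belong to (q⁴;q⁴)_n.
  poch-double : ∀ q n → poch (q ^ 2) (q ^ 2) (double n)
    ≈ poch (- q) (q ^ 2) n * poch (q ^ 4) (q ^ 4) n * poch q (q ^ 2) n
  poch-double q zero    = solve 0 (# 1 := # 1 :* # 1 :* # 1) refl
  poch-double q (suc n) = begin
    poch p p (suc (suc (double n)))
      ≈⟨ trans (poch-suc p p (suc (double n))) (*-congʳ (poch-suc p p (double n))) ⟩
    poch p p (double n) * (1# - p * p ^ double n) * (1# - p * (p * p ^ double n))
      ≈⟨ *-cong (*-cong (poch-double q n) (+-congˡ (-‿cong (*-congˡ p^≈)))) (+-congˡ (-‿cong (*-congˡ (*-congˡ p^≈)))) ⟩
    P * Q * S * (1# - p * (x * x * (x * x))) * (1# - p * (p * (x * x * (x * x))))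
      ≈⟨ solve 5 (λ q x P Q S →
           P :* Q :* S :* (# 1 :- q :^ 2 :* (x :* x :* (x :* x))) :* (# 1 :- q :^ 2 :* (q :^ 2 :* (x :* x :* (x :* x))))
           := P :* (# 1 :- (:- q) :* (x :* x)) :* (Q :* (# 1 :- q :^ 4 :* x :^ 4)) :* (S :* (# 1 :- q :* (x :* x))))
           refl q x P Q S ⟩
    P * (1# - - q * (x * x)) * (Q * (1# - q ^ 4 * x ^ 4)) * (S * (1# - q * (x * x)))
      ≈⟨ *-cong (*-cong (*-congˡ (+-congˡ (-‿cong (*-congˡ (square-^ q n)))))
                        (*-congˡ (+-congˡ (-‿cong (*-congˡ (power-swap q 4 n))))))
                (*-congˡ (+-congˡ (-‿cong (*-congˡ (square-^ q n))))) ⟨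
    P * (1# - - q * p ^ n) * (Q * (1# - q ^ 4 * (q ^ 4) ^ n)) * (S * (1# - q * p ^ n))
      ≈⟨ *-cong (*-cong (poch-suc (- q) p n) (poch-suc (q ^ 4) (q ^ 4) n)) (poch-suc q p n) ⟨
    poch (- q) p (suc n) * poch (q ^ 4) (q ^ 4) (suc n) * poch q p (suc n) ∎
    where
    p = q ^ 2
    x = q ^ n
    P = poch (- q) p n
    Q = poch (q ^ 4) (q ^ 4) n
    S = poch q p n
    p^≈ : p ^ double n ≈ x * x * (x * x)
    p^≈ = trans (^-double p n) (*-cong (square-^ q n) (square-^ q n))

-- Ordered arithmetic of ℚ and geometric bounds

module Rationals where
  open import Algebra.Structures using (IsCommutativeRing)
  open import Data.Integer.Base as ℤ using (+_; -[1+_])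
  import Data.Integer.Properties as ℤₚ
  open import Data.Rational.Base using (mkℚ; toℚᵘ)
  import Data.Rational.Unnormalised.Base as ℚᵘ
  import Data.Rational.Unnormalised.Properties as ℚᵘₚ
  open ≡ using (refl; sym; trans; cong; cong₂; subst; subst₂)
  open Defs using (recip; recip-inverseʳ; recip-pos)

  infixl 6 _⊕_ _⊝_
  infixl 7 _⊗_
  infix  8 ⊖_

  -- ℚ is a record with eta, so its operations unfold even on variables;
  -- opaque copies keep the terms below small.
  opaque
    _⊕_ : ℚ → ℚ → ℚ
    _⊕_ = ℚ._+_

    _⊗_ : ℚ → ℚ → ℚ
    _⊗_ = ℚ._*_

    ⊖_ : ℚ → ℚ
    ⊖_ = ℚ.-_

  _⊝_ : ℚ → ℚ → ℚ
  p ⊝ q = p ⊕ ⊖ q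

  opaque
    unfolding _⊕_

    ⊕-⊗-isCommutativeRing : IsCommutativeRing _≡_ _⊕_ _⊗_ ⊖_ 0ℚ 1ℚ
    ⊕-⊗-isCommutativeRing = ℚₚ.+-*-isCommutativeRing

    ⊕-mono-≤ : ∀ {p q r s} → p ℚ.≤ q → r ℚ.≤ s → p ⊕ r ℚ.≤ q ⊕ s
    ⊕-mono-≤ = ℚₚ.+-mono-≤

    ⊕-mono-<-≤ : ∀ {p q r s} → p ℚ.< q → r ℚ.≤ s → p ⊕ r ℚ.< q ⊕ s
    ⊕-mono-<-≤ = ℚₚ.+-mono-<-≤

    ⊗-monoˡ-≤ : ∀ {p q} r → 0ℚ ℚ.≤ r → p ℚ.≤ q → r ⊗ p ℚ.≤ r ⊗ q
    ⊗-monoˡ-≤ r 0≤r = ℚₚ.*-monoˡ-≤-nonNeg r {{ℚ.nonNegative 0≤r}}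

    ⊗-pos : ∀ {p q} → 0ℚ ℚ.< p → 0ℚ ℚ.< q → 0ℚ ℚ.< p ⊗ q
    ⊗-pos = Defs.*-pos

    ⊗-cancelˡ-≤ : ∀ {p q} r → 0ℚ ℚ.< r → r ⊗ p ℚ.≤ r ⊗ q → p ℚ.≤ q
    ⊗-cancelˡ-≤ r 0<r = ℚₚ.*-cancelˡ-≤-pos r {{ℚ.positive 0<r}}

    ⊗-recip : ∀ {p} → 0ℚ ℚ.< p → p ⊗ recip p ≡ 1ℚ
    ⊗-recip = recip-inverseʳ

    ½⊕½≡1 : ½ ⊕ ½ ≡ 1ℚ
    ½⊕½≡1 = refl

    toℚᵘ-⊕ : ∀ p q → toℚᵘ (p ⊕ q) ℚᵘ.≃ toℚᵘ p ℚᵘ.+ toℚᵘ q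
    toℚᵘ-⊕ = ℚₚ.toℚᵘ-homo-+

  ℚ-commutativeRing : CommutativeRing 0ℓ 0ℓ
  ℚ-commutativeRing = record { isCommutativeRing = ⊕-⊗-isCommutativeRing }

  module ℚR = CommutativeRing ℚ-commutativeRing
  module ℚSolver = ℤ-Solver ℚ-commutativeRing
  open FiniteSums ℚ-commutativeRing public using () renaming (_^_ to _^ℚ_; ^-homo-* to ^ℚ-homo-*)

  0<1ℚ : 0ℚ ℚ.< 1ℚ
  0<1ℚ = ℚₚ.positive⁻¹ 1ℚ

  0≤1ℚ : 0ℚ ℚ.≤ 1ℚ
  0≤1ℚ = ℚₚ.<⇒≤ 0<1ℚ

  0<½ : 0ℚ ℚ.< ½
  0<½ = ℚₚ.positive⁻¹ ½

  ½-pos : ∀ {p} → 0ℚ ℚ.< p → 0ℚ ℚ.< ½ ⊗ p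
  ½-pos = ⊗-pos 0<½

  halves : ∀ p → ½ ⊗ p ⊕ ½ ⊗ p ≡ p
  halves p = trans (sym (ℚR.distribʳ p ½ ½)) (trans (cong (_⊗ p) ½⊕½≡1) (ℚR.*-identityˡ p))

  ⊗-monoʳ-≤ : ∀ {p q} r → 0ℚ ℚ.≤ r → p ℚ.≤ q → p ⊗ r ℚ.≤ q ⊗ r
  ⊗-monoʳ-≤ {p} {q} r 0≤r p≤q = subst₂ ℚ._≤_ (ℚR.*-comm r p) (ℚR.*-comm r q) (⊗-monoˡ-≤ r 0≤r p≤q)

  ⊗-nonNeg : ∀ {p q} → 0ℚ ℚ.≤ p → 0ℚ ℚ.≤ q → 0ℚ ℚ.≤ p ⊗ q
  ⊗-nonNeg {p} {q} 0≤p 0≤q = subst (ℚ._≤ p ⊗ q) (ℚR.zeroʳ p) (⊗-monoˡ-≤ p 0≤p 0≤q)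

  ⊕-nonNeg : ∀ {p q} → 0ℚ ℚ.≤ p → 0ℚ ℚ.≤ q → 0ℚ ℚ.≤ p ⊕ q
  ⊕-nonNeg {p} {q} 0≤p 0≤q = subst (ℚ._≤ p ⊕ q) (ℚR.+-identityʳ 0ℚ) (⊕-mono-≤ 0≤p 0≤q)

  ⊕-pos : ∀ {p q} → 0ℚ ℚ.< p → 0ℚ ℚ.≤ q → 0ℚ ℚ.< p ⊕ q
  ⊕-pos {p} {q} 0<p 0≤q = subst (ℚ._< p ⊕ q) (ℚR.+-identityʳ 0ℚ) (⊕-mono-<-≤ 0<p 0≤q)

  p≤p⊕q : ∀ {p q} → 0ℚ ℚ.≤ q → p ℚ.≤ p ⊕ q
  p≤p⊕q {p} {q} 0≤q = subst (ℚ._≤ p ⊕ q) (ℚR.+-identityʳ p) (⊕-mono-≤ (ℚₚ.≤-refl {p}) 0≤q)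

  difference⇒≤ : ∀ {p q} d → 0ℚ ℚ.≤ d → q ≡ p ⊕ d → p ℚ.≤ q
  difference⇒≤ {p} d 0≤d q≡p⊕d = subst (p ℚ.≤_) (sym q≡p⊕d) (p≤p⊕q 0≤d)

  p≤q⇒0≤q⊝p : ∀ {p q} → p ℚ.≤ q → 0ℚ ℚ.≤ q ⊝ p
  p≤q⇒0≤q⊝p {p} {q} p≤q = subst (ℚ._≤ q ⊝ p) (ℚR.-‿inverseʳ p) (⊕-mono-≤ p≤q ℚₚ.≤-refl)

  p<q⇒0<q⊝p : ∀ {p q} → p ℚ.< q → 0ℚ ℚ.< q ⊝ p
  p<q⇒0<q⊝p {p} {q} p<q = subst (ℚ._< q ⊝ p) (ℚR.-‿inverseʳ p) (⊕-mono-<-≤ p<q ℚₚ.≤-refl)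

  ⊗-recip-cancel : ∀ p {q} → 0ℚ ℚ.< q → p ⊗ recip q ⊗ q ≡ p
  ⊗-recip-cancel p {q} 0<q = trans (ℚR.*-assoc p (recip q) q)
    (trans (cong (p ⊗_) (trans (ℚR.*-comm (recip q) q) (⊗-recip 0<q))) (ℚR.*-identityʳ p))

  fromℕ : ℕ → ℚ
  fromℕ zero    = 0ℚ
  fromℕ (suc n) = 1ℚ ⊕ fromℕ n

  0≤fromℕ : ∀ n → 0ℚ ℚ.≤ fromℕ n
  0≤fromℕ zero    = ℚₚ.≤-refl
  0≤fromℕ (suc n) = ⊕-nonNeg 0≤1ℚ (0≤fromℕ n)

  0<fromℕ-suc : ∀ n → 0ℚ ℚ.< fromℕ (suc n)
  0<fromℕ-suc n = ⊕-pos 0<1ℚ (0≤fromℕ n)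

  fromℕ≃ : ∀ n → toℚᵘ (fromℕ n) ℚᵘ.≃ ℚᵘ.mkℚᵘ (+ n) 0
  fromℕ≃ zero    = ℚᵘₚ.≃-refl
  fromℕ≃ (suc n) = ℚᵘₚ.≃-trans (toℚᵘ-⊕ 1ℚ (fromℕ n))
    (ℚᵘₚ.≃-trans (ℚᵘₚ.+-congʳ (toℚᵘ 1ℚ) (fromℕ≃ n))
      (ℚᵘ.*≡* (cong (λ i → (+ 1 ℤ.+ i) ℤ.* + 1) (ℤₚ.*-identityʳ (+ n)))))

  -- A nonnegative fraction is at most its numerator.
  archimedean : ∀ p → ∃[ n ] p ℚ.≤ fromℕ n
  archimedean p@(mkℚ (+ n) d _) = n , ℚₚ.toℚᵘ-cancel-≤
    (ℚᵘₚ.≤-respʳ-≃ (ℚᵘₚ.≃-sym (fromℕ≃ n)) (ℚᵘ.*≤* (ℤₚ.*-monoˡ-≤-nonNeg (+ n) (ℤ.+≤+ (s≤s z≤n)))))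
  archimedean p@(mkℚ -[1+ n ] d _) = 0 , ℚₚ.nonPositive⁻¹ p

  ^ℚ-nonNeg : ∀ {ρ} → 0ℚ ℚ.≤ ρ → ∀ n → 0ℚ ℚ.≤ ρ ^ℚ n
  ^ℚ-nonNeg 0≤ρ zero    = 0≤1ℚ
  ^ℚ-nonNeg 0≤ρ (suc n) = ⊗-nonNeg 0≤ρ (^ℚ-nonNeg 0≤ρ n)

  module GeometricBounds {ρ : ℚ} (0≤ρ : 0ℚ ℚ.≤ ρ) (ρ<1 : ρ ℚ.< 1ℚ) where
    open ℚₚ.≤-Reasoning
    open ℚSolver

    κ : ℚ
    κ = recip (1ℚ ⊝ ρ)

    0<1-ρ : 0ℚ ℚ.< 1ℚ ⊝ ρ
    0<1-ρ = p<q⇒0<q⊝p ρ<1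

    0<κ : 0ℚ ℚ.< κ
    0<κ = recip-pos 0<1-ρ

    0≤κ : 0ℚ ℚ.≤ κ
    0≤κ = ℚₚ.<⇒≤ 0<κ

    [1-ρ]κ≡1 : (1ℚ ⊝ ρ) ⊗ κ ≡ 1ℚ
    [1-ρ]κ≡1 = ⊗-recip 0<1-ρ

    geometric : ℕ → ℚ
    geometric zero    = 0ℚ
    geometric (suc n) = geometric n ⊕ ρ ^ℚ n

    geometric-closed : ∀ n → geometric n ⊗ (1ℚ ⊝ ρ) ⊕ ρ ^ℚ n ≡ 1ℚ
    geometric-closed zero    = solve 1 (λ r → # 0 :* (# 1 :- r) :+ # 1 := # 1) refl ρ
    geometric-closed (suc n) = trans
      (solve 3 (λ g x r → (g :+ x) :* (# 1 :- r) :+ r :* x := g :* (# 1 :- r) :+ x) refl (geometric n) (ρ ^ℚ n) ρ)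
      (geometric-closed n)

    geometric≤κ : ∀ n → geometric n ℚ.≤ κ
    geometric≤κ n = difference⇒≤ (ρ ^ℚ n ⊗ κ) (⊗-nonNeg (^ℚ-nonNeg 0≤ρ n) 0≤κ) (begin-equality
      κ
        ≡⟨ ℚR.*-identityˡ κ ⟨
      1ℚ ⊗ κ
        ≡⟨ cong (_⊗ κ) (geometric-closed n) ⟨
      (geometric n ⊗ (1ℚ ⊝ ρ) ⊕ ρ ^ℚ n) ⊗ κ
        ≡⟨ solve 4 (λ g d x k → (g :* d :+ x) :* k := g :* (d :* k) :+ x :* k) refl (geometric n) (1ℚ ⊝ ρ) (ρ ^ℚ n) κ ⟩
      geometric n ⊗ ((1ℚ ⊝ ρ) ⊗ κ) ⊕ ρ ^ℚ n ⊗ κ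
        ≡⟨ cong (_⊕ ρ ^ℚ n ⊗ κ) (trans (cong (geometric n ⊗_) [1-ρ]κ≡1) (ℚR.*-identityʳ (geometric n))) ⟩
      geometric n ⊕ ρ ^ℚ n ⊗ κ ∎)

    ^ℚ-suc-≤ : ∀ n → ρ ^ℚ suc n ℚ.≤ ρ ^ℚ n
    ^ℚ-suc-≤ n = subst (ρ ⊗ ρ ^ℚ n ℚ.≤_) (ℚR.*-identityˡ _) (⊗-monoʳ-≤ _ (^ℚ-nonNeg 0≤ρ n) (ℚₚ.<⇒≤ ρ<1))

    ^ℚ-antitone-+ : ∀ m k → ρ ^ℚ (m ℕ.+ k) ℚ.≤ ρ ^ℚ m
    ^ℚ-antitone-+ m zero    = ℚₚ.≤-reflexive (cong (ρ ^ℚ_) (ℕₚ.+-identityʳ m))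
    ^ℚ-antitone-+ m (suc k) = ℚₚ.≤-trans
      (ℚₚ.≤-reflexive (cong (ρ ^ℚ_) (ℕₚ.+-suc m k)))
      (ℚₚ.≤-trans (^ℚ-suc-≤ (m ℕ.+ k)) (^ℚ-antitone-+ m k))

    ^ℚ-antitone : ∀ {m n} → m ℕ.≤ n → ρ ^ℚ n ℚ.≤ ρ ^ℚ m
    ^ℚ-antitone {m} {n} m≤n = subst (λ k → ρ ^ℚ k ℚ.≤ ρ ^ℚ m) (ℕₚ.m+[n∸m]≡n m≤n) (^ℚ-antitone-+ m (n ℕ.∸ m))

    ^ℚ≤1 : ∀ n → ρ ^ℚ n ℚ.≤ 1ℚ
    ^ℚ≤1 n = ^ℚ-antitone {0} {n} z≤n

    -- Each of the n summands ρ^j is at least ρ^n. As the geometric sums stay below `κ`, this bounds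
    -- ρ^n by κ/n without logarithms.
    n*ρ^n≤geometric : ∀ n → fromℕ n ⊗ ρ ^ℚ n ℚ.≤ geometric n
    n*ρ^n≤geometric zero    = ℚₚ.≤-reflexive (ℚR.zeroˡ 1ℚ)
    n*ρ^n≤geometric (suc n) = begin
      (1ℚ ⊕ fromℕ n) ⊗ ρ ^ℚ suc n            ≤⟨ ⊗-monoˡ-≤ _ (0≤fromℕ (suc n)) (^ℚ-suc-≤ n) ⟩
      (1ℚ ⊕ fromℕ n) ⊗ ρ ^ℚ n                ≡⟨ solve 2 (λ k x → (# 1 :+ k) :* x := k :* x :+ x) refl (fromℕ n) (ρ ^ℚ n) ⟩
      fromℕ n ⊗ ρ ^ℚ n ⊕ ρ ^ℚ n              ≤⟨ ⊕-mono-≤ (n*ρ^n≤geometric n) ℚₚ.≤-refl ⟩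
      geometric n ⊕ ρ ^ℚ n                     ∎

    ^ℚ-small : ∀ K {ε} → 0ℚ ℚ.≤ K → 0ℚ ℚ.< ε → ∃[ N ] (∀ n → N ℕ.≤ n → K ⊗ ρ ^ℚ n ℚ.≤ ε)
    -- N ≥ Kκ/ε is enough, since K ρ^(N+1) ≤ Kκ/(N+1).
    ^ℚ-small K {ε} 0≤K 0<ε with archimedean (K ⊗ κ ⊗ recip ε)
    ... | N , KκE≤N = suc N , λ n N<n →
      ⊗-cancelˡ-≤ (fromℕ (suc N)) (0<fromℕ-suc N) (begin
        fromℕ (suc N) ⊗ (K ⊗ ρ ^ℚ n)
          ≤⟨ ⊗-monoˡ-≤ _ (0≤fromℕ (suc N)) (⊗-monoˡ-≤ K 0≤K (^ℚ-antitone N<n)) ⟩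
        fromℕ (suc N) ⊗ (K ⊗ ρ ^ℚ suc N)
          ≡⟨ solve 3 (λ a b c → a :* (b :* c) := b :* (a :* c)) refl (fromℕ (suc N)) K (ρ ^ℚ suc N) ⟩
        K ⊗ (fromℕ (suc N) ⊗ ρ ^ℚ suc N)
          ≤⟨ ⊗-monoˡ-≤ K 0≤K (ℚₚ.≤-trans (n*ρ^n≤geometric (suc N)) (geometric≤κ (suc N))) ⟩
        K ⊗ κ
          ≡⟨ ⊗-recip-cancel (K ⊗ κ) 0<ε ⟨
        K ⊗ κ ⊗ recip ε ⊗ ε
          ≤⟨ ⊗-monoʳ-≤ ε (ℚₚ.<⇒≤ 0<ε) KκE≤N ⟩
        fromℕ N ⊗ ε
          ≤⟨ ⊗-monoʳ-≤ ε (ℚₚ.<⇒≤ 0<ε) (difference⇒≤ 1ℚ 0≤1ℚ (ℚR.+-comm 1ℚ (fromℕ N))) ⟩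
        fromℕ (suc N) ⊗ ε ∎)

open Rationals

-- Complete normed rings and their limits

open Defs using (recip; recip-pos)

-- ∥ z ∥≤ r stands for |z| ≤ r: rational upper bounds replace the real-valued norm.
record CompleteNorm (R : CommutativeRing 0ℓ 0ℓ) : Set₁ where
  open CommutativeRing R
  infix 4 ∥_∥≤_ _↝_
  field
    ∥_∥≤_      : Carrier → ℚ → Set
    norm-cong  : ∀ {z w r} → z ≈ w → ∥ z ∥≤ r → ∥ w ∥≤ r
    norm-≤     : ∀ {z r s} → r ℚ.≤ s → ∥ z ∥≤ r → ∥ z ∥≤ s
    norm-≥0    : ∀ {z r} → ∥ z ∥≤ r → 0ℚ ℚ.≤ r
    norm-1     : ∥ 1# ∥≤ 1ℚ
    norm-+     : ∀ {z w r s} → ∥ z ∥≤ r → ∥ w ∥≤ s → ∥ z + w ∥≤ r ⊕ s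
    norm-*     : ∀ {z w r s} → ∥ z ∥≤ r → ∥ w ∥≤ s → ∥ z * w ∥≤ r ⊗ s
    norm-neg   : ∀ {z r} → ∥ z ∥≤ r → ∥ - z ∥≤ r
    norm-0⇒≈0  : ∀ {z} → ∥ z ∥≤ 0ℚ → z ≈ 0#
    norm-0     : ∥ 0# ∥≤ 0ℚ
    -- Closedness of balls: through `↝-bounded` it passes bounds to limits and makes limits unique.
    norm-limit : ∀ {z r} → (∀ ε → 0ℚ ℚ.< ε → ∥ z ∥≤ r ⊕ ε) → ∥ z ∥≤ r
    norm-bound : ∀ z → ∃[ r ] ∥ z ∥≤ r

  _↝_ : (ℕ → Carrier) → Carrier → Set
  s ↝ L = ∀ ε → 0ℚ ℚ.< ε → ∃[ N ] (∀ n → N ℕ.≤ n → ∥ s n - L ∥≤ ε)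

  field
    complete : ∀ s → (∀ ε → 0ℚ ℚ.< ε → ∃[ N ] (∀ n → N ℕ.≤ n → ∥ s n - s N ∥≤ ε)) → ∃[ L ] s ↝ L

module Limits {R : CommutativeRing 0ℓ 0ℓ} (norm : CompleteNorm R) where
  open CommutativeRing R
  open CompleteNorm norm public
  open ℤ-Solver R
  open FiniteSums R
  open import Relation.Binary.Reasoning.Setoid setoid

  norm-≡ : ∀ {z r s} → r ≡ s → ∥ z ∥≤ r → ∥ z ∥≤ s
  norm-≡ ≡.refl b = b

  norm-swap : ∀ {z w r} → ∥ z - w ∥≤ r → ∥ w - z ∥≤ r
  norm-swap b = norm-cong (solve 2 (λ z w → :- (z :- w) := w :- z) refl _ _) (norm-neg b)

  ↝-cong : ∀ {s t L M} → (∀ n → s n ≈ t n) → L ≈ M → s ↝ L → t ↝ M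
  ↝-cong s≈t L≈M s↝L ε 0<ε with s↝L ε 0<ε
  ... | N , close = N , λ n N≤n → norm-cong (+-cong (s≈t n) (-‿cong L≈M)) (close n N≤n)

  ↝-const : ∀ c → (λ _ → c) ↝ c
  ↝-const c ε 0<ε = 0 , λ _ _ → norm-≤ (ℚₚ.<⇒≤ 0<ε) (norm-cong (sym (-‿inverseʳ c)) norm-0)

  ↝-+ : ∀ {s t L M} → s ↝ L → t ↝ M → (λ n → s n + t n) ↝ L + M
  ↝-+ s↝L t↝M ε 0<ε with s↝L (½ ⊗ ε) (½-pos 0<ε) | t↝M (½ ⊗ ε) (½-pos 0<ε)
  ... | N₁ , close₁ | N₂ , close₂ = N₁ ℕ.⊔ N₂ , λ n ≤n → norm-≡ (halves ε)
    (norm-cong (solve 4 (λ a b c d → (a :- b) :+ (c :- d) := (a :+ c) :- (b :+ d)) refl _ _ _ _)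
      (norm-+ (close₁ n (ℕₚ.m⊔n≤o⇒m≤o N₁ N₂ ≤n)) (close₂ n (ℕₚ.m⊔n≤o⇒n≤o N₁ N₂ ≤n))))

  ↝-* : ∀ {s t L M} → s ↝ L → t ↝ M → (λ n → s n * t n) ↝ L * M
  ↝-* {s} {t} {L} {M} s↝L t↝M ε 0<ε with norm-bound L | norm-bound M
  ... | B , ∥L∥≤B | C , ∥M∥≤C = N₁ ℕ.⊔ (N₂ ℕ.⊔ N₃) , λ n ≤n →
    let ≤n′ = ℕₚ.m⊔n≤o⇒n≤o N₁ (N₂ ℕ.⊔ N₃) ≤n
        ds  = close₁ n (ℕₚ.m⊔n≤o⇒m≤o N₁ (N₂ ℕ.⊔ N₃) ≤n)
        dt  = close₂ n (ℕₚ.m⊔n≤o⇒m≤o N₂ N₃ ≤n′)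
        ∥t∥ = norm-cong (solve 2 (λ a b → a :- b :+ b := a) refl _ _)
                (norm-+ (close₃ n (ℕₚ.m⊔n≤o⇒n≤o N₂ N₃ ≤n′)) ∥M∥≤C)
    in norm-≡ (≡.trans (≡.cong₂ _⊕_ (⊗-recip-cancel _ 0<1+C)
                  (≡.trans (ℚR.*-comm (1ℚ ⊕ B) _) (⊗-recip-cancel _ 0<1+B))) (halves ε))
      (norm-cong (solve 4 (λ a b c d → (a :- b) :* c :+ b :* (c :- d) := a :* c :- b :* d) refl (s n) L (t n) M)
        (norm-+ (norm-* ds ∥t∥) (norm-* (norm-≤ B≤1+B ∥L∥≤B) dt)))
    where
    0<1+C = ⊕-pos 0<1ℚ (norm-≥0 ∥M∥≤C)
    0<1+B = ⊕-pos 0<1ℚ (norm-≥0 ∥L∥≤B)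
    B≤1+B = difference⇒≤ 1ℚ 0≤1ℚ (ℚR.+-comm 1ℚ B)
    -- The terms of `t` are eventually bounded by 1 + C, from `lim₃`; `B` is raised to 1 + B because
    -- `B` may be 0.
    lim₁ = s↝L (½ ⊗ ε ⊗ recip (1ℚ ⊕ C)) (⊗-pos (½-pos 0<ε) (recip-pos 0<1+C))
    lim₂ = t↝M (½ ⊗ ε ⊗ recip (1ℚ ⊕ B)) (⊗-pos (½-pos 0<ε) (recip-pos 0<1+B))
    lim₃ = t↝M 1ℚ 0<1ℚ
    N₁ = proj₁ lim₁
    N₂ = proj₁ lim₂
    N₃ = proj₁ lim₃
    close₁ = proj₂ lim₁
    close₂ = proj₂ lim₂
    close₃ = proj₂ lim₃

  ↝-neg : ∀ {s L} → s ↝ L → (λ n → - s n) ↝ - L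
  ↝-neg s↝L ε 0<ε with s↝L ε 0<ε
  ... | N , close = N , λ n N≤n →
    norm-cong (solve 2 (λ a b → :- (a :- b) := :- a :- :- b) refl _ _) (norm-neg (close n N≤n))

  ↝-bounded : ∀ {s L r} → (∀ n → ∥ s n ∥≤ r) → s ↝ L → ∥ L ∥≤ r
  ↝-bounded {s} {L} bounded s↝L = norm-limit λ ε 0<ε →
    let N , close = s↝L ε 0<ε
    in norm-cong (solve 2 (λ a b → a :+ (b :- a) := b) refl (s N) L)
         (norm-+ (bounded N) (norm-swap (close N ℕₚ.≤-refl)))

  -- The zero sequence s - s converges to L - M, which therefore has norm bound 0.
  ↝-unique : ∀ {s L M} → s ↝ L → s ↝ M → L ≈ M
  ↝-unique {s} {L} {M} s↝L s↝M = begin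
    L            ≈⟨ solve 2 (λ a b → a := (a :- b) :+ b) refl L M ⟩
    (L - M) + M  ≈⟨ +-congʳ (norm-0⇒≈0 (↝-bounded
                      (λ n → norm-cong (sym (-‿inverseʳ (s n))) norm-0) (↝-+ s↝L (↝-neg s↝M)))) ⟩
    0# + M       ≈⟨ +-identityˡ M ⟩
    M            ∎

  ↝-reindex : ∀ {s L} (f : ℕ → ℕ) → (∀ n → n ℕ.≤ f n) → s ↝ L → (λ n → s (f n)) ↝ L
  ↝-reindex f n≤fn s↝L ε 0<ε with s↝L ε 0<ε
  ... | N , close = N , λ n N≤n → close (f n) (ℕₚ.≤-trans N≤n (n≤fn n))

  ↝-unshift : ∀ {s L} → (λ n → s (suc n)) ↝ L → s ↝ L
  ↝-unshift s↝L ε 0<ε with s↝L ε 0<ε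
  ... | N , close = suc N , λ { (suc n) (s≤s N≤n) → close n N≤n }

  ↝-difference : ∀ {s t L} → (λ n → s n - t n) ↝ 0# → t ↝ L → s ↝ L
  ↝-difference d↝0 t↝L = ↝-cong (λ n → solve 2 (λ a b → a :- b :+ b := a) refl _ _) (+-identityˡ _) (↝-+ d↝0 t↝L)

  -- Geometric rates, infinite products and reciprocals

  module WithRatio {ρ : ℚ} (0≤ρ : 0ℚ ℚ.≤ ρ) (ρ<1 : ρ ℚ.< 1ℚ) where
    open GeometricBounds 0≤ρ ρ<1
    private
      module S = ℚSolver

    0≤ρ^ : ∀ n → 0ℚ ℚ.≤ ρ ^ℚ n
    0≤ρ^ = ^ℚ-nonNeg 0≤ρ

    norm-^ : ∀ {z r} → ∥ z ∥≤ r → ∀ n → ∥ z ^ n ∥≤ r ^ℚ n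
    norm-^ b zero    = norm-1
    norm-^ b (suc n) = norm-* b (norm-^ b n)

    rate-nonNeg : ∀ {z K} → ∥ z ∥≤ K ⊗ ρ ^ℚ 0 → 0ℚ ℚ.≤ K
    rate-nonNeg {K = K} b = ≡.subst (0ℚ ℚ.≤_) (ℚR.*-identityʳ K) (norm-≥0 b)

    rate⇒null : ∀ {s} K → (∀ n → ∥ s n ∥≤ K ⊗ ρ ^ℚ n) → s ↝ 0#
    rate⇒null {s} K bounded ε 0<ε = proj₁ small , λ n N≤n → norm-≤ (proj₂ small n N≤n)
      (norm-cong (solve 1 (λ a → a := a :- # 0) refl (s n)) (bounded n))
      where
      small = ^ℚ-small K (rate-nonNeg (bounded 0)) 0<ε

    -- A bound and a geometric rate are part of the data: the weights of the finite sums must be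
    -- within O(ρ^k) of 1 uniformly in n, which mere convergence would not give.
    record Converges (s : ℕ → Carrier) : Set where
      field
        limit   : Carrier
        bound   : ℚ
        speed   : ℚ
        bounded : ∀ n → ∥ s n ∥≤ bound
        rate    : ∀ n → ∥ s n - limit ∥≤ speed ⊗ ρ ^ℚ n

      0≤speed : 0ℚ ℚ.≤ speed
      0≤speed = rate-nonNeg (rate 0)

      converges : s ↝ limit
      converges = ↝-cong (λ n → solve 2 (λ a b → a :- b :+ b := a) refl _ _) (+-identityˡ _)
        (↝-+ (rate⇒null speed rate) (↝-const limit))

      limit-bounded : ∥ limit ∥≤ bound
      limit-bounded = ↝-bounded bounded converges

    -- Any later term differs from `s n` by at most K ρ^n times a geometric sum, hence by at most K
    -- κ ρ^n; letting the later index grow turns this into the rate towards the limit.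
    geometric-steps⇒converges : ∀ s K M → (∀ n → ∥ s n ∥≤ M) →
      (∀ n → ∥ s (suc n) - s n ∥≤ K ⊗ ρ ^ℚ n) → Converges s
    geometric-steps⇒converges s K M bounded steps = record
      { limit = L ; bound = M ; speed = K ⊗ κ ; bounded = bounded
      ; rate  = λ n → norm-swap (↝-bounded (λ k → far n k)
          (↝-+ (↝-reindex (n ℕ.+_) (λ k → ℕₚ.m≤n+m k n) s↝L) (↝-const (- s n)))) }
      where
      0≤K : 0ℚ ℚ.≤ K
      0≤K = rate-nonNeg (steps 0)
      far′ : ∀ n k → ∥ s (n ℕ.+ k) - s n ∥≤ K ⊗ ρ ^ℚ n ⊗ geometric k
      far′ n zero    = norm-cong
        (trans (sym (-‿inverseʳ (s n))) (+-congʳ (reflexive (≡.cong s (≡.sym (ℕₚ.+-identityʳ n))))))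
        (norm-≤ (⊗-nonNeg (⊗-nonNeg 0≤K (0≤ρ^ n)) ℚₚ.≤-refl) norm-0)
      far′ n (suc k) = norm-≡
        (≡.trans (≡.cong₂ _⊕_ (≡.cong (K ⊗_) (^ℚ-homo-* ρ n k)) ≡.refl)
          (S.solve 4 (λ K a b g → K S.:* (a S.:* b) S.:+ K S.:* a S.:* g S.:= K S.:* a S.:* (g S.:+ b)) ≡.refl
            K (ρ ^ℚ n) (ρ ^ℚ k) (geometric k)))
        (norm-cong (trans (solve 3 (λ a b c → (a :- b) :+ (b :- c) := a :- c) refl _ _ _)
            (+-congʳ (reflexive (≡.cong s (≡.sym (ℕₚ.+-suc n k))))))
          (norm-+ (steps (n ℕ.+ k)) (far′ n k)))
      far : ∀ n k → ∥ s (n ℕ.+ k) - s n ∥≤ K ⊗ κ ⊗ ρ ^ℚ n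
      far n k = norm-≤ (ℚₚ.≤-trans (⊗-monoˡ-≤ _ (⊗-nonNeg 0≤K (0≤ρ^ n)) (geometric≤κ k))
          (ℚₚ.≤-reflexive (S.solve 3 (λ K a b → K S.:* a S.:* b S.:= K S.:* b S.:* a) ≡.refl K (ρ ^ℚ n) κ)))
        (far′ n k)
      lim = complete s (λ ε 0<ε → let N , small = ^ℚ-small (K ⊗ κ) (⊗-nonNeg 0≤K 0≤κ) 0<ε in
        N , λ n N≤n → ≡.subst (λ i → ∥ s i - s N ∥≤ ε) (ℕₚ.m+[n∸m]≡n N≤n)
          (norm-≤ (small N ℕₚ.≤-refl) (far N (n ℕ.∸ N))))
      L = proj₁ lim
      s↝L = proj₂ lim

    private
      Product : (ℕ → Carrier) → ℕ → Carrier
      Product y n = product {n} (λ i → 1# - y (toℕ i))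

    -- The scale D (1 − ρ) makes 1 + 2 D an invariant bound as long as D ≤ ½;
    -- dropping the first m factors replaces D by D ρ^m.
    product-bounded : ∀ m D → 0ℚ ℚ.≤ D → D ⊗ ρ ^ℚ m ℚ.≤ ½ → ∃[ M ] 1ℚ ℚ.≤ M ×
      (∀ y → (∀ j → ∥ y j ∥≤ D ⊗ (1ℚ ⊝ ρ) ⊗ ρ ^ℚ j) → ∀ n → ∥ Product y n ∥≤ M)
    product-bounded zero D 0≤D D≤½ = 1ℚ ⊕ (D ⊕ D) , p≤p⊕q (⊕-nonNeg 0≤D 0≤D) ,
      λ y y≤ n → small D 0≤D (≡.subst (ℚ._≤ ½) (ℚR.*-identityʳ D) D≤½) y y≤ n
      where
      small : ∀ D → 0ℚ ℚ.≤ D → D ℚ.≤ ½ → ∀ y → (∀ j → ∥ y j ∥≤ D ⊗ (1ℚ ⊝ ρ) ⊗ ρ ^ℚ j) →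
        ∀ n → ∥ Product y n ∥≤ 1ℚ ⊕ (D ⊕ D)
      small D 0≤D D≤½ y y≤ zero    = norm-≤ (p≤p⊕q (⊕-nonNeg 0≤D 0≤D)) norm-1
      small D 0≤D D≤½ y y≤ (suc n) = norm-≤
        -- 1 + 2D exceeds (1 + D(1 - ρ))(1 + 2Dρ) by D(1 - ρ)(1 - 2Dρ), which is nonnegative because
        -- 2Dρ ≤ 1.
        (difference⇒≤ _ (⊗-nonNeg (⊗-nonNeg 0≤D (ℚₚ.<⇒≤ 0<1-ρ)) (p≤q⇒0≤q⊝p 2Dρ≤1))
          (S.solve 2 (λ D ρ →
             S.# 1 S.:+ (D S.:+ D) S.:= (S.# 1 S.:+ D S.:* (S.# 1 S.:- ρ) S.:* S.# 1) S.:* (S.# 1 S.:+ (D S.:* ρ S.:+ D S.:* ρ))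
               S.:+ D S.:* (S.# 1 S.:- ρ) S.:* (S.# 1 S.:- (D S.:* ρ S.:+ D S.:* ρ))) ≡.refl D ρ))
        (norm-* (norm-+ norm-1 (norm-neg (y≤ 0)))
          (small (D ⊗ ρ) (⊗-nonNeg 0≤D 0≤ρ) Dρ≤½ (λ j → y (suc j))
            (λ j → norm-≡ (S.solve 4 (λ D d ρ x → D S.:* d S.:* (ρ S.:* x) S.:= D S.:* ρ S.:* d S.:* x) ≡.refl D (1ℚ ⊝ ρ) ρ (ρ ^ℚ j))
              (y≤ (suc j)))
            n))
        where
        Dρ≤½ : D ⊗ ρ ℚ.≤ ½
        Dρ≤½ = ℚₚ.≤-trans (⊗-monoˡ-≤ D 0≤D (ℚₚ.<⇒≤ ρ<1)) (≡.subst (ℚ._≤ ½) (≡.sym (ℚR.*-identityʳ D)) D≤½)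
        2Dρ≤1 : D ⊗ ρ ⊕ D ⊗ ρ ℚ.≤ 1ℚ
        2Dρ≤1 = ≡.subst (D ⊗ ρ ⊕ D ⊗ ρ ℚ.≤_) ½⊕½≡1 (⊕-mono-≤ Dρ≤½ Dρ≤½)
    product-bounded (suc m) D 0≤D small with product-bounded m (D ⊗ ρ) (⊗-nonNeg 0≤D 0≤ρ)
      (≡.subst (ℚ._≤ ½) (≡.sym (ℚR.*-assoc D ρ (ρ ^ℚ m))) small)
    ... | M , 1≤M , tail-bounded = (1ℚ ⊕ D ⊗ (1ℚ ⊝ ρ) ⊗ 1ℚ) ⊗ M ,
      ℚₚ.≤-trans 1≤M M≤ , λ where
        y y≤ zero    → norm-≤ (ℚₚ.≤-trans 1≤M M≤) norm-1
        y y≤ (suc n) → norm-* (norm-+ norm-1 (norm-neg (y≤ 0)))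
          (tail-bounded (λ j → y (suc j))
            (λ j → norm-≡ (S.solve 4 (λ D d ρ x → D S.:* d S.:* (ρ S.:* x) S.:= D S.:* ρ S.:* d S.:* x) ≡.refl D (1ℚ ⊝ ρ) ρ (ρ ^ℚ j))
              (y≤ (suc j)))
            n)
      where
      M≤ : M ℚ.≤ (1ℚ ⊕ D ⊗ (1ℚ ⊝ ρ) ⊗ 1ℚ) ⊗ M
      M≤ = difference⇒≤ _ (⊗-nonNeg (⊗-nonNeg (⊗-nonNeg 0≤D (ℚₚ.<⇒≤ 0<1-ρ)) 0≤1ℚ) (ℚₚ.≤-trans 0≤1ℚ 1≤M))
        (S.solve 2 (λ d M → (S.# 1 S.:+ d) S.:* M S.:= M S.:+ d S.:* M) ≡.refl (D ⊗ (1ℚ ⊝ ρ) ⊗ 1ℚ) M)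

    -- Consecutive partial products differ by the product so far times `y n`, so a uniform bound on
    -- the partial products makes the steps geometric.
    product-converges : ∀ y c → (∀ j → ∥ y j ∥≤ c ⊗ ρ ^ℚ j) → Converges (Product y)
    product-converges y c y≤ = geometric-steps⇒converges (Product y) (M ⊗ c) M bounded λ n →
      norm-≡ (≡.sym (ℚR.*-assoc M c (ρ ^ℚ n)))
        (norm-cong (trans (solve 2 (λ P y → :- (P :* y) := P :* (# 1 :- y) :- P) refl (Product y n) (y n))
            (+-congʳ (sym (product-snoc n (λ j → 1# - y j)))))
          (norm-neg (norm-* (bounded n) (y≤ n))))
      where
      0≤c : 0ℚ ℚ.≤ c
      0≤c = rate-nonNeg (y≤ 0)
      -- The scale is D = c κ because then D(1 - ρ) = c, and `m` counts the leading factors to be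
      -- split off until D ρ^m ≤ ½.
      m = proj₁ (^ℚ-small (c ⊗ κ) (⊗-nonNeg 0≤c 0≤κ) 0<½)
      bounds = product-bounded m (c ⊗ κ) (⊗-nonNeg 0≤c 0≤κ)
        (proj₂ (^ℚ-small (c ⊗ κ) (⊗-nonNeg 0≤c 0≤κ) 0<½) m ℕₚ.≤-refl)
      M = proj₁ bounds
      c≡ : ∀ x → c ⊗ x ≡ c ⊗ κ ⊗ (1ℚ ⊝ ρ) ⊗ x
      c≡ x = ≡.cong (_⊗ x) (≡.sym (⊗-recip-cancel c 0<1-ρ))
      bounded : ∀ n → ∥ Product y n ∥≤ M
      bounded = proj₂ (proj₂ bounds) y (λ j → norm-≡ (c≡ (ρ ^ℚ j)) (y≤ j))

    poch-converges : ∀ {a x} → ∥ a ∥≤ 1ℚ → ∥ x ∥≤ ρ → Converges (poch a x)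
    poch-converges {a} {x} ∥a∥≤1 ∥x∥≤ρ =
      product-converges (λ j → a * x ^ j) 1ℚ (λ j → norm-* ∥a∥≤1 (norm-^ ∥x∥≤ρ j))

    powerSum : Carrier → ℕ → Carrier
    powerSum w zero    = 0#
    powerSum w (suc n) = powerSum w n + w ^ n

    powerSum-bounded : ∀ {w} → ∥ w ∥≤ ρ → ∀ n → ∥ powerSum w n ∥≤ geometric n
    powerSum-bounded ∥w∥≤ρ zero    = norm-0
    powerSum-bounded ∥w∥≤ρ (suc n) = norm-+ (powerSum-bounded ∥w∥≤ρ n) (norm-^ ∥w∥≤ρ n)

    powerSum-closed : ∀ w n → (1# - w) * powerSum w n ≈ 1# - w ^ n
    powerSum-closed w zero    = solve 1 (λ w → (# 1 :- w) :* # 0 := # 1 :- # 1) refl w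
    powerSum-closed w (suc n) = begin
      (1# - w) * (powerSum w n + w ^ n)             ≈⟨ distribˡ _ _ _ ⟩
      (1# - w) * powerSum w n + (1# - w) * w ^ n    ≈⟨ +-congʳ (powerSum-closed w n) ⟩
      (1# - w ^ n) + (1# - w) * w ^ n
        ≈⟨ solve 2 (λ w x → (# 1 :- x) :+ (# 1 :- w) :* x := # 1 :- w :* x) refl w (w ^ n) ⟩
      1# - w ^ suc n                                ∎

    norm-^′ : ∀ {w} → ∥ w ∥≤ ρ → ∀ n → ∥ w ^ n ∥≤ 1ℚ ⊗ ρ ^ℚ n
    norm-^′ ∥w∥≤ρ n = norm-≡ (≡.sym (ℚR.*-identityˡ (ρ ^ℚ n))) (norm-^ ∥w∥≤ρ n)

    powerSum-converges : ∀ {w} → ∥ w ∥≤ ρ → Converges (powerSum w)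
    powerSum-converges {w} ∥w∥≤ρ = geometric-steps⇒converges (powerSum w) 1ℚ κ
      (λ n → norm-≤ (geometric≤κ n) (powerSum-bounded ∥w∥≤ρ n))
      (λ n → norm-cong (solve 2 (λ a b → b := a :+ b :- a) refl (powerSum w n) (w ^ n)) (norm-^′ ∥w∥≤ρ n))

    -- The Neumann series: 1 - w times the n-th partial sum is 1 - w^n, which tends to 1.
    1-w-inverse : ∀ {w} → ∥ w ∥≤ ρ → ∃[ v ] (1# - w) * v ≈ 1# × ∥ v ∥≤ κ
    1-w-inverse {w} ∥w∥≤ρ = from (powerSum-converges ∥w∥≤ρ)
      where
      from : Converges (powerSum w) → ∃[ v ] (1# - w) * v ≈ 1# × ∥ v ∥≤ κ
      from conv = limit , inverse , ↝-bounded (λ n → norm-≤ (geometric≤κ n) (powerSum-bounded ∥w∥≤ρ n)) converges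
        where
        open Converges conv
        inverse : (1# - w) * limit ≈ 1#
        inverse = ↝-unique (↝-* (↝-const (1# - w)) converges)
          (↝-cong (λ n → sym (powerSum-closed w n)) (solve 0 (# 1 :- # 0 := # 1) refl)
            (↝-+ (↝-const 1#) (↝-neg (rate⇒null 1ℚ (norm-^′ ∥w∥≤ρ)))))

    -- As 1/(1 - w) = 1 + w/(1 - w), the sequence 1/(x;x)_n is itself a product of factors 1 - y_j
    -- with y_j = O(ρ^j), so `product-converges` applies to it as well.
    reciprocal : ∀ {x} → ∥ x ∥≤ ρ → ∃[ u ] (QIdentities.Reciprocal R x u × Converges u)
    reciprocal {x} ∥x∥≤ρ = Product y , record { u-zero = refl ; u-suc = u-suc } ,
      product-converges y κ (λ j → norm-≤
        (ℚₚ.≤-trans (⊗-monoʳ-≤ κ 0≤κ (^ℚ-suc-≤ j)) (ℚₚ.≤-reflexive (ℚR.*-comm _ κ)))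
        (norm-neg (norm-* (norm-^ ∥x∥≤ρ (suc j)) (proj₂ (proj₂ (inv j))))))
      where
      inv : ∀ j → ∃[ v ] (1# - x ^ suc j) * v ≈ 1# × ∥ v ∥≤ κ
      inv j = 1-w-inverse (norm-≤ (≡.subst (ρ ^ℚ suc j ℚ.≤_) (ℚR.*-identityʳ ρ) (⊗-monoˡ-≤ ρ 0≤ρ (^ℚ≤1 j)))
        (norm-^ ∥x∥≤ρ (suc j)))
      y : ℕ → Carrier
      y j = - (x ^ suc j * proj₁ (inv j))
      u-suc : ∀ n → Product y n ≈ (1# - x ^ suc n) * Product y (suc n)
      u-suc n = sym (begin
        (1# - w) * Product y (suc n)
          ≈⟨ *-congˡ (product-snoc n (λ j → 1# - y j)) ⟩
        (1# - w) * (Product y n * (1# - - (w * v)))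
          ≈⟨ solve 3 (λ w v P → (# 1 :- w) :* (P :* (# 1 :- :- (w :* v))) := P :* (# 1 :- w) :+ P :* w :* ((# 1 :- w) :* v)) refl w v _ ⟩
        Product y n * (1# - w) + Product y n * w * ((1# - w) * v)
          ≈⟨ +-congˡ (*-congˡ (proj₁ (proj₂ (inv n)))) ⟩
        Product y n * (1# - w) + Product y n * w * 1#
          ≈⟨ solve 2 (λ w P → P :* (# 1 :- w) :+ P :* w :* # 1 := P) refl w _ ⟩
        Product y n ∎)
        where
        w = x ^ suc n
        v = proj₁ (inv n)

    norm≤1-^ : ∀ {z} → ∥ z ∥≤ 1ℚ → ∀ n → ∥ z ^ n ∥≤ 1ℚ
    norm≤1-^ b zero    = norm-1
    norm≤1-^ b (suc n) = norm-≡ (ℚR.*-identityˡ 1ℚ) (norm-* b (norm≤1-^ b n))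

    convolve-bounded : ∀ n f B → (∀ r k → r ℕ.+ k ≡ n → ∥ f r k ∥≤ B ⊗ ρ ^ℚ r) →
      ∥ convolve f n ∥≤ B ⊗ geometric (suc n)
    convolve-bounded zero    f B f≤ = norm-≡ (≡.cong (B ⊗_) (≡.sym (ℚR.+-identityˡ 1ℚ))) (f≤ 0 0 ≡.refl)
    convolve-bounded (suc n) f B f≤ = norm-≡ (≡.sym (ℚR.distribˡ B (geometric (suc n)) (ρ ^ℚ suc n)))
      (norm-+ (convolve-bounded n (λ r k → f r (suc k)) B
                (λ r k eq → f≤ r (suc k) (≡.trans (ℕₚ.+-suc r k) (≡.cong suc eq))))
              (f≤ (suc n) 0 (ℕₚ.+-identityʳ (suc n))))

    -- The weights are within C ρ^k of 1 while the r-th term is O(ρ^(2r)), so in the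
    -- n-th sum all products are O(ρ^n ρ^r).
    convolve-weights : ∀ (t : ℕ → Carrier) (h : ℕ → ℕ → ℕ → Carrier) T C →
      (∀ r → ∥ t r ∥≤ T ⊗ (ρ ^ℚ r ⊗ ρ ^ℚ r)) →
      (∀ n r k → r ℕ.+ k ≡ n → ∥ h n r k - 1# ∥≤ C ⊗ ρ ^ℚ k) →
      (λ n → convolve (λ r k → h n r k * t r) n - sum {suc n} (λ i → t (toℕ i))) ↝ 0#
    convolve-weights t h T C t≤ h≤ = rate⇒null (C ⊗ T ⊗ κ) λ n → norm-≤
      (ℚₚ.≤-trans (⊗-monoˡ-≤ _ (⊗-nonNeg (⊗-nonNeg 0≤C 0≤T) (0≤ρ^ n)) (geometric≤κ (suc n)))
        (ℚₚ.≤-reflexive (S.solve 4 (λ C T a b → C S.:* T S.:* a S.:* b S.:= C S.:* T S.:* b S.:* a) ≡.refl C T (ρ ^ℚ n) κ)))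
      (norm-cong (difference n)
        (convolve-bounded n (λ r k → (h n r k - 1#) * t r) (C ⊗ T ⊗ ρ ^ℚ n) (λ r k eq → norm-≡ (rearrange n r k eq)
          (norm-* (h≤ n r k eq) (t≤ r)))))
      where
      0≤C : 0ℚ ℚ.≤ C
      0≤C = rate-nonNeg (h≤ 0 0 0 ≡.refl)
      0≤T : 0ℚ ℚ.≤ T
      0≤T = rate-nonNeg (norm-≡ (≡.cong (T ⊗_) (ℚR.*-identityˡ 1ℚ)) (t≤ 0))
      rearrange : ∀ n r k → r ℕ.+ k ≡ n →
        C ⊗ ρ ^ℚ k ⊗ (T ⊗ (ρ ^ℚ r ⊗ ρ ^ℚ r)) ≡ C ⊗ T ⊗ ρ ^ℚ n ⊗ ρ ^ℚ r
      rearrange n r k eq = ≡.trans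
        (S.solve 4 (λ C T a b → C S.:* b S.:* (T S.:* (a S.:* a)) S.:= C S.:* T S.:* (a S.:* b) S.:* a) ≡.refl C T (ρ ^ℚ r) (ρ ^ℚ k))
        (≡.cong (λ x → C ⊗ T ⊗ x ⊗ ρ ^ℚ r) (≡.trans (≡.sym (^ℚ-homo-* ρ r k)) (≡.cong (ρ ^ℚ_) eq)))
      difference : ∀ n → convolve (λ r k → (h n r k - 1#) * t r) n
        ≈ convolve (λ r k → h n r k * t r) n - sum {suc n} (λ i → t (toℕ i))
      difference n = begin
        X                 ≈⟨ solve 2 (λ a b → a := (a :+ b) :- b) refl X Z ⟩
        (X + Z) - Z       ≈⟨ +-cong (trans (sym (convolve-+ n (λ r k → (h n r k - 1#) * t r) (λ r _ → t r)))
                               (convolve-cong n (λ r k _ → solve 2 (λ a b → (a :- # 1) :* b :+ b := a :* b) refl (h n r k) (t r))))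
                               (-‿cong (convolve-const n t)) ⟩
        convolve (λ r k → h n r k * t r) n - sum {suc n} (λ i → t (toℕ i)) ∎
        where
        X = convolve (λ r k → (h n r k - 1#) * t r) n
        Z = convolve (λ r _ → t r) n

    module _ {s u : ℕ → Carrier} (s-conv : Converges s) (u-conv : Converges u) (su≈1 : ∀ n → s n * u n ≈ 1#) where
      private
        module s = Converges s-conv
        module u = Converges u-conv

      limits-inverse : s.limit * u.limit ≈ 1#
      limits-inverse = ↝-unique (↝-* s.converges u.converges) (↝-cong (λ n → sym (su≈1 n)) refl (↝-const 1#))

      pair-speed : ℚ
      pair-speed = s.speed ⊗ u.bound ⊕ s.bound ⊗ u.speed

      -- The two indices may differ: each sequence is within O(ρ^k) of its own limit, and the
      -- product of the limits is 1.
      pair-near-1 : ∀ {i j k} → k ℕ.≤ i → k ℕ.≤ j → ∥ s i * u j - 1# ∥≤ pair-speed ⊗ ρ ^ℚ k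
      pair-near-1 {i} {j} {k} k≤i k≤j = norm-≡
        (S.solve 5 (λ a b c d x → a S.:* x S.:* b S.:+ c S.:* (d S.:* x) S.:= (a S.:* b S.:+ c S.:* d) S.:* x) ≡.refl
          s.speed u.bound s.bound u.speed (ρ ^ℚ k))
        (norm-cong (trans
            (solve 4 (λ a b A B → (a :- A) :* b :+ A :* (b :- B) := a :* b :- A :* B) refl (s i) (u j) s.limit u.limit)
            (+-congˡ (-‿cong limits-inverse)))
          (norm-+
            (norm-* (norm-≤ (⊗-monoˡ-≤ s.speed s.0≤speed (^ℚ-antitone k≤i)) (s.rate i)) (u.bounded j))
            (norm-* s.limit-bounded (norm-≤ (⊗-monoˡ-≤ u.speed u.0≤speed (^ℚ-antitone k≤j)) (u.rate j)))))

-- The series identity in a complete normed ring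

n≤double : ∀ n → n ℕ.≤ double n
n≤double zero    = z≤n
n≤double (suc n) = s≤s (ℕₚ.m≤n⇒m≤1+n (n≤double n))

module SeriesIdentity {R : CommutativeRing 0ℓ 0ℓ} (norm : CompleteNorm R)
  {ρ : ℚ} (0≤ρ : 0ℚ ℚ.≤ ρ) (ρ<1 : ρ ℚ.< 1ℚ) where
  open CommutativeRing R
  open ℤ-Solver R
  open FiniteSums R
  open QIdentities R
  open Limits norm
  open WithRatio 0≤ρ ρ<1
  open GeometricBounds 0≤ρ ρ<1
  open import Relation.Binary.Reasoning.Setoid setoid

  norm-power : ∀ {q} → ∥ q ∥≤ ρ → ∀ k → ∥ q ^ suc k ∥≤ ρ
  norm-power ∥q∥≤ρ k = norm-≤ (≡.subst (ρ ^ℚ suc k ℚ.≤_) (ℚR.*-identityʳ ρ) (⊗-monoˡ-≤ ρ 0≤ρ (^ℚ≤1 k)))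
    (norm-^ ∥q∥≤ρ (suc k))

  norm-ρ⇒1 : ∀ {z} → ∥ z ∥≤ ρ → ∥ z ∥≤ 1ℚ
  norm-ρ⇒1 = norm-≤ (ℚₚ.<⇒≤ ρ<1)

  module _ {q : Carrier} (∥q∥≤ρ : ∥ q ∥≤ ρ) where

    -- With k = n - r this is (x;x)_n (x;x)_(2n+1)/((x;x)_(n-r) (x;x)_(n+r+1)). The normalisation
    -- makes it tend to 1 for fixed r in every base, so that base q² and base q⁵ can be compared.
    weight : (s u : ℕ → Carrier) → ℕ → ℕ → ℕ → Carrier
    weight s u n r k = s n * u k * (s (suc (double n)) * u (suc (double r ℕ.+ k)))

    weight-near-1 : ∀ {s u} (s-conv : Converges s) (u-conv : Converges u) → (∀ n → s n * u n ≈ 1#) →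
      ∃[ C ] (∀ n r k → r ℕ.+ k ≡ n → ∥ weight s u n r k - 1# ∥≤ C ⊗ ρ ^ℚ k)
    weight-near-1 {s} {u} s-conv u-conv su≈1 = c ⊗ b ⊕ c , λ n r k r+k≡n →
      let k≤n = ≡.subst (k ℕ.≤_) r+k≡n (ℕₚ.m≤n+m k r) in
      norm-≡ (S.solve 3 (λ c b x → c S.:* x S.:* b S.:+ c S.:* x S.:= (c S.:* b S.:+ c) S.:* x) ≡.refl c b (ρ ^ℚ k))
        (norm-cong (solve 2 (λ x y → (x :- # 1) :* y :+ (y :- # 1) := x :* y :- # 1) refl
            (s n * u k) (s (suc (double n)) * u (suc (double r ℕ.+ k))))
          (norm-+
            (norm-* (pair-near-1 s-conv u-conv su≈1 k≤n ℕₚ.≤-refl) (norm-* (s.bounded _) (u.bounded _)))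
            (pair-near-1 s-conv u-conv su≈1
              (ℕₚ.≤-trans k≤n (ℕₚ.m≤n⇒m≤1+n (n≤double n)))
              (ℕₚ.m≤n⇒m≤1+n (ℕₚ.m≤n+m k (double r))))))
      where
      module S = ℚSolver
      module s = Converges s-conv
      module u = Converges u-conv
      c = pair-speed s-conv u-conv su≈1
      b = s.bound ⊗ u.bound

    θ : ℕ → Carrier
    θ = thetaTerm q (q ^ 4)

    -- Two powers of ρ^r are taken from q^(4r): in `convolve-weights` one of them turns ρ^k into
    -- ρ^n, and the other is summed to at most `κ`.
    θ-bounded : ∀ r → ∥ θ r ∥≤ (1ℚ ⊕ 1ℚ) ⊗ (ρ ^ℚ r ⊗ ρ ^ℚ r)
    θ-bounded r = norm-≡ (S.solve 1 (λ x → S.# 1 S.:* x S.:* (S.# 1 S.:+ S.# 1 S.:* (S.# 1 S.:* S.# 1)) S.:= (S.# 1 S.:+ S.# 1) S.:* x) ≡.refl (ρ ^ℚ r ⊗ ρ ^ℚ r))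
      (norm-* (norm-* (norm≤1-^ (norm-ρ⇒1 (norm-power ∥q∥≤ρ 4)) (triangle r)) q⁴^r)
        (norm-+ norm-1 (norm-* q≤1 (norm-* (norm≤1-^ q≤1 r) (norm≤1-^ q≤1 r)))))
      where
      module S = ℚSolver
      q≤1 = norm-ρ⇒1 ∥q∥≤ρ
      q⁴^r : ∥ (q ^ 4) ^ r ∥≤ ρ ^ℚ r ⊗ ρ ^ℚ r
      q⁴^r = norm-cong (sym (^-distrib-* q (q ^ 3) r))
        (norm-* (norm-^ ∥q∥≤ρ r) (norm-^ (norm-power ∥q∥≤ρ 2) r))

    θ-sum : ℕ → Carrier
    θ-sum n = sum {suc n} (λ i → θ (toℕ i))

    weighted-θ-sum : (s u : ℕ → Carrier) → ℕ → Carrier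
    weighted-θ-sum s u n = convolve (λ r k → weight s u n r k * θ r) n

    weighted-θ-sum-factor : ∀ s u n → weighted-θ-sum s u n
      ≈ s n * s (suc (double n)) * convolve (λ r k → θ r * (u k * u (suc (double r ℕ.+ k)))) n
    weighted-θ-sum-factor s u n = trans
      (convolve-cong n (λ r k _ → solve 5 (λ a b c d t → a :* b :* (c :* d) :* t := a :* c :* (t :* (b :* d))) refl _ _ _ _ _))
      (convolve-* n (s n * s (suc (double n))) _)

    weighted-θ-sum-limit : ∀ {s u} → Converges s → Converges u → (∀ n → s n * u n ≈ 1#) →
      (λ n → weighted-θ-sum s u n - θ-sum n) ↝ 0#
    weighted-θ-sum-limit {s} {u} s-conv u-conv su≈1 =
      convolve-weights θ (weight s u) (1ℚ ⊕ 1ℚ) (proj₁ near) θ-bounded (proj₂ near)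
      where near = weight-near-1 s-conv u-conv su≈1

    -- The Jacobi triple product in the limit: the normalising (q⁵;q⁵)_(2n+1) cancels the reciprocal
    -- in `finite-triple-product`, and a product of three convergent Pochhammer symbols is left.
    θ-sum-limit : ∀ {A B C u} → Reciprocal (q ^ 5) u → Converges u →
      poch (- q) (q ^ 5) ↝ A → poch (- (q ^ 4)) (q ^ 5) ↝ B → poch (q ^ 5) (q ^ 5) ↝ C →
      θ-sum ↝ C * (A * B)
    θ-sum-limit {A} {B} {C} {u} rec u-conv A↝ B↝ C↝ = ↝-difference
      (↝-cong (λ n → solve 2 (λ a b → :- (a :- b) := b :- a) refl _ _) (solve 0 (:- # 0 := # 0) refl)
        (↝-neg (weighted-θ-sum-limit s-conv u-conv u-inverse)))
      (↝-cong (λ n → sym (evaluate n)) refl (↝-* C↝ (↝-* (↝-reindex suc (λ n → ℕₚ.n≤1+n n) A↝) B↝)))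
      where
      open Reciprocal rec
      x = q ^ 5
      s = poch x x
      s-conv : Converges s
      s-conv = poch-converges (norm-ρ⇒1 (norm-power ∥q∥≤ρ 4)) (norm-power ∥q∥≤ρ 4)
      evaluate : ∀ n → weighted-θ-sum s u n ≈ s n * (poch (- q) x (suc n) * poch (- (q ^ 4)) x n)
      evaluate n = begin
        weighted-θ-sum s u n
          ≈⟨ weighted-θ-sum-factor s u n ⟩
        s n * s (suc (double n)) * convolve (λ r k → θ r * (u k * u (suc (double r ℕ.+ k)))) n
          ≈⟨ *-congˡ (finite-triple-product q (q ^ 4) rec n) ⟩
        s n * s (suc (double n)) * (poch (- q) x (suc n) * poch (- (q ^ 4)) x n * u (suc (double n)))
          ≈⟨ solve 5 (λ a b c d e → a :* b :* (c :* d :* e) := b :* e :* (a :* (c :* d))) refl _ _ _ _ _ ⟩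
        s (suc (double n)) * u (suc (double n)) * (s n * (poch (- q) x (suc n) * poch (- (q ^ 4)) x n))
          ≈⟨ *-congʳ (u-inverse (suc (double n))) ⟩
        1# * (s n * (poch (- q) x (suc n) * poch (- (q ^ 4)) x n))
          ≈⟨ *-identityˡ _ ⟩
        s n * (poch (- q) x (suc n) * poch (- (q ^ 4)) x n) ∎

    -- Two weights are removed by comparison of limits: `s n * u l` from the partial sums of the
    -- series, and the base q² weight from the theta sum. `evaluate` links them by inserting s(2n+1)
    -- u(2n+1) = 1, where the first factor completes the theta weight and the second tends to
    -- 1/(q²;q²)_∞.
    series-limit : ∀ {D T u} (rec : Reciprocal (q ^ 2) u) (u-conv : Converges u) →
      poch q (q ^ 2) ↝ D → θ-sum ↝ T →
      (λ n → sum {n} (λ i → seriesTerm q rec (toℕ i))) ↝ Converges.limit u-conv * (D * T)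
    series-limit {D} {T} {u} rec u-conv D↝ θ↝ = ↝-unshift (↝-difference
      (↝-cong (λ n → solve 2 (λ a b → :- (a :- b) := b :- a) refl _ _) (solve 0 (:- # 0 := # 0) refl)
        (↝-neg (convolve-weights t (λ n m l → s n * u l) _ (pair-speed s-conv u-conv u-inverse) t-bounded
          (λ n m l m+l≡n → pair-near-1 s-conv u-conv u-inverse
            (≡.subst (l ℕ.≤_) m+l≡n (ℕₚ.m≤n+m l m)) ℕₚ.≤-refl))))
      (↝-cong (λ n → sym (evaluate n)) refl
        (↝-* (↝-reindex (λ n → suc (double n)) (λ n → ℕₚ.m≤n⇒m≤1+n (n≤double n)) u.converges)
          (↝-* (↝-reindex suc (λ n → ℕₚ.n≤1+n n) D↝)
            (↝-difference (weighted-θ-sum-limit s-conv u-conv u-inverse) θ↝)))))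
      where
      open Reciprocal rec
      module u = Converges u-conv
      p = q ^ 2
      s = poch p p
      t = seriesTerm q rec
      s-conv : Converges s
      s-conv = poch-converges (norm-ρ⇒1 (norm-power ∥q∥≤ρ 1)) (norm-power ∥q∥≤ρ 1)
      module D = Converges (poch-converges (norm-ρ⇒1 ∥q∥≤ρ) (norm-power ∥q∥≤ρ 1))
      module S = ℚSolver
      t-bounded : ∀ n → ∥ t n ∥≤ D.bound ⊗ (D.bound ⊗ u.bound) ⊗ (ρ ^ℚ n ⊗ ρ ^ℚ n)
      t-bounded n = norm-≡
        (S.solve 3 (λ a b x → S.# 1 S.:* x S.:* a S.:* (a S.:* b) S.:= a S.:* (a S.:* b) S.:* x) ≡.refl
          D.bound u.bound (ρ ^ℚ n ⊗ ρ ^ℚ n))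
        (norm-* (norm-* (norm-* (norm≤1-^ (norm-neg norm-1) n) q^≤) (D.bounded n))
          (norm-* (D.bounded n) (u.bounded (double n))))
        where
        n+n≤ : n ℕ.+ n ℕ.≤ n ℕ.^ 2 ℕ.+ 2 ℕ.* n
        n+n≤ = ℕₚ.≤-trans (ℕₚ.≤-reflexive (≡.cong (n ℕ.+_) (≡.sym (ℕₚ.+-identityʳ n)))) (ℕₚ.m≤n+m (2 ℕ.* n) (n ℕ.^ 2))
        q^≤ : ∥ q ^ (n ℕ.^ 2 ℕ.+ 2 ℕ.* n) ∥≤ ρ ^ℚ n ⊗ ρ ^ℚ n
        q^≤ = norm-≤ (ℚₚ.≤-trans (^ℚ-antitone n+n≤) (ℚₚ.≤-reflexive (^ℚ-homo-* ρ n n)))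
          (norm-^ ∥q∥≤ρ (n ℕ.^ 2 ℕ.+ 2 ℕ.* n))
      evaluate : ∀ n → convolve (λ m l → s n * u l * t m) n
        ≈ u (suc (double n)) * (poch q p (suc n) * weighted-θ-sum s u n)
      evaluate n = begin
        convolve (λ m l → s n * u l * t m) n
          ≈⟨ convolve-cong n (λ m l _ → *-assoc _ _ _) ⟩
        convolve (λ m l → s n * (u l * t m)) n
          ≈⟨ convolve-* n (s n) (λ m l → u l * t m) ⟩
        s n * convolve (λ m l → u l * t m) n
          ≈⟨ *-congˡ (finite-identity q rec n) ⟩
        s n * (poch q p (suc n) * Y)
          ≈⟨ *-identityˡ _ ⟨
        1# * (s n * (poch q p (suc n) * Y))
          ≈⟨ *-congʳ (u-inverse (suc (double n))) ⟨
        s (suc (double n)) * u (suc (double n)) * (s n * (poch q p (suc n) * Y))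
          ≈⟨ solve 5 (λ a b c d e → a :* b :* (c :* (d :* e)) := b :* (d :* (c :* a :* e))) refl _ _ _ _ _ ⟩
        u (suc (double n)) * (poch q p (suc n) * (s n * s (suc (double n)) * Y))
          ≈⟨ *-congˡ (*-congˡ (weighted-θ-sum-factor s u n)) ⟨
        u (suc (double n)) * (poch q p (suc n) * weighted-θ-sum s u n) ∎
        where Y = convolve (λ r k → θ r * (u k * u (suc (double r ℕ.+ k)))) n

    denominator-inverse : ∀ {u} → Reciprocal (q ^ 2) u → ∀ n →
      poch (- q) (q ^ 2) n * poch (q ^ 4) (q ^ 4) n * (poch q (q ^ 2) n * u (double n)) ≈ 1#
    denominator-inverse rec n = trans (sym (*-assoc _ _ _))
      (trans (*-congʳ (sym (poch-double q n))) (Reciprocal.u-inverse rec (double n)))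

-- ℂ as a normed ring

module ComplexSeries where
  open import Algebra.Morphism.Structures using (IsRingMonomorphism)
  open import Data.Sum.Base using (inj₁; inj₂)
  open ≡ using (refl; sym; trans; cong; cong₂; subst; subst₂; isEquivalence)
  open import Relation.Nullary.Decidable using (yes; no)
  open import Relation.Nullary.Negation using (contradiction)
  open Defs using (mkℝ; seq; cauchy; ℂ; _+i_; re; im;
    ∣_∣²; ∣_∣<_; _#0; inv; recip; recip-pos; eventually-bounded; _⟶_)

  opaque
    unfolding _⊕_

    ⊗-monoˡ-< : ∀ {p q} r → 0ℚ ℚ.< r → p ℚ.< q → r ⊗ p ℚ.< r ⊗ q
    ⊗-monoˡ-< r 0<r = ℚₚ.*-monoʳ-<-pos r {{ℚ.positive 0<r}}

    ∣⊖p∣≡∣p∣ : ∀ p → ℚ.∣ ⊖ p ∣ ≡ ℚ.∣ p ∣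
    ∣⊖p∣≡∣p∣ = ℚₚ.∣-p∣≡∣p∣

    ∣p⊕q∣≤ : ∀ p q → ℚ.∣ p ⊕ q ∣ ℚ.≤ ℚ.∣ p ∣ ⊕ ℚ.∣ q ∣
    ∣p⊕q∣≤ = ℚₚ.∣p+q∣≤∣p∣+∣q∣

    ∣p∣∣p∣≡pp : ∀ p → ℚ.∣ p ∣ ⊗ ℚ.∣ p ∣ ≡ p ⊗ p
    ∣p∣∣p∣≡pp p with ℚₚ.∣p∣≡p∨∣p∣≡-p p
    ... | inj₁ eq = cong₂ ℚ._*_ eq eq
    ... | inj₂ eq = trans (cong₂ ℚ._*_ eq eq) (ℚSolver.solve 1 (λ a → ℚSolver.:- a ℚSolver.:* ℚSolver.:- a ℚSolver.:= a ℚSolver.:* a) refl p)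

  module _ where
    open ℚSolver

    0≤pp : ∀ p → 0ℚ ℚ.≤ p ⊗ p
    0≤pp p = subst (0ℚ ℚ.≤_) (∣p∣∣p∣≡pp p) (⊗-nonNeg (ℚₚ.0≤∣p∣ p) (ℚₚ.0≤∣p∣ p))

    square-mono : ∀ {p q} → 0ℚ ℚ.≤ p → p ℚ.≤ q → p ⊗ p ℚ.≤ q ⊗ q
    square-mono {p} {q} 0≤p p≤q = ℚₚ.≤-trans (⊗-monoˡ-≤ p 0≤p p≤q) (⊗-monoʳ-≤ q (ℚₚ.≤-trans 0≤p p≤q) p≤q)

    square-cancel : ∀ {p q} → 0ℚ ℚ.≤ q → p ⊗ p ℚ.≤ q ⊗ q → p ℚ.≤ q
    square-cancel {p} {q} 0≤q pp≤qq with p ℚₚ.≤? q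
    ... | yes p≤q = p≤q
    ... | no  p≰q = contradiction (ℚₚ.<-≤-trans (ℚₚ.≤-<-trans
      (⊗-monoʳ-≤ q 0≤q (ℚₚ.<⇒≤ q<p)) (⊗-monoˡ-< p (ℚₚ.≤-<-trans 0≤q q<p) q<p)) pp≤qq) (ℚₚ.<-irrefl refl)
      where q<p = ℚₚ.≰⇒> p≰q

    ∣p∣≤⇒pp≤ : ∀ {p r} → ℚ.∣ p ∣ ℚ.≤ r → p ⊗ p ℚ.≤ r ⊗ r
    ∣p∣≤⇒pp≤ {p} {r} b = subst (ℚ._≤ r ⊗ r) (∣p∣∣p∣≡pp p) (square-mono (ℚₚ.0≤∣p∣ p) b)

    pp≤⇒∣p∣≤ : ∀ {p r} → 0ℚ ℚ.≤ r → p ⊗ p ℚ.≤ r ⊗ r → ℚ.∣ p ∣ ℚ.≤ r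
    pp≤⇒∣p∣≤ {p} {r} 0≤r b = square-cancel 0≤r (subst (ℚ._≤ r ⊗ r) (sym (∣p∣∣p∣≡pp p)) b)

    ∣p⊝q∣-triangle : ∀ p q r → ℚ.∣ p ⊝ r ∣ ℚ.≤ ℚ.∣ p ⊝ q ∣ ⊕ ℚ.∣ q ⊝ r ∣
    ∣p⊝q∣-triangle p q r = subst (ℚ._≤ ℚ.∣ p ⊝ q ∣ ⊕ ℚ.∣ q ⊝ r ∣)
      (cong ℚ.∣_∣ (solve 3 (λ p q r → (p :- q) :+ (q :- r) := p :- r) refl p q r)) (∣p⊕q∣≤ (p ⊝ q) (q ⊝ r))

    ∣p⊝q∣-sym : ∀ p q → ℚ.∣ p ⊝ q ∣ ≡ ℚ.∣ q ⊝ p ∣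
    ∣p⊝q∣-sym p q = trans (sym (∣⊖p∣≡∣p∣ (p ⊝ q)))
      (cong ℚ.∣_∣ (solve 2 (λ p q → :- (p :- q) := q :- p) refl p q))

    normSq : ℚ → ℚ → ℚ
    normSq a b = a ⊗ a ⊕ b ⊗ b

    -- The triangle inequality in squares, since moduli need not be rational. The cross term is
    -- bounded by Cauchy-Schwarz, which follows from Lagrange's identity with the square of ad - bc
    -- as remainder.
    normSq-+ : ∀ a b c d {r s} → 0ℚ ℚ.≤ r → 0ℚ ℚ.≤ s → normSq a b ℚ.≤ r ⊗ r → normSq c d ℚ.≤ s ⊗ s →
      normSq (a ⊕ c) (b ⊕ d) ℚ.≤ (r ⊕ s) ⊗ (r ⊕ s)
    normSq-+ a b c d {r} {s} 0≤r 0≤s z≤r w≤s = begin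
      normSq (a ⊕ c) (b ⊕ d)
        ≡⟨ solve 4 (λ a b c d → (a :+ c) :* (a :+ c) :+ (b :+ d) :* (b :+ d)
             := (a :* a :+ b :* b) :+ (c :* c :+ d :* d) :+ ((a :* c :+ b :* d) :+ (a :* c :+ b :* d))) refl a b c d ⟩
      normSq a b ⊕ normSq c d ⊕ (a ⊗ c ⊕ b ⊗ d ⊕ (a ⊗ c ⊕ b ⊗ d))
        ≤⟨ ⊕-mono-≤ (⊕-mono-≤ z≤r w≤s) (⊕-mono-≤ inner inner) ⟩
      r ⊗ r ⊕ s ⊗ s ⊕ (r ⊗ s ⊕ r ⊗ s)
        ≡⟨ solve 2 (λ r s → r :* r :+ s :* s :+ (r :* s :+ r :* s) := (r :+ s) :* (r :+ s)) refl r s ⟩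
      (r ⊕ s) ⊗ (r ⊕ s) ∎
      where
      open ℚₚ.≤-Reasoning
      inner : a ⊗ c ⊕ b ⊗ d ℚ.≤ r ⊗ s
      inner = square-cancel (⊗-nonNeg 0≤r 0≤s) (begin
        (a ⊗ c ⊕ b ⊗ d) ⊗ (a ⊗ c ⊕ b ⊗ d)
          ≤⟨ difference⇒≤ ((a ⊗ d ⊝ b ⊗ c) ⊗ (a ⊗ d ⊝ b ⊗ c)) (0≤pp _)
               (solve 4 (λ a b c d → (a :* a :+ b :* b) :* (c :* c :+ d :* d)
                 := (a :* c :+ b :* d) :* (a :* c :+ b :* d) :+ (a :* d :- b :* c) :* (a :* d :- b :* c)) refl a b c d) ⟩
        normSq a b ⊗ normSq c d
          ≤⟨ ℚₚ.≤-trans (⊗-monoˡ-≤ _ (⊕-nonNeg (0≤pp a) (0≤pp b)) w≤s) (⊗-monoʳ-≤ _ (0≤pp s) z≤r) ⟩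
        r ⊗ r ⊗ (s ⊗ s)
          ≡⟨ solve 2 (λ r s → r :* r :* (s :* s) := r :* s :* (r :* s)) refl r s ⟩
        r ⊗ s ⊗ (r ⊗ s) ∎)

    normSq-* : ∀ a b c d → normSq (a ⊗ c ⊝ b ⊗ d) (a ⊗ d ⊕ b ⊗ c) ≡ normSq a b ⊗ normSq c d
    normSq-* = solve 4 (λ a b c d → (a :* c :- b :* d) :* (a :* c :- b :* d) :+ (a :* d :+ b :* c) :* (a :* d :+ b :* c)
      := (a :* a :+ b :* b) :* (c :* c :+ d :* d)) refl

    normSq-nonNeg : ∀ a b → 0ℚ ℚ.≤ normSq a b
    normSq-nonNeg a b = ⊕-nonNeg (0≤pp a) (0≤pp b)

    normSq-*-≤ : ∀ a b c d {r s} → normSq a b ℚ.≤ r ⊗ r → normSq c d ℚ.≤ s ⊗ s →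
      normSq (a ⊗ c ⊝ b ⊗ d) (a ⊗ d ⊕ b ⊗ c) ℚ.≤ r ⊗ s ⊗ (r ⊗ s)
    normSq-*-≤ a b c d {r} {s} z≤r w≤s = begin
      normSq (a ⊗ c ⊝ b ⊗ d) (a ⊗ d ⊕ b ⊗ c)  ≡⟨ normSq-* a b c d ⟩
      normSq a b ⊗ normSq c d                 ≤⟨ ⊗-monoˡ-≤ _ (normSq-nonNeg a b) w≤s ⟩
      normSq a b ⊗ (s ⊗ s)                    ≤⟨ ⊗-monoʳ-≤ _ (0≤pp s) z≤r ⟩
      r ⊗ r ⊗ (s ⊗ s)                         ≡⟨ solve 2 (λ r s → r :* r :* (s :* s) := r :* s :* (r :* s)) refl r s ⟩
      r ⊗ s ⊗ (r ⊗ s)                         ∎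
      where open ℚₚ.≤-Reasoning

    normSq-∣∣ : ∀ {a b r s} → ℚ.∣ a ∣ ℚ.≤ r → ℚ.∣ b ∣ ℚ.≤ s → normSq a b ℚ.≤ (r ⊕ s) ⊗ (r ⊕ s)
    normSq-∣∣ {a} {b} {r} {s} a≤r b≤s = begin
      normSq a b
        ≤⟨ ⊕-mono-≤ (∣p∣≤⇒pp≤ a≤r) (∣p∣≤⇒pp≤ b≤s) ⟩
      r ⊗ r ⊕ s ⊗ s
        ≤⟨ difference⇒≤ (r ⊗ s ⊕ r ⊗ s) (⊕-nonNeg 0≤rs 0≤rs)
             (solve 2 (λ r s → (r :+ s) :* (r :+ s) := r :* r :+ s :* s :+ (r :* s :+ r :* s)) refl r s) ⟩
      (r ⊕ s) ⊗ (r ⊕ s) ∎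
      where
      open ℚₚ.≤-Reasoning
      0≤rs = ⊗-nonNeg (ℚₚ.≤-trans (ℚₚ.0≤∣p∣ a) a≤r) (ℚₚ.≤-trans (ℚₚ.0≤∣p∣ b) b≤s)

  Eventually : (ℕ → Set) → Set
  Eventually P = ∃[ N ] (∀ n → N ℕ.≤ n → P n)

  eventually-map : ∀ {P Q : ℕ → Set} → (∀ n → P n → Q n) → Eventually P → Eventually Q
  eventually-map f (N , p) = N , λ n N≤n → f n (p n N≤n)

  eventually-map₂ : ∀ {P Q S : ℕ → Set} → (∀ n → P n → Q n → S n) → Eventually P → Eventually Q → Eventually S
  eventually-map₂ f (M , p) (N , q) = M ℕ.⊔ N , λ n ≤n →
    f n (p n (ℕₚ.m⊔n≤o⇒m≤o M N ≤n)) (q n (ℕₚ.m⊔n≤o⇒n≤o M N ≤n))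

  Cauchy : (ℕ → ℚ) → Set
  Cauchy x = ∀ ε → 0ℚ ℚ.< ε → ∃[ N ] (∀ m n → N ℕ.≤ m → N ℕ.≤ n → ℚ.∣ x m ⊝ x n ∣ ℚ.< ε)

  infixl 6 _+_ _-_
  infixl 7 _*_
  infix  8 -_

  -- Opaque copies of the ring operations, for the same reason as for ℚ.
  opaque
    _+_ _*_ : ℂ → ℂ → ℂ
    _+_ = Defs._+_
    _*_ = Defs._*_

    -_ : ℂ → ℂ
    -_ = Defs.-_

    0# 1# : ℂ
    0# = Defs.0#
    1# = Defs.1#

  _-_ : ℂ → ℂ → ℂ
  z - w = z + (- w)

  opaque
    unfolding _⊕_ _+_

    -- The coordinates of the n-th rational approximation. The equations that follow serve as the
    -- interface to the representation of complex numbers.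
    reₙ imₙ : ℂ → ℕ → ℚ
    reₙ z n = seq (re z) n
    imₙ z n = seq (im z) n

    re0≡ : ∀ n → reₙ 0# n ≡ 0ℚ
    re0≡ n = refl
    im0≡ : ∀ n → imₙ 0# n ≡ 0ℚ
    im0≡ n = refl
    re1≡ : ∀ n → reₙ 1# n ≡ 1ℚ
    re1≡ n = refl
    im1≡ : ∀ n → imₙ 1# n ≡ 0ℚ
    im1≡ n = refl
    reₙ-+ : ∀ z w n → reₙ (z + w) n ≡ reₙ z n ⊕ reₙ w n
    reₙ-+ z w n = refl
    imₙ-+ : ∀ z w n → imₙ (z + w) n ≡ imₙ z n ⊕ imₙ w n
    imₙ-+ z w n = refl
    reₙ-* : ∀ z w n → reₙ (z * w) n ≡ reₙ z n ⊗ reₙ w n ⊝ imₙ z n ⊗ imₙ w n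
    reₙ-* z w n = refl
    imₙ-* : ∀ z w n → imₙ (z * w) n ≡ reₙ z n ⊗ imₙ w n ⊕ imₙ z n ⊗ reₙ w n
    imₙ-* z w n = refl
    reₙ-neg : ∀ z n → reₙ (- z) n ≡ ⊖ reₙ z n
    reₙ-neg z n = refl
    imₙ-neg : ∀ z n → imₙ (- z) n ≡ ⊖ imₙ z n
    imₙ-neg z n = refl
    cauchyʳᵉ : ∀ z → Cauchy (reₙ z)
    cauchyʳᵉ z = cauchy (re z)
    cauchyⁱᵐ : ∀ z → Cauchy (imₙ z)
    cauchyⁱᵐ z = cauchy (im z)

    mkℂ : (a b : ℕ → ℚ) → Cauchy a → Cauchy b → ℂ
    mkℂ a b ca cb = mkℝ a ca +i mkℝ b cb
    reₙ-mkℂ : ∀ a b ca cb n → reₙ (mkℂ a b ca cb) n ≡ a n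
    reₙ-mkℂ a b ca cb n = refl
    imₙ-mkℂ : ∀ a b ca cb n → imₙ (mkℂ a b ca cb) n ≡ b n
    imₙ-mkℂ a b ca cb n = refl

    ⇒#0 : ∀ z δ → 0ℚ ℚ.< δ → Eventually (λ n → δ ℚ.≤ normSq (reₙ z n) (imₙ z n)) → z #0
    ⇒#0 z δ 0<δ (N , δ≤) = δ , 0<δ , N , λ n N≤n → subst (ℚ._≤ seq ∣ z ∣² n) (sym (ℚₚ.+-identityˡ δ)) (δ≤ n N≤n)

    #0⇒ : ∀ z → z #0 → Eventually (λ n → 0ℚ ℚ.< normSq (reₙ z n) (imₙ z n))
    #0⇒ z (δ , 0<δ , N , δ≤) = N , λ n N≤n → ℚₚ.<-≤-trans 0<δ (subst (ℚ._≤ seq ∣ z ∣² n) (ℚₚ.+-identityˡ δ) (δ≤ n N≤n))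

    reₙ-inv : ∀ z z#0 n → reₙ (inv z z#0) n ≡ reₙ z n ⊗ recip (normSq (reₙ z n) (imₙ z n))
    reₙ-inv z z#0 n = refl
    imₙ-inv : ∀ z z#0 n → imₙ (inv z z#0) n ≡ ⊖ imₙ z n ⊗ recip (normSq (reₙ z n) (imₙ z n))
    imₙ-inv z z#0 n = refl

    ⇒∣-∣< : ∀ z w ε δ → 0ℚ ℚ.< δ → Eventually (λ n → normSq (reₙ (z - w) n) (imₙ (z - w) n) ⊕ δ ℚ.≤ ε ⊗ ε) → ∣ z Defs.- w ∣< ε
    ⇒∣-∣< z w ε δ 0<δ (N , ≤ε²) = δ , 0<δ , N , ≤ε²

    ∣∣<⇒ : ∀ z r → ∣ z ∣< r → ∃[ δ ] 0ℚ ℚ.< δ × Eventually (λ n → normSq (reₙ z n) (imₙ z n) ⊕ δ ℚ.≤ r ⊗ r)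
    ∣∣<⇒ z r ∣z∣<r = ∣z∣<r

  normSqₙ : ℂ → ℕ → ℚ
  normSqₙ z n = normSq (reₙ z n) (imₙ z n)

  reₙ-- : ∀ z w n → reₙ (z - w) n ≡ reₙ z n ⊝ reₙ w n
  reₙ-- z w n = trans (reₙ-+ z (- w) n) (cong (reₙ z n ⊕_) (reₙ-neg w n))

  imₙ-- : ∀ z w n → imₙ (z - w) n ≡ imₙ z n ⊝ imₙ w n
  imₙ-- z w n = trans (imₙ-+ z (- w) n) (cong (imₙ z n ⊕_) (imₙ-neg w n))

  -- This is |z| ≤ r for the number that the approximations define; the approximations themselves
  -- may exceed r by a vanishing amount, hence the slack ε. Only squares are compared, so the sign
  -- of r is recorded separately.
  record Bounded (z : ℂ) (r : ℚ) : Set where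
    constructor bounded
    field
      nonNeg     : 0ℚ ℚ.≤ r
      eventually : ∀ ε → 0ℚ ℚ.< ε → Eventually (λ n → normSqₙ z n ℚ.≤ (r ⊕ ε) ⊗ (r ⊕ ε))

  open Bounded

  ½p<p : ∀ {ε} → 0ℚ ℚ.< ε → ½ ⊗ ε ℚ.< ε
  ½p<p {ε} 0<ε = subst₂ ℚ._<_ (ℚR.+-identityʳ _) (halves ε)
    (subst₂ ℚ._<_ (ℚR.+-comm 0ℚ _) refl (⊕-mono-<-≤ (½-pos 0<ε) (ℚₚ.≤-refl {½ ⊗ ε})))

  components : ∀ {z r} → Bounded z r → ∀ ε → 0ℚ ℚ.< ε →
    Eventually (λ n → ℚ.∣ reₙ z n ∣ ℚ.≤ r ⊕ ε × ℚ.∣ imₙ z n ∣ ℚ.≤ r ⊕ ε)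
  components {z} {r} b ε 0<ε = eventually-map (λ n sq≤ →
      pp≤⇒∣p∣≤ 0≤r+ε (ℚₚ.≤-trans (p≤p⊕q (0≤pp _)) sq≤) ,
      pp≤⇒∣p∣≤ 0≤r+ε (ℚₚ.≤-trans (subst (imₙ z n ⊗ imₙ z n ℚ.≤_) (ℚR.+-comm _ _) (p≤p⊕q (0≤pp _))) sq≤))
    (eventually b ε 0<ε)
    where 0≤r+ε = ⊕-nonNeg (nonNeg b) (ℚₚ.<⇒≤ 0<ε)

  infix 4 _≋_ _≐_

  -- Opacity lets Agda recover z and w from the type z ≋ w.
  opaque
    _≋_ : ℂ → ℂ → Set
    z ≋ w = Bounded (z - w) 0ℚ

    equal : ∀ {z w} → Bounded (z - w) 0ℚ → z ≋ w
    equal b = b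

    difference : ∀ {z w} → z ≋ w → Bounded (z - w) 0ℚ
    difference b = b

  -- Equality of all approximations, finer than `_≋_`. The ring laws hold already here, so the
  -- solver is available before `_≋_` is shown to be a congruence.
  record _≐_ (z w : ℂ) : Set where
    constructor pointwise
    field
      re≡ : ∀ n → reₙ z n ≡ reₙ w n
      im≡ : ∀ n → imₙ z n ≡ imₙ w n

  bounded-≐ : ∀ {z w r} → z ≐ w → Bounded z r → Bounded w r
  bounded-≐ {z} {w} {r} (pointwise re≡ im≡) b = bounded (nonNeg b) λ ε 0<ε → eventually-map
    (λ n → subst (ℚ._≤ (r ⊕ ε) ⊗ (r ⊕ ε)) (cong₂ normSq (re≡ n) (im≡ n))) (eventually b ε 0<ε)

  bounded-+ : ∀ {z w r s} → Bounded z r → Bounded w s → Bounded (z + w) (r ⊕ s)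
  bounded-+ {z} {w} {r} {s} b c = bounded (⊕-nonNeg (nonNeg b) (nonNeg c)) λ ε 0<ε →
    eventually-map₂ (λ n p q → subst₂ ℚ._≤_
        (sym (cong₂ normSq (reₙ-+ z w n) (imₙ-+ z w n)))
        (cong (λ x → x ⊗ x) (trans
          (solve 4 (λ r s a b → (r :+ a) :+ (s :+ b) := (r :+ s) :+ (a :+ b)) refl r s (½ ⊗ ε) (½ ⊗ ε))
          (cong (r ⊕ s ⊕_) (halves ε))))
        (normSq-+ (reₙ z n) (imₙ z n) (reₙ w n) (imₙ w n)
          (⊕-nonNeg (nonNeg b) (ℚₚ.<⇒≤ (½-pos 0<ε))) (⊕-nonNeg (nonNeg c) (ℚₚ.<⇒≤ (½-pos 0<ε))) p q))
      (eventually b (½ ⊗ ε) (½-pos 0<ε)) (eventually c (½ ⊗ ε) (½-pos 0<ε))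
    where open ℚSolver

  -- The slack η = ε/(r + s + 1 + ε) is at most 1, so (r + η)(s + η) ≤ r s + η (r + s + 1) ≤ r s + ε.
  bounded-* : ∀ {z w r s} → Bounded z r → Bounded w s → Bounded (z * w) (r ⊗ s)
  bounded-* {z} {w} {r} {s} b c = bounded (⊗-nonNeg (nonNeg b) (nonNeg c)) λ ε 0<ε →
    let T   = r ⊕ s ⊕ 1ℚ ⊕ ε
        η   = ε ⊗ recip T
        0≤ε = ℚₚ.<⇒≤ 0<ε
        0≤T′ = ⊕-nonNeg (⊕-nonNeg (nonNeg b) (nonNeg c)) 0≤1ℚ
        0<T = subst (0ℚ ℚ.<_) (ℚR.+-comm ε (r ⊕ s ⊕ 1ℚ)) (⊕-pos 0<ε 0≤T′)
        0<η = ⊗-pos 0<ε (recip-pos 0<T)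
        0≤η = ℚₚ.<⇒≤ 0<η
        ηT≡ε = ⊗-recip-cancel ε 0<T
        η≤1 = ⊗-cancelˡ-≤ T 0<T (difference⇒≤ (r ⊕ s ⊕ 1ℚ) 0≤T′
          (trans (solve 2 (λ a e → (a :+ e) :* # 1 := e :+ a) refl (r ⊕ s ⊕ 1ℚ) ε)
            (cong (_⊕ (r ⊕ s ⊕ 1ℚ)) (sym (trans (ℚR.*-comm T η) ηT≡ε)))))
        slack = ℚₚ.≤-trans
          (difference⇒≤ (η ⊗ ε ⊕ η ⊗ (1ℚ ⊝ η))
            (⊕-nonNeg (⊗-nonNeg 0≤η 0≤ε) (⊗-nonNeg 0≤η (p≤q⇒0≤q⊝p η≤1)))
            (solve 4 (λ r s h e → r :* s :+ h :* (r :+ s :+ # 1 :+ e)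
              := (r :+ h) :* (s :+ h) :+ (h :* e :+ h :* (# 1 :- h))) refl r s η ε))
          (ℚₚ.≤-reflexive (cong (r ⊗ s ⊕_) ηT≡ε))
    in eventually-map₂ (λ n p q → subst (ℚ._≤ (r ⊗ s ⊕ ε) ⊗ (r ⊗ s ⊕ ε))
        (sym (cong₂ normSq (reₙ-* z w n) (imₙ-* z w n)))
        (ℚₚ.≤-trans (normSq-*-≤ (reₙ z n) (imₙ z n) (reₙ w n) (imₙ w n) p q)
          (square-mono (⊗-nonNeg (⊕-nonNeg (nonNeg b) 0≤η) (⊕-nonNeg (nonNeg c) 0≤η)) slack)))
      (eventually b η 0<η) (eventually c η 0<η)
    where open ℚSolver

  bounded-neg : ∀ {z r} → Bounded z r → Bounded (- z) r
  bounded-neg {z} {r} b = bounded (nonNeg b) λ ε 0<ε → eventually-map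
    (λ n → subst (ℚ._≤ (r ⊕ ε) ⊗ (r ⊕ ε)) (sym (trans (cong₂ normSq (reₙ-neg z n) (imₙ-neg z n))
      (solve 2 (λ a b → :- a :* :- a :+ :- b :* :- b := a :* a :+ b :* b) refl (reₙ z n) (imₙ z n)))))
    (eventually b ε 0<ε)
    where open ℚSolver

  opaque
    unfolding reₙ

    components-bounded : ∀ z → ∃[ A ] ∃[ B ] 0ℚ ℚ.< A × 0ℚ ℚ.< B ×
      Eventually (λ n → ℚ.∣ reₙ z n ∣ ℚ.≤ A) × Eventually (λ n → ℚ.∣ imₙ z n ∣ ℚ.≤ B)
    components-bounded z = let A , 0<A , re≤ = eventually-bounded (re z)
                               B , 0<B , im≤ = eventually-bounded (im z)
      in A , B , 0<A , 0<B , re≤ , im≤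

  bound : ∀ z → ∃[ r ] Bounded z r
  bound z = let A , B , 0<A , 0<B , re≤ , im≤ = components-bounded z
                0≤A+B = ⊕-nonNeg (ℚₚ.<⇒≤ 0<A) (ℚₚ.<⇒≤ 0<B)
    in A ⊕ B , bounded 0≤A+B λ ε 0<ε →
      eventually-map₂ (λ n p q → ℚₚ.≤-trans (normSq-∣∣ p q) (square-mono 0≤A+B (p≤p⊕q (ℚₚ.<⇒≤ 0<ε)))) re≤ im≤

  ≐⇒≋ : ∀ {z w} → z ≐ w → z ≋ w
  ≐⇒≋ {z} {w} (pointwise re≡ im≡) = equal (bounded ℚₚ.≤-refl λ ε 0<ε → 0 , λ n _ → subst (ℚ._≤ (0ℚ ⊕ ε) ⊗ (0ℚ ⊕ ε))
    (sym (trans (cong₂ normSq (zeroʳᵉ n) (zeroⁱᵐ n)) (trans (cong₂ _⊕_ (ℚR.zeroˡ 0ℚ) (ℚR.zeroˡ 0ℚ)) (ℚR.+-identityˡ 0ℚ))))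
    (0≤pp (0ℚ ⊕ ε)))
    where
    zeroʳᵉ : ∀ n → reₙ (z - w) n ≡ 0ℚ
    zeroʳᵉ n = trans (reₙ-- z w n) (trans (cong (_⊝ reₙ w n) (re≡ n)) (ℚR.-‿inverseʳ _))
    zeroⁱᵐ : ∀ n → imₙ (z - w) n ≡ 0ℚ
    zeroⁱᵐ n = trans (imₙ-- z w n) (trans (cong (_⊝ imₙ w n) (im≡ n)) (ℚR.-‿inverseʳ _))

  -- The ring ℚ(i). Sequences in it form a ring under pointwise operations, ℂ with `_≐_` embeds
  -- there by its coordinates, and the ring laws are pulled back along this embedding.
  module Gaussian where
    open ℚSolver

    Pair : Set
    Pair = ℚ × ℚ

    infixl 6 _+ᵍ_
    infixl 7 _*ᵍ_

    _+ᵍ_ _*ᵍ_ : Pair → Pair → Pair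
    (a , b) +ᵍ (c , d) = a ⊕ c , b ⊕ d
    (a , b) *ᵍ (c , d) = a ⊗ c ⊝ b ⊗ d , a ⊗ d ⊕ b ⊗ c

    -ᵍ_ : Pair → Pair
    -ᵍ (a , b) = ⊖ a , ⊖ b

    *ᵍ-comm : ∀ z w → z *ᵍ w ≡ w *ᵍ z
    *ᵍ-comm (a , b) (c , d) = cong₂ _,_
      (solve 4 (λ a b c d → a :* c :- b :* d := c :* a :- d :* b) refl a b c d)
      (solve 4 (λ a b c d → a :* d :+ b :* c := c :* b :+ d :* a) refl a b c d)

    *ᵍ-identityˡ : ∀ z → (1ℚ , 0ℚ) *ᵍ z ≡ z
    *ᵍ-identityˡ (a , b) = cong₂ _,_
      (solve 2 (λ a b → # 1 :* a :- # 0 :* b := a) refl a b)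
      (solve 2 (λ a b → # 1 :* b :+ # 0 :* a := b) refl a b)

    *ᵍ-distribˡ : ∀ x y z → x *ᵍ (y +ᵍ z) ≡ x *ᵍ y +ᵍ x *ᵍ z
    *ᵍ-distribˡ (a , b) (c , d) (e , f) = cong₂ _,_
      (solve 6 (λ a b c d e f → a :* (c :+ e) :- b :* (d :+ f) := a :* c :- b :* d :+ (a :* e :- b :* f)) refl a b c d e f)
      (solve 6 (λ a b c d e f → a :* (d :+ f) :+ b :* (c :+ e) := a :* d :+ b :* c :+ (a :* f :+ b :* e)) refl a b c d e f)

    commutativeRing : CommutativeRing 0ℓ 0ℓ
    commutativeRing = record
      { Carrier = Pair ; _≈_ = _≡_ ; _+_ = _+ᵍ_ ; _*_ = _*ᵍ_ ; -_ = -ᵍ_ ; 0# = 0ℚ , 0ℚ ; 1# = 1ℚ , 0ℚ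
      ; isCommutativeRing = record
        { isRing = record
          { +-isAbelianGroup = record
            { isGroup = record
              { isMonoid = record
                { isSemigroup = record
                  { isMagma = record { isEquivalence = isEquivalence ; ∙-cong = cong₂ _+ᵍ_ }
                  ; assoc = λ { (a , b) (c , d) (e , f) → cong₂ _,_ (ℚR.+-assoc a c e) (ℚR.+-assoc b d f) } }
                ; identity = (λ { (a , b) → cong₂ _,_ (ℚR.+-identityˡ a) (ℚR.+-identityˡ b) })
                           , (λ { (a , b) → cong₂ _,_ (ℚR.+-identityʳ a) (ℚR.+-identityʳ b) }) }
              ; inverse = (λ { (a , b) → cong₂ _,_ (ℚR.-‿inverseˡ a) (ℚR.-‿inverseˡ b) })
                        , (λ { (a , b) → cong₂ _,_ (ℚR.-‿inverseʳ a) (ℚR.-‿inverseʳ b) })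
              ; ⁻¹-cong = cong -ᵍ_ }
            ; comm = λ { (a , b) (c , d) → cong₂ _,_ (ℚR.+-comm a c) (ℚR.+-comm b d) } }
          ; *-cong = cong₂ _*ᵍ_
          ; *-assoc = λ { (a , b) (c , d) (e , f) → cong₂ _,_
              (solve 6 (λ a b c d e f → (a :* c :- b :* d) :* e :- (a :* d :+ b :* c) :* f
                := a :* (c :* e :- d :* f) :- b :* (c :* f :+ d :* e)) refl a b c d e f)
              (solve 6 (λ a b c d e f → (a :* c :- b :* d) :* f :+ (a :* d :+ b :* c) :* e
                := a :* (c :* f :+ d :* e) :+ b :* (c :* e :- d :* f)) refl a b c d e f) }
          ; *-identity = *ᵍ-identityˡ , (λ z → trans (*ᵍ-comm z (1ℚ , 0ℚ)) (*ᵍ-identityˡ z))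
          ; distrib = *ᵍ-distribˡ , (λ x y z → trans (*ᵍ-comm (y +ᵍ z) x)
              (trans (*ᵍ-distribˡ x y z) (cong₂ _+ᵍ_ (*ᵍ-comm x y) (*ᵍ-comm x z))))
          }
        ; *-comm = *ᵍ-comm
        }
      }

  module Pointwiseᵍ = CommutativeRing (Pointwise.commutativeRing ℕ Gaussian.commutativeRing)

  ≐-rawRing : RawRing 0ℓ 0ℓ
  ≐-rawRing = record { Carrier = ℂ ; _≈_ = _≐_ ; _+_ = _+_ ; _*_ = _*_ ; -_ = -_ ; 0# = 0# ; 1# = 1# }

  components-isRingMonomorphism : IsRingMonomorphism ≐-rawRing Pointwiseᵍ.rawRing (λ z n → reₙ z n , imₙ z n)
  components-isRingMonomorphism = record
    { isRingHomomorphism = record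
      { isSemiringHomomorphism = record
        { isNearSemiringHomomorphism = record
          { +-isMonoidHomomorphism = record
            { isMagmaHomomorphism = record
              { isRelHomomorphism = record { cong = λ z≐w n → cong₂ _,_ (_≐_.re≡ z≐w n) (_≐_.im≡ z≐w n) }
              ; homo = λ z w n → cong₂ _,_ (reₙ-+ z w n) (imₙ-+ z w n) }
            ; ε-homo = λ n → cong₂ _,_ (re0≡ n) (im0≡ n) }
          ; *-homo = λ z w n → cong₂ _,_ (reₙ-* z w n) (imₙ-* z w n) }
        ; 1#-homo = λ n → cong₂ _,_ (re1≡ n) (im1≡ n) }
      ; -‿homo = λ z n → cong₂ _,_ (reₙ-neg z n) (imₙ-neg z n) }
    ; injective = λ eq → pointwise (λ n → cong proj₁ (eq n)) (λ n → cong proj₂ (eq n))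
    }

  ≐-commutativeRing : CommutativeRing 0ℓ 0ℓ
  ≐-commutativeRing = record
    { isCommutativeRing = RingMonomorphism.isCommutativeRing components-isRingMonomorphism Pointwiseᵍ.isCommutativeRing }

  module ≐ where
    open CommutativeRing ≐-commutativeRing public
    open ℤ-Solver ≐-commutativeRing public

  -- The axioms are inherited from `_≐_`; estimates enter only for symmetry, transitivity and the
  -- congruences. For products, xu - yv = (x - y)u + y(u - v), and 0 times the bound of a factor is
  -- 0.
  ℂ-commutativeRing : CommutativeRing 0ℓ 0ℓ
  ℂ-commutativeRing = record
    { Carrier = ℂ ; _≈_ = _≋_ ; _+_ = _+_ ; _*_ = _*_ ; -_ = -_ ; 0# = 0# ; 1# = 1#
    ; isCommutativeRing = record
      { isRing = record
        { +-isAbelianGroup = record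
          { isGroup = record
            { isMonoid = record
              { isSemigroup = record
                { isMagma = record
                  { isEquivalence = record { refl = ≐⇒≋ ≐.refl ; sym = ≋-sym ; trans = ≋-trans }
                  ; ∙-cong = +-cong }
                ; assoc = λ x y z → ≐⇒≋ (≐.+-assoc x y z) }
              ; identity = (λ x → ≐⇒≋ (≐.+-identityˡ x)) , (λ x → ≐⇒≋ (≐.+-identityʳ x)) }
            ; inverse = (λ x → ≐⇒≋ (≐.-‿inverseˡ x)) , (λ x → ≐⇒≋ (≐.-‿inverseʳ x))
            ; ⁻¹-cong = neg-cong }
          ; comm = λ x y → ≐⇒≋ (≐.+-comm x y) }
        ; *-cong = *-cong
        ; *-assoc = λ x y z → ≐⇒≋ (≐.*-assoc x y z)
        ; *-identity = (λ x → ≐⇒≋ (≐.*-identityˡ x)) , (λ x → ≐⇒≋ (≐.*-identityʳ x))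
        ; distrib = (λ x y z → ≐⇒≋ (≐.distribˡ x y z)) , (λ x y z → ≐⇒≋ (≐.distribʳ x y z))
        }
      ; *-comm = λ x y → ≐⇒≋ (≐.*-comm x y)
      }
    }
    where
    open ≐ using (solve; _:=_; _:+_; _:*_; _:-_; :-_)
    0⊕0 : ∀ {z} → Bounded z (0ℚ ⊕ 0ℚ) → Bounded z 0ℚ
    0⊕0 {z} = subst (Bounded z) (ℚR.+-identityˡ 0ℚ)
    ≋-sym : ∀ {z w} → z ≋ w → w ≋ z
    ≋-sym {z} {w} z≋w = equal (bounded-≐ (solve 2 (λ z w → :- (z :- w) := w :- z) ≐.refl z w) (bounded-neg (difference z≋w)))
    ≋-trans : ∀ {x y z} → x ≋ y → y ≋ z → x ≋ z
    ≋-trans {x} {y} {z} x≋y y≋z = equal (bounded-≐ (solve 3 (λ x y z → (x :- y) :+ (y :- z) := x :- z) ≐.refl x y z)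
      (0⊕0 (bounded-+ (difference x≋y) (difference y≋z))))
    +-cong : ∀ {x y u v} → x ≋ y → u ≋ v → x + u ≋ y + v
    +-cong {x} {y} {u} {v} x≋y u≋v = equal (bounded-≐
      (solve 4 (λ x y u v → (x :- y) :+ (u :- v) := (x :+ u) :- (y :+ v)) ≐.refl x y u v)
      (0⊕0 (bounded-+ (difference x≋y) (difference u≋v))))
    neg-cong : ∀ {x y} → x ≋ y → - x ≋ - y
    neg-cong {x} {y} x≋y = equal (bounded-≐ (solve 2 (λ x y → :- (x :- y) := (:- x) :- (:- y)) ≐.refl x y)
      (bounded-neg (difference x≋y)))
    *-cong : ∀ {x y u v} → x ≋ y → u ≋ v → x * u ≋ y * v
    *-cong {x} {y} {u} {v} x≋y u≋v = equal (bounded-≐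
      (solve 4 (λ x y u v → (x :- y) :* u :+ y :* (u :- v) := x :* u :- y :* v) ≐.refl x y u v)
      (subst (Bounded _) (trans (cong₂ _⊕_ (ℚR.zeroˡ _) (ℚR.zeroʳ _)) (ℚR.+-identityˡ 0ℚ))
        (bounded-+ (bounded-* (difference x≋y) (proj₂ (bound u))) (bounded-* (proj₂ (bound y)) (difference u≋v)))))

  -- Completeness of ℂ

  p≤∣p∣ : ∀ p → p ℚ.≤ ℚ.∣ p ∣
  p≤∣p∣ p = square-cancel (ℚₚ.0≤∣p∣ p) (ℚₚ.≤-reflexive (sym (∣p∣∣p∣≡pp p)))

  ≤+ε⇒≤ : ∀ {p q} → (∀ ε → 0ℚ ℚ.< ε → p ℚ.≤ q ⊕ ε) → p ℚ.≤ q
  ≤+ε⇒≤ {p} {q} p≤q+ε with p ℚₚ.≤? q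
  ... | yes p≤q = p≤q
  ... | no  p≰q = contradiction (ℚₚ.≤-<-trans (p≤q+ε (½ ⊗ d) (½-pos 0<d))
      (subst₂ ℚ._<_ (ℚR.+-comm (½ ⊗ d) q) (solve 2 (λ p q → (p :- q) :+ q := p) refl p q) (⊕-mono-<-≤ (½p<p 0<d) (ℚₚ.≤-refl {q}))))
      (ℚₚ.<-irrefl refl)
    where
    open ℚSolver
    d = p ⊝ q
    0<d = p<q⇒0<q⊝p (ℚₚ.≰⇒> p≰q)

  -- The diagonal limit: its k-th term is a late term of a late member of the sequence.
  module _ (x : ℕ → ℕ → ℚ) (x-cauchy : ∀ n → Cauchy (x n))
    (modulus : ∀ ε → 0ℚ ℚ.< ε → ∃[ N ] (∀ n → N ℕ.≤ n → Eventually (λ i → ℚ.∣ x n i ⊝ x N i ∣ ℚ.≤ ε))) where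
    private
      0≤½ = ℚₚ.<⇒≤ 0<½
      module G = GeometricBounds {½} 0≤½ (subst₂ ℚ._<_ (ℚR.*-identityʳ ½) refl (½p<p 0<1ℚ))

      η : ℕ → ℚ
      η k = ½ ^ℚ k

      0<η : ∀ k → 0ℚ ℚ.< η k
      0<η zero    = 0<1ℚ
      0<η (suc k) = ½-pos (0<η k)

      -- `N k` is a stage after which the members stay within 2^(-k) of the one at `N k`; `M k` is a
      -- stage after which the approximations to that member vary by less than 2^(-k).
      N : ℕ → ℕ
      N k = proj₁ (modulus (η k) (0<η k))

      M : ℕ → ℕ
      M k = proj₁ (x-cauchy (N k) (η k) (0<η k))

    diagonal : ℕ → ℚ
    diagonal k = x (N k) (M k)

    private
      near-diagonal : ∀ k i → M k ℕ.≤ i → ℚ.∣ x (N k) i ⊝ diagonal k ∣ ℚ.≤ η k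
      near-diagonal k i M≤i = ℚₚ.<⇒≤ (proj₂ (x-cauchy (N k) (η k) (0<η k)) i (M k) M≤i ℕₚ.≤-refl)

      triangle₃ : ∀ {a b c d r s t} → ℚ.∣ a ⊝ b ∣ ℚ.≤ r → ℚ.∣ b ⊝ c ∣ ℚ.≤ s → ℚ.∣ c ⊝ d ∣ ℚ.≤ t →
        ℚ.∣ a ⊝ d ∣ ℚ.≤ r ⊕ s ⊕ t
      triangle₃ {a} {b} {c} {d} p q u = ℚₚ.≤-trans (∣p⊝q∣-triangle a c d)
        (⊕-mono-≤ (ℚₚ.≤-trans (∣p⊝q∣-triangle a b c) (⊕-mono-≤ p q)) u)

      flip : ∀ {p q r} → ℚ.∣ p ⊝ q ∣ ℚ.≤ r → ℚ.∣ q ⊝ p ∣ ℚ.≤ r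
      flip {p} {q} {r} = subst (ℚ._≤ r) (∣p⊝q∣-sym p q)

      -- For a common later member `n` and a late index `i`, the path leads through `x (N k) i`,
      -- `x n i` and `x (N l) i`; each of its four steps costs at most δ.
      diagonal-close : ∀ k l {δ} → η k ℚ.≤ δ → η l ℚ.≤ δ →
        ℚ.∣ diagonal k ⊝ diagonal l ∣ ℚ.≤ δ ⊕ (δ ⊕ δ) ⊕ δ
      diagonal-close k l {δ} ηk≤δ ηl≤δ = triangle₃
          (flip (ℚₚ.≤-trans (near-diagonal k i (ℕₚ.m⊔n≤o⇒m≤o (M k) (M l) ≤i)) ηk≤δ))
          (ℚₚ.≤-trans (∣p⊝q∣-triangle (x (N k) i) (x n i) (x (N l) i))
            (⊕-mono-≤ (ℚₚ.≤-trans (flip (proj₁ (proj₂ near i (ℕₚ.m≤n⊔m (M k ℕ.⊔ M l) (proj₁ near))))) ηk≤δ)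
                      (ℚₚ.≤-trans (proj₂ (proj₂ near i (ℕₚ.m≤n⊔m (M k ℕ.⊔ M l) (proj₁ near)))) ηl≤δ)))
          (ℚₚ.≤-trans (near-diagonal l i (ℕₚ.m⊔n≤o⇒n≤o (M k) (M l) ≤i)) ηl≤δ)
        where
        n = N k ℕ.⊔ N l
        near : Eventually (λ i → ℚ.∣ x n i ⊝ x (N k) i ∣ ℚ.≤ η k × ℚ.∣ x n i ⊝ x (N l) i ∣ ℚ.≤ η l)
        near = eventually-map₂ (λ _ → _,_)
          (proj₂ (modulus (η k) (0<η k)) n (ℕₚ.m≤m⊔n (N k) (N l)))
          (proj₂ (modulus (η l) (0<η l)) n (ℕₚ.m≤n⊔m (N k) (N l)))
        i = M k ℕ.⊔ M l ℕ.⊔ proj₁ near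
        ≤i : M k ℕ.⊔ M l ℕ.≤ i
        ≤i = ℕₚ.m≤m⊔n (M k ℕ.⊔ M l) (proj₁ near)

      -- In `diagonal-limit` three distances are added to the four of `diagonal-close`, seven in
      -- all, so an eighth of ε for each suffices; in `diagonal-cauchy` the four alone give ε/2,
      -- which is strictly below ε.
      eighth : ℚ → ℚ
      eighth ε = ½ ⊗ (½ ⊗ (½ ⊗ ε))

      0<eighth : ∀ {ε} → 0ℚ ℚ.< ε → 0ℚ ℚ.< eighth ε
      0<eighth 0<ε = ½-pos (½-pos (½-pos 0<ε))

      4-eighths : ∀ ε → eighth ε ⊕ (eighth ε ⊕ eighth ε) ⊕ eighth ε ≡ ½ ⊗ ε
      4-eighths ε = trans (solve 1 (λ d → d :+ (d :+ d) :+ d := (d :+ d) :+ (d :+ d)) refl (eighth ε))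
        (trans (cong₂ _⊕_ (halves (½ ⊗ (½ ⊗ ε))) (halves (½ ⊗ (½ ⊗ ε)))) (halves (½ ⊗ ε)))
        where open ℚSolver

      late : ∀ ε → 0ℚ ℚ.< ε → ∃[ k₀ ] (∀ k → k₀ ℕ.≤ k → η k ℚ.≤ eighth ε)
      late ε 0<ε = let k₀ , small = G.^ℚ-small 1ℚ 0≤1ℚ (0<eighth 0<ε)
        in k₀ , λ k k₀≤k → subst (ℚ._≤ eighth ε) (ℚR.*-identityˡ (η k)) (small k k₀≤k)

    diagonal-cauchy : Cauchy diagonal
    diagonal-cauchy ε 0<ε = let k₀ , small = late ε 0<ε in k₀ , λ k l k₀≤k k₀≤l →
      ℚₚ.≤-<-trans (diagonal-close k l (small k k₀≤k) (small l k₀≤l))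
        (subst (ℚ._< ε) (sym (4-eighths ε)) (½p<p 0<ε))

    diagonal-limit : ∀ ε → 0ℚ ℚ.< ε → ∃[ n₀ ] (∀ n → n₀ ℕ.≤ n → Eventually (λ i → ℚ.∣ x n i ⊝ diagonal i ∣ ℚ.≤ ε))
    diagonal-limit ε 0<ε = N k₀ , λ n N≤n →
      let near = proj₂ (modulus (η k₀) (0<η k₀)) n N≤n
          i₀ , x-close = x-cauchy n δ (0<eighth 0<ε)
      in k₀ ℕ.⊔ i₀ , λ i ≤i →
        let j  = i₀ ℕ.⊔ M k₀ ℕ.⊔ proj₁ near
            ≤j = ℕₚ.m≤m⊔n (i₀ ℕ.⊔ M k₀) (proj₁ near)
        in ℚₚ.≤-trans (∣p⊝q∣-triangle (x n i) (diagonal k₀) (diagonal i))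
            (ℚₚ.≤-trans (⊕-mono-≤
                (triangle₃
                  (ℚₚ.<⇒≤ (x-close i j (ℕₚ.m⊔n≤o⇒n≤o k₀ i₀ ≤i) (ℕₚ.m⊔n≤o⇒m≤o i₀ (M k₀) ≤j)))
                  (ℚₚ.≤-trans (proj₂ near j (ℕₚ.m≤n⊔m (i₀ ℕ.⊔ M k₀) (proj₁ near))) (small k₀ ℕₚ.≤-refl))
                  (ℚₚ.≤-trans (near-diagonal k₀ j (ℕₚ.m⊔n≤o⇒n≤o i₀ (M k₀) ≤j)) (small k₀ ℕₚ.≤-refl)))
                (diagonal-close k₀ i (small k₀ ℕₚ.≤-refl) (small i (ℕₚ.m⊔n≤o⇒m≤o k₀ i₀ ≤i))))
              total)
      where
      open ℚSolver
      δ = eighth ε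
      k₀ = proj₁ (late ε 0<ε)
      small = proj₂ (late ε 0<ε)
      total : δ ⊕ δ ⊕ δ ⊕ (δ ⊕ (δ ⊕ δ) ⊕ δ) ℚ.≤ ε
      total = difference⇒≤ δ (ℚₚ.<⇒≤ (0<eighth 0<ε)) (trans (sym (trans (cong₂ _⊕_ (4-eighths ε) (4-eighths ε)) (halves ε)))
        (solve 1 (λ d → (d :+ (d :+ d) :+ d) :+ (d :+ (d :+ d) :+ d) := (d :+ d :+ d :+ (d :+ (d :+ d) :+ d)) :+ d) refl δ))

  bounded-real : ∀ z r → 0ℚ ℚ.≤ r → (∀ n → reₙ z n ≡ r) → (∀ n → imₙ z n ≡ 0ℚ) → Bounded z r
  bounded-real z r 0≤r re≡ im≡ = bounded 0≤r λ ε 0<ε → 0 , λ n _ → subst (ℚ._≤ (r ⊕ ε) ⊗ (r ⊕ ε))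
    (sym (trans (cong₂ normSq (re≡ n) (im≡ n)) (trans (cong (r ⊗ r ⊕_) (ℚR.zeroˡ 0ℚ)) (ℚR.+-identityʳ (r ⊗ r)))))
    (square-mono 0≤r (p≤p⊕q (ℚₚ.<⇒≤ 0<ε)))

  bounded-≋ : ∀ {z w r} → z ≋ w → Bounded z r → Bounded w r
  bounded-≋ {z} {w} {r} z≋w b = subst (Bounded w) (ℚR.+-identityʳ r)
    (bounded-≐ (≐.solve 2 (λ z w → z ≐.:+ ≐.:- (z ≐.:- w) ≐.:= w) ≐.refl z w) (bounded-+ b (bounded-neg (difference z≋w))))

  bounded-≤ : ∀ {z r s} → r ℚ.≤ s → Bounded z r → Bounded z s
  bounded-≤ r≤s b = bounded (ℚₚ.≤-trans (nonNeg b) r≤s) λ ε 0<ε → eventually-map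
    (λ n sq≤ → ℚₚ.≤-trans sq≤ (square-mono (⊕-nonNeg (nonNeg b) (ℚₚ.<⇒≤ 0<ε)) (⊕-mono-≤ r≤s ℚₚ.≤-refl))) (eventually b ε 0<ε)

  bounded-0⇒≋0 : ∀ {z} → Bounded z 0ℚ → z ≋ 0#
  bounded-0⇒≋0 {z} b = equal (bounded-≐ (≐.solve 1 (λ z → z ≐.:= z ≐.:- ≐.# 0) ≐.refl z) b)

  bounded-limit : ∀ {z r} → (∀ ε → 0ℚ ℚ.< ε → Bounded z (r ⊕ ε)) → Bounded z r
  bounded-limit {z} {r} b = bounded (≤+ε⇒≤ (λ ε 0<ε → nonNeg (b ε 0<ε))) λ ε 0<ε → eventually-map
    (λ n → subst (λ t → normSqₙ z n ℚ.≤ t ⊗ t) (trans (ℚR.+-assoc r (½ ⊗ ε) (½ ⊗ ε)) (cong (r ⊕_) (halves ε))))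
    (eventually (b (½ ⊗ ε) (½-pos 0<ε)) (½ ⊗ ε) (½-pos 0<ε))

  -- Coordinatewise, with ε/2 for each coordinate because |z| ≤ |Re z| + |Im z|.
  ℂ-complete : ∀ (s : ℕ → ℂ) → (∀ ε → 0ℚ ℚ.< ε → ∃[ N ] (∀ n → N ℕ.≤ n → Bounded (s n - s N) ε)) →
    ∃[ L ] (∀ ε → 0ℚ ℚ.< ε → ∃[ N ] (∀ n → N ℕ.≤ n → Bounded (s n - L) ε))
  ℂ-complete s modulus = L , λ ε 0<ε →
    let N₁ , close₁ = diagonal-limit (λ n → reₙ (s n)) (λ n → cauchyʳᵉ (s n)) modulusʳᵉ (½ ⊗ ε) (½-pos 0<ε)
        N₂ , close₂ = diagonal-limit (λ n → imₙ (s n)) (λ n → cauchyⁱᵐ (s n)) modulusⁱᵐ (½ ⊗ ε) (½-pos 0<ε)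
        0≤ε = ℚₚ.<⇒≤ 0<ε
    in N₁ ℕ.⊔ N₂ , λ n ≤n → bounded 0≤ε λ ε′ 0<ε′ → eventually-map₂
      (λ i p q → ℚₚ.≤-trans (normSq-∣∣ (subst (λ t → ℚ.∣ t ∣ ℚ.≤ ½ ⊗ ε) (sym (reL n i)) p)
                                       (subst (λ t → ℚ.∣ t ∣ ℚ.≤ ½ ⊗ ε) (sym (imL n i)) q))
        (subst (λ t → t ⊗ t ℚ.≤ (ε ⊕ ε′) ⊗ (ε ⊕ ε′)) (sym (halves ε)) (square-mono 0≤ε (p≤p⊕q (ℚₚ.<⇒≤ 0<ε′)))))
      (close₁ n (ℕₚ.m⊔n≤o⇒m≤o N₁ N₂ ≤n)) (close₂ n (ℕₚ.m⊔n≤o⇒n≤o N₁ N₂ ≤n))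
    where
    both : ∀ ε → 0ℚ ℚ.< ε → ∃[ N ] (∀ n → N ℕ.≤ n →
      Eventually (λ i → ℚ.∣ reₙ (s n - s N) i ∣ ℚ.≤ ε × ℚ.∣ imₙ (s n - s N) i ∣ ℚ.≤ ε))
    both ε 0<ε = let N , close = modulus (½ ⊗ ε) (½-pos 0<ε) in N , λ n N≤n →
      subst (λ r → Eventually (λ i → ℚ.∣ reₙ (s n - s N) i ∣ ℚ.≤ r × ℚ.∣ imₙ (s n - s N) i ∣ ℚ.≤ r)) (halves ε)
        (components (close n N≤n) (½ ⊗ ε) (½-pos 0<ε))
    modulusʳᵉ : ∀ ε → 0ℚ ℚ.< ε → ∃[ N ] (∀ n → N ℕ.≤ n → Eventually (λ i → ℚ.∣ reₙ (s n) i ⊝ reₙ (s N) i ∣ ℚ.≤ ε))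
    modulusʳᵉ ε 0<ε = let N , close = both ε 0<ε in N , λ n N≤n → eventually-map
      (λ i p → subst (λ t → ℚ.∣ t ∣ ℚ.≤ ε) (reₙ-- (s n) (s N) i) (proj₁ p)) (close n N≤n)
    modulusⁱᵐ : ∀ ε → 0ℚ ℚ.< ε → ∃[ N ] (∀ n → N ℕ.≤ n → Eventually (λ i → ℚ.∣ imₙ (s n) i ⊝ imₙ (s N) i ∣ ℚ.≤ ε))
    modulusⁱᵐ ε 0<ε = let N , close = both ε 0<ε in N , λ n N≤n → eventually-map
      (λ i p → subst (λ t → ℚ.∣ t ∣ ℚ.≤ ε) (imₙ-- (s n) (s N) i) (proj₂ p)) (close n N≤n)
    a = diagonal (λ n → reₙ (s n)) (λ n → cauchyʳᵉ (s n)) modulusʳᵉ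
    b = diagonal (λ n → imₙ (s n)) (λ n → cauchyⁱᵐ (s n)) modulusⁱᵐ
    ca = diagonal-cauchy (λ n → reₙ (s n)) (λ n → cauchyʳᵉ (s n)) modulusʳᵉ
    cb = diagonal-cauchy (λ n → imₙ (s n)) (λ n → cauchyⁱᵐ (s n)) modulusⁱᵐ
    L = mkℂ a b ca cb
    reL : ∀ n i → reₙ (s n - L) i ≡ reₙ (s n) i ⊝ a i
    reL n i = trans (reₙ-- (s n) L i) (cong (reₙ (s n) i ⊝_) (reₙ-mkℂ a b ca cb i))
    imL : ∀ n i → imₙ (s n - L) i ≡ imₙ (s n) i ⊝ b i
    imL n i = trans (imₙ-- (s n) L i) (cong (imₙ (s n) i ⊝_) (imₙ-mkℂ a b ca cb i))

  ℂ-completeNorm : CompleteNorm ℂ-commutativeRing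
  ℂ-completeNorm = record
    { ∥_∥≤_      = Bounded
    ; norm-cong  = bounded-≋
    ; norm-≤     = bounded-≤
    ; norm-≥0    = nonNeg
    ; norm-1     = bounded-real 1# 1ℚ 0≤1ℚ re1≡ im1≡
    ; norm-+     = bounded-+
    ; norm-*     = bounded-*
    ; norm-neg   = bounded-neg
    ; norm-0⇒≈0  = bounded-0⇒≋0
    ; norm-0     = bounded-real 0# 0ℚ ℚₚ.≤-refl re0≡ im0≡
    ; norm-limit = bounded-limit
    ; norm-bound = bound
    ; complete   = ℂ-complete
    }

  -- Apartness, inverses and convergence in ℂ

  open CommutativeRing ℂ-commutativeRing using ()
    renaming (refl to ≋-refl; sym to ≋-sym; trans to ≋-trans; *-congˡ to ≋-*-congˡ)
  open Limits ℂ-completeNorm using (_↝_; ↝-cong; module WithRatio)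
  open FiniteSums ℂ-commutativeRing using (_^_; sum; product; sum-cong; poch; cancelˡ)
  open QIdentities ℂ-commutativeRing using (Reciprocal; seriesTerm; signedPower)
  open Bounded

  ½⊗½ : ℚ
  ½⊗½ = ½ ⊗ ½

  0<½⊗½ : 0ℚ ℚ.< ½⊗½
  0<½⊗½ = ½-pos 0<½

  -- Apartness asks for an explicit gap. Eventually Re(zw) ≥ ½, so |z|²|w|² ≥ ¼, and an eventual
  -- upper bound `T` of |w|² gives |z|² ≥ 1/(4T).
  inverse⇒#0 : ∀ z w → z * w ≋ 1# → z #0
  inverse⇒#0 z w zw≋1 = ⇒#0 z (½⊗½ ⊗ recip T) (⊗-pos 0<½⊗½ (recip-pos 0<T))
    (eventually-map₂ lower-bound
      (eventually (proj₂ (bound w)) 1ℚ 0<1ℚ)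
      (components (difference zw≋1) ½ 0<½))
    where
    open ℚSolver
    r = proj₁ (bound w)
    T = (r ⊕ 1ℚ) ⊗ (r ⊕ 1ℚ)
    0<r+1 : 0ℚ ℚ.< r ⊕ 1ℚ
    0<r+1 = subst (0ℚ ℚ.<_) (ℚR.+-comm 1ℚ r) (⊕-pos 0<1ℚ (nonNeg (proj₂ (bound w))))
    0<T : 0ℚ ℚ.< T
    0<T = ⊗-pos 0<r+1 0<r+1
    lower-bound : ∀ n → normSqₙ w n ℚ.≤ T →
      ℚ.∣ reₙ (z * w - 1#) n ∣ ℚ.≤ 0ℚ ⊕ ½ × ℚ.∣ imₙ (z * w - 1#) n ∣ ℚ.≤ 0ℚ ⊕ ½ →
      ½⊗½ ⊗ recip T ℚ.≤ normSqₙ z n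
    lower-bound n w≤T (close , _) = ⊗-cancelˡ-≤ T 0<T (begin
      T ⊗ (½⊗½ ⊗ recip T)              ≡⟨ ℚR.*-comm T (½⊗½ ⊗ recip T) ⟩
      ½⊗½ ⊗ recip T ⊗ T                ≡⟨ ⊗-recip-cancel ½⊗½ 0<T ⟩
      ½ ⊗ ½                            ≤⟨ square-mono (ℚₚ.<⇒≤ 0<½) ½≤x ⟩
      x ⊗ x                            ≤⟨ p≤p⊕q (0≤pp (imₙ (z * w) n)) ⟩
      normSqₙ (z * w) n                ≡⟨ cong₂ normSq (reₙ-* z w n) (imₙ-* z w n) ⟩
      normSq (reₙ z n ⊗ reₙ w n ⊝ imₙ z n ⊗ imₙ w n) (reₙ z n ⊗ imₙ w n ⊕ imₙ z n ⊗ reₙ w n)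
                                       ≡⟨ normSq-* (reₙ z n) (imₙ z n) (reₙ w n) (imₙ w n) ⟩
      normSqₙ z n ⊗ normSqₙ w n        ≤⟨ ⊗-monoˡ-≤ (normSqₙ z n) (normSq-nonNeg (reₙ z n) (imₙ z n)) w≤T ⟩
      normSqₙ z n ⊗ T                  ≡⟨ ℚR.*-comm (normSqₙ z n) T ⟩
      T ⊗ normSqₙ z n                  ∎)
      where
      open ℚₚ.≤-Reasoning
      x = reₙ (z * w) n
      1-x≤½ : 1ℚ ⊝ x ℚ.≤ ½
      1-x≤½ = begin
        1ℚ ⊝ x                       ≤⟨ p≤∣p∣ (1ℚ ⊝ x) ⟩
        ℚ.∣ 1ℚ ⊝ x ∣                 ≡⟨ ∣p⊝q∣-sym 1ℚ x ⟩
        ℚ.∣ x ⊝ 1ℚ ∣                 ≡⟨ cong ℚ.∣_∣ (trans (reₙ-- (z * w) 1# n) (cong (x ⊝_) (re1≡ n))) ⟨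
        ℚ.∣ reₙ (z * w - 1#) n ∣     ≤⟨ close ⟩
        0ℚ ⊕ ½                       ≡⟨ ℚR.+-identityˡ ½ ⟩
        ½                            ∎
      ½≤x : ½ ℚ.≤ x
      ½≤x = difference⇒≤ (½ ⊝ (1ℚ ⊝ x)) (p≤q⇒0≤q⊝p 1-x≤½) (trans
        (solve 1 (λ x → x := # 1 :- (# 1 :- x)) refl x)
        (trans (cong (_⊝ (1ℚ ⊝ x)) (sym ½⊕½≡1)) (solve 2 (λ h y → (h :+ h) :- y := h :+ (h :- y)) refl ½ (1ℚ ⊝ x))))

  -- The product is exactly 1 at every index where |z|² is positive. Earlier approximations may
  -- vanish, where `recip` gives 0, so the equation holds for `_≋_` and only eventually term by
  -- term.
  *-inverseʳ : ∀ z z#0 → z * inv z z#0 ≋ 1#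
  *-inverseʳ z z#0 = equal (bounded ℚₚ.≤-refl λ ε 0<ε → eventually-map
    (λ n 0<nz → subst (ℚ._≤ (0ℚ ⊕ ε) ⊗ (0ℚ ⊕ ε)) (sym (vanishes n 0<nz)) (0≤pp (0ℚ ⊕ ε))) (#0⇒ z z#0))
    where
    open ℚSolver
    vanishes : ∀ n → 0ℚ ℚ.< normSqₙ z n → normSqₙ (z * inv z z#0 - 1#) n ≡ 0ℚ
    vanishes n 0<nz = trans (cong₂ normSq re≡0 im≡0) (trans (cong₂ _⊕_ (ℚR.zeroˡ 0ℚ) (ℚR.zeroˡ 0ℚ)) (ℚR.+-identityˡ 0ℚ))
      where
      a = reₙ z n
      b = imₙ z n
      r = recip (normSqₙ z n)
      re≡0 : reₙ (z * inv z z#0 - 1#) n ≡ 0ℚ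
      re≡0 = trans (reₙ-- (z * inv z z#0) 1# n) (trans (cong₂ _⊝_
          (trans (reₙ-* z (inv z z#0) n) (trans
            (cong₂ (λ c d → a ⊗ c ⊝ b ⊗ d) (reₙ-inv z z#0 n) (imₙ-inv z z#0 n))
            (trans (solve 3 (λ a b r → a :* (a :* r) :- b :* (:- b :* r) := (a :* a :+ b :* b) :* r) refl a b r)
              (⊗-recip 0<nz))))
          (re1≡ n)) (ℚR.-‿inverseʳ 1ℚ))
      im≡0 : imₙ (z * inv z z#0 - 1#) n ≡ 0ℚ
      im≡0 = trans (imₙ-- (z * inv z z#0) 1# n) (trans (cong₂ _⊝_
          (trans (imₙ-* z (inv z z#0) n) (trans
            (cong₂ (λ c d → a ⊗ d ⊕ b ⊗ c) (reₙ-inv z z#0 n) (imₙ-inv z z#0 n))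
            (solve 3 (λ a b r → a :* (:- b :* r) :+ b :* (a :* r) := # 0) refl a b r)))
          (im1≡ n)) (ℚR.-‿inverseʳ 0ℚ))

  inv≋ : ∀ z w z#0 → z * w ≋ 1# → inv z z#0 ≋ w
  inv≋ z w z#0 zw≋1 = cancelˡ w zw≋1 (≋-trans (*-inverseʳ z z#0) (≋-sym zw≋1))

  -- The target is a strict inequality with a positive gap. With h = ε/2, a bound h/2 and slack h/2
  -- give at most h² for the squared distance, and h² + h² ≤ 4h² = ε² leaves room for the gap h².
  ↝⇒⟶ : ∀ s L → s ↝ L → s ⟶ L
  ↝⇒⟶ s L s↝L ε 0<ε = proj₁ lim , λ n N≤n →
    ⇒∣-∣< (s n) L ε (h ⊗ h) (⊗-pos 0<h 0<h) (eventually-map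
      (λ i sq≤ → ℚₚ.≤-trans (⊕-mono-≤ sq≤ (ℚₚ.≤-refl {h ⊗ h})) enough) (eventually (proj₂ lim n N≤n) (½ ⊗ h) (½-pos 0<h)))
    where
    open ℚSolver
    h = ½ ⊗ ε
    0<h = ½-pos 0<ε
    lim = s↝L (½ ⊗ h) (½-pos 0<h)
    enough : (½ ⊗ h ⊕ ½ ⊗ h) ⊗ (½ ⊗ h ⊕ ½ ⊗ h) ⊕ h ⊗ h ℚ.≤ ε ⊗ ε
    enough = difference⇒≤ (h ⊗ h ⊕ h ⊗ h) (⊕-nonNeg (0≤pp h) (0≤pp h)) (trans
      (cong₂ _⊗_ (sym (halves ε)) (sym (halves ε)))
      (trans (solve 1 (λ h → (h :+ h) :* (h :+ h) := h :* h :+ h :* h :+ (h :* h :+ h :* h)) refl h)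
        (cong (λ x → x ⊗ x ⊕ h ⊗ h ⊕ (h ⊗ h ⊕ h ⊗ h)) (sym (halves h)))))

  -- From |q|² + δ ≤ 1 the ratio ρ = 1 - δ/2 is rational and ρ² = 1 - δ + δ²/4 ≥ |q|². It is
  -- nonnegative because δ ≤ 1.
  ∣∣<1⇒bounded : ∀ q → ∣ q ∣< 1ℚ → ∃[ ρ ] 0ℚ ℚ.≤ ρ × ρ ℚ.< 1ℚ × Bounded q ρ
  ∣∣<1⇒bounded q ∣q∣<1 = ρ , 0≤ρ , ρ<1 , bounded 0≤ρ λ ε 0<ε →
    eventually-map (λ n sq≤ → ℚₚ.≤-trans (below n sq≤) (square-mono 0≤ρ (p≤p⊕q (ℚₚ.<⇒≤ 0<ε)))) (N , sq+δ≤1)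
    where
    open ℚSolver
    gap = ∣∣<⇒ q 1ℚ ∣q∣<1
    δ = proj₁ gap
    0<δ = proj₁ (proj₂ gap)
    N = proj₁ (proj₂ (proj₂ gap))
    sq+δ≤1 = proj₂ (proj₂ (proj₂ gap))
    h = ½ ⊗ δ
    ρ = 1ℚ ⊝ h
    0<h = ½-pos 0<δ
    ρ<1 : ρ ℚ.< 1ℚ
    ρ<1 = subst₂ ℚ._<_ (ℚR.+-identityˡ ρ) (solve 1 (λ h → h :+ (# 1 :- h) := # 1) refl h) (⊕-mono-<-≤ 0<h (ℚₚ.≤-refl {ρ}))
    h≤1 : h ℚ.≤ 1ℚ
    h≤1 = ℚₚ.≤-trans (ℚₚ.<⇒≤ (½p<p 0<δ)) (ℚₚ.≤-trans
      (subst (δ ℚ.≤_) (ℚR.+-comm δ (normSqₙ q N)) (p≤p⊕q (normSq-nonNeg (reₙ q N) (imₙ q N))))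
      (subst (normSqₙ q N ⊕ δ ℚ.≤_) (ℚR.*-identityˡ 1ℚ) (sq+δ≤1 N ℕₚ.≤-refl)))
    0≤ρ : 0ℚ ℚ.≤ ρ
    0≤ρ = p≤q⇒0≤q⊝p h≤1
    below : ∀ n → normSqₙ q n ⊕ δ ℚ.≤ 1ℚ ⊗ 1ℚ → normSqₙ q n ℚ.≤ ρ ⊗ ρ
    below n sq≤ = difference⇒≤ (h ⊗ h ⊕ (1ℚ ⊗ 1ℚ ⊝ (normSqₙ q n ⊕ δ))) (⊕-nonNeg (0≤pp h) (p≤q⇒0≤q⊝p sq≤))
      (trans (solve 2 (λ h s → (# 1 :- h) :* (# 1 :- h) := s :+ (h :* h :+ (# 1 :* # 1 :- (s :+ (h :+ h))))) refl h (normSqₙ q n))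
        (cong (λ d → normSqₙ q n ⊕ (h ⊗ h ⊕ (1ℚ ⊗ 1ℚ ⊝ (normSqₙ q n ⊕ d)))) (halves δ)))

  -- Evaluation of the series in ℂ

  module _ (q : ℂ) where
    denominator numerator : ℕ → ℂ
    denominator n = poch (- q) (q ^ 2) n * poch (q ^ 4) (q ^ 4) n
    numerator n = signedPower q n * poch q (q ^ 2) n

  module _ (q : ℂ) (∣q∣<1 : ∣ q ∣< 1ℚ) where
    private
      ratio = ∣∣<1⇒bounded q ∣q∣<1
      0≤ρ = proj₁ (proj₂ ratio)
      ρ<1 = proj₁ (proj₂ (proj₂ ratio))
      ∥q∥≤ρ = proj₂ (proj₂ (proj₂ ratio))
      open WithRatio 0≤ρ ρ<1
      open SeriesIdentity ℂ-completeNorm 0≤ρ ρ<1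

    SeriesStatement : Set
    SeriesStatement =
      Σ[ den#0 ∈ (∀ n → denominator q n #0) ]
      ∃[ A ] ∃[ B ] ∃[ C ] ∃[ D ] ∃[ E ]
        poch (- q) (q ^ 5) ⟶ A ×
        poch (- (q ^ 4)) (q ^ 5) ⟶ B ×
        poch (q ^ 5) (q ^ 5) ⟶ C ×
        poch q (q ^ 2) ⟶ D ×
        poch (q ^ 2) (q ^ 2) ⟶ E ×
        (Σ[ E#0 ∈ E #0 ]
          (λ n → sum {n} (λ i → numerator q (toℕ i) * inv (denominator q (toℕ i)) (den#0 (toℕ i)))) ⟶ A * B * C * D * inv E E#0)

    series-evaluation : SeriesStatement
    series-evaluation = from (reciprocal (norm-power ∥q∥≤ρ 1)) (reciprocal (norm-power ∥q∥≤ρ 4))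
      (poch-converges (bounded-neg′ ∥q∥≤ρ) (norm-power ∥q∥≤ρ 4))
      (poch-converges (bounded-neg′ (norm-power ∥q∥≤ρ 3)) (norm-power ∥q∥≤ρ 4))
      (poch-converges (norm-ρ⇒1 (norm-power ∥q∥≤ρ 4)) (norm-power ∥q∥≤ρ 4))
      (poch-converges (norm-ρ⇒1 ∥q∥≤ρ) (norm-power ∥q∥≤ρ 1))
      (poch-converges (norm-ρ⇒1 (norm-power ∥q∥≤ρ 1)) (norm-power ∥q∥≤ρ 1))
      where
      bounded-neg′ : ∀ {z} → Bounded z (proj₁ ratio) → Bounded (- z) 1ℚ
      bounded-neg′ b = norm-ρ⇒1 (bounded-neg b)
      from : ∃[ u ] (Reciprocal (q ^ 2) u × Converges u) → ∃[ v ] (Reciprocal (q ^ 5) v × Converges v) →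
        Converges (poch (- q) (q ^ 5)) → Converges (poch (- (q ^ 4)) (q ^ 5)) → Converges (poch (q ^ 5) (q ^ 5)) →
        Converges (poch q (q ^ 2)) → Converges (poch (q ^ 2) (q ^ 2)) → SeriesStatement
      from (u , u-rec , u-conv) (v , v-rec , v-conv) a b c d e =
        den#0 , A.limit , B.limit , C.limit , D.limit , E.limit ,
        ↝⇒⟶ (poch (- q) (q ^ 5)) A.limit A.converges , ↝⇒⟶ (poch (- (q ^ 4)) (q ^ 5)) B.limit B.converges , ↝⇒⟶ (poch (q ^ 5) (q ^ 5)) C.limit C.converges , ↝⇒⟶ (poch q (q ^ 2)) D.limit D.converges , ↝⇒⟶ (poch (q ^ 2) (q ^ 2)) E.limit E.converges ,
        E#0 , ↝⇒⟶ partialSum value series↝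
        where
        module A = Converges a
        module B = Converges b
        module C = Converges c
        module D = Converges d
        module E = Converges e
        module U = Converges u-conv
        -- Both apartness claims come from reciprocals already at hand: (q;q²)_n/(q²;q²)_(2n)
        -- inverts the n-th denominator, and the limit of 1/(q²;q²)_n inverts `E.limit`.
        den-inverse : ∀ n → denominator q n * (poch q (q ^ 2) n * u (double n)) ≋ 1#
        den-inverse = denominator-inverse ∥q∥≤ρ u-rec
        den#0 : ∀ n → denominator q n #0
        den#0 n = inverse⇒#0 (denominator q n) (poch q (q ^ 2) n * u (double n)) (den-inverse n)
        EU≋1 : E.limit * U.limit ≋ 1#
        EU≋1 = limits-inverse e u-conv (Reciprocal.u-inverse u-rec)
        E#0 : E.limit #0
        E#0 = inverse⇒#0 E.limit U.limit EU≋1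
        value : ℂ
        value = A.limit * B.limit * C.limit * D.limit * inv E.limit E#0
        value≋ : U.limit * (D.limit * (C.limit * (A.limit * B.limit))) ≋ value
        value≋ = ≋-trans
          (solve 5 (λ a b c d u → u :* (d :* (c :* (a :* b))) := a :* b :* c :* d :* u) ≋-refl
            A.limit B.limit C.limit D.limit U.limit)
          (≋-*-congˡ (≋-sym (inv≋ E.limit U.limit E#0 EU≋1)))
          where open ℤ-Solver ℂ-commutativeRing
        term : ℕ → ℂ
        term n = numerator q n * inv (denominator q n) (den#0 n)
        partialSum : ℕ → ℂ
        partialSum n = sum {n} (λ i → numerator q (toℕ i) * inv (denominator q (toℕ i)) (den#0 (toℕ i)))
        term≋ : ∀ n → seriesTerm q u-rec n ≋ term n
        term≋ n = ≋-*-congˡ (≋-sym (inv≋ (denominator q n) (poch q (q ^ 2) n * u (double n)) (den#0 n) (den-inverse n)))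
        partialSum≋ : ∀ n → sum {n} (λ i → seriesTerm q u-rec (toℕ i)) ≋ partialSum n
        partialSum≋ n = sum-cong n {seriesTerm q u-rec} {term} term≋
        theta↝ : θ-sum ∥q∥≤ρ ↝ C.limit * (A.limit * B.limit)
        theta↝ = θ-sum-limit ∥q∥≤ρ {A.limit} {B.limit} {C.limit} {v} v-rec v-conv A.converges B.converges C.converges
        series↝′ : (λ n → sum {n} (λ i → seriesTerm q u-rec (toℕ i))) ↝ U.limit * (D.limit * (C.limit * (A.limit * B.limit)))
        series↝′ = series-limit ∥q∥≤ρ {D.limit} {C.limit * (A.limit * B.limit)} {u} u-rec u-conv D.converges theta↝
        series↝ : partialSum ↝ value
        series↝ = ↝-cong {λ n → sum {n} (λ i → seriesTerm q u-rec (toℕ i))} {partialSum}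
          {U.limit * (D.limit * (C.limit * (A.limit * B.limit)))} {value} partialSum≋ value≋ series↝′


  -- Transport to the operations of the statement

  opaque
    unfolding _+_

    +≡ : ∀ z w → z + w ≡ z Defs.+ w
    +≡ z w = refl
    *≡ : ∀ z w → z * w ≡ z Defs.* w
    *≡ z w = refl
    neg≡ : ∀ z → - z ≡ Defs.- z
    neg≡ z = refl
    0≡ : 0# ≡ Defs.0#
    0≡ = refl
    1≡ : 1# ≡ Defs.1#
    1≡ = refl

  foldr-≡ : ∀ {A : Set} (_∙_ _∘_ : A → A → A) {ε ι : A} → (∀ x y → x ∙ y ≡ x ∘ y) → ε ≡ ι →
    ∀ n (f g : ℕ → A) → (∀ i → f i ≡ g i) →
    Vector.foldr _∙_ ε {n} (λ i → f (toℕ i)) ≡ Vector.foldr _∘_ ι {n} (λ i → g (toℕ i))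
  foldr-≡ _∙_ _∘_ ∙≡∘ ε≡ι zero    f g f≡g = ε≡ι
  foldr-≡ _∙_ _∘_ ∙≡∘ ε≡ι (suc n) f g f≡g = trans (∙≡∘ _ _)
    (cong₂ _∘_ (f≡g 0) (foldr-≡ _∙_ _∘_ ∙≡∘ ε≡ι n (λ i → f (suc i)) (λ i → g (suc i)) (λ i → f≡g (suc i))))

  -- Powers are iterated products in the multiplicative monoid, so this comparison of multiples
  -- yields `^≡`. The two monoids also carry different equalities, hence the two relations.
  ×-≡ : ∀ {A : Set} (_≈₁_ _≈₂_ : A → A → Set) (_∙_ _∘_ : A → A → A) (ε ι : A) → (∀ x y → x ∙ y ≡ x ∘ y) → ε ≡ ι →
    ∀ n x → RawMonoidDefinitions._×_ (record { _≈_ = _≈₁_ ; _∙_ = _∙_ ; ε = ε }) n x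
          ≡ RawMonoidDefinitions._×_ (record { _≈_ = _≈₂_ ; _∙_ = _∘_ ; ε = ι }) n x
  ×-≡ _≈₁_ _≈₂_ _∙_ _∘_ ε ι ∙≡∘ ε≡ι zero    x = ε≡ι
  ×-≡ _≈₁_ _≈₂_ _∙_ _∘_ ε ι ∙≡∘ ε≡ι (suc n) x = trans (∙≡∘ _ _) (cong (x ∘_) (×-≡ _≈₁_ _≈₂_ _∙_ _∘_ ε ι ∙≡∘ ε≡ι n x))

  ^≡ : ∀ z n → z ^ n ≡ z Defs.^ n
  ^≡ z n = ×-≡ _≋_ Defs._≈_ _*_ Defs._*_ 1# Defs.1# *≡ 1≡ n z

  sum≡ : ∀ n (f g : ℕ → ℂ) → (∀ i → f i ≡ g i) → sum {n} (λ i → f (toℕ i)) ≡ Defs.sum {n} (λ i → g (toℕ i))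
  sum≡ = foldr-≡ _+_ Defs._+_ +≡ 0≡

  product≡ : ∀ n (f g : ℕ → ℂ) → (∀ i → f i ≡ g i) → product {n} (λ i → f (toℕ i)) ≡ Defs.product {n} (λ i → g (toℕ i))
  product≡ = foldr-≡ _*_ Defs._*_ *≡ 1≡

  -- The operations of Defs are copies of record projections, which Agda may silently
  -- unfold in terms but not in signatures; ordinary definitions do not have this problem.
  negᴰ : ℂ → ℂ
  negᴰ z = Defs.- z

  mulᴰ : ℂ → ℂ → ℂ
  mulᴰ z w = z Defs.* w

  powᴰ : ℂ → ℕ → ℂ
  powᴰ z n = z Defs.^ n

  oneᴰ : ℂ
  oneᴰ = Defs.1#

  mul-≡ : ∀ z w z′ w′ → z ≡ z′ → w ≡ w′ → z * w ≡ mulᴰ z′ w′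
  mul-≡ z w .z .w refl refl = *≡ z w

  neg-≡ : ∀ z z′ → z ≡ z′ → - z ≡ negᴰ z′
  neg-≡ z .z refl = neg≡ z

  pow-≡ : ∀ z z′ → z ≡ z′ → ∀ n → z ^ n ≡ powᴰ z′ n
  pow-≡ z .z refl n = ^≡ z n

  plus-≡ : ∀ z w z′ w′ → z ≡ z′ → w ≡ w′ → z + w ≡ z′ Defs.+ w′
  plus-≡ z w .z .w refl refl = +≡ z w

  minus-≡ : ∀ z w z′ w′ → z ≡ z′ → w ≡ w′ → z - w ≡ z′ Defs.- w′
  minus-≡ z w z′ w′ z≡z′ w≡w′ = plus-≡ z (- w) z′ (Defs.- w′) z≡z′ (neg-≡ w w′ w≡w′)

  times-≡ : ∀ z w z′ w′ → z ≡ z′ → w ≡ w′ → z * w ≡ z′ Defs.* w′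
  times-≡ z w .z .w refl refl = *≡ z w

  poch≡ : ∀ a b x y → a ≡ b → x ≡ y → ∀ n → poch a x n ≡ Defs.poch b y n
  poch≡ a .a x .x refl refl n = product≡ n (λ j → 1# - a * x ^ j) (λ j → Defs.1# Defs.- a Defs.* x Defs.^ j) λ j →
    minus-≡ 1# (a * x ^ j) Defs.1# (a Defs.* x Defs.^ j) 1≡ (times-≡ a (x ^ j) a (x Defs.^ j) refl (^≡ x j))

  signᴰ : ℕ → ℂ
  signᴰ n = powᴰ (negᴰ oneᴰ) n

  denominatorᴰ squareᴰ powerᴰ numeratorᴰ : ℂ → ℕ → ℂ
  denominatorᴰ q n = mulᴰ (Defs.poch (negᴰ q) (powᴰ q 2) n) (Defs.poch (powᴰ q 4) (powᴰ q 4) n)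
  squareᴰ q n = powᴰ q (n ℕ.^ 2 ℕ.+ 2 ℕ.* n)
  powerᴰ q n = mulᴰ (signᴰ n) (squareᴰ q n)
  numeratorᴰ q n = mulᴰ (powerᴰ q n) (Defs.poch q (powᴰ q 2) n)

  denominator≡ : ∀ q n → denominator q n ≡ denominatorᴰ q n
  denominator≡ q n = mul-≡ (poch (- q) (q ^ 2) n) (poch (q ^ 4) (q ^ 4) n)
    (Defs.poch (negᴰ q) (powᴰ q 2) n) (Defs.poch (powᴰ q 4) (powᴰ q 4) n)
    (poch≡ (- q) (negᴰ q) (q ^ 2) (powᴰ q 2) (neg≡ q) (^≡ q 2) n)
    (poch≡ (q ^ 4) (powᴰ q 4) (q ^ 4) (powᴰ q 4) (^≡ q 4) (^≡ q 4) n)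

  numerator≡ : ∀ q n → numerator q n ≡ numeratorᴰ q n
  numerator≡ q n = mul-≡ (signedPower q n) (poch q (q ^ 2) n) (powerᴰ q n) (Defs.poch q (powᴰ q 2) n)
    (mul-≡ ((- 1#) ^ n) (q ^ (n ℕ.^ 2 ℕ.+ 2 ℕ.* n)) (signᴰ n) (squareᴰ q n)
      (pow-≡ (- 1#) (negᴰ oneᴰ) (neg-≡ 1# oneᴰ 1≡) n) (^≡ q (n ℕ.^ 2 ℕ.+ 2 ℕ.* n)))
    (poch≡ q q (q ^ 2) (powᴰ q 2) refl (^≡ q 2) n)

  -- The modulus of convergence of an inverse depends on the proof of apartness, so equal inverses
  -- require the proof to be transported along with the number.
  inv-≡ : ∀ z w → z ≡ w → (z#0 : z #0) → Σ[ w#0 ∈ w #0 ] inv z z#0 ≡ inv w w#0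
  inv-≡ z .z refl z#0 = z#0 , refl

  ∣-∣<-≡ : ∀ z w L ε → z ≡ w → ∣ z Defs.- L ∣< ε → ∣ w Defs.- L ∣< ε
  ∣-∣<-≡ z .z L ε refl b = b

  ⟶-≡ : ∀ (s t : ℕ → ℂ) L M → (∀ n → s n ≡ t n) → L ≡ M → s ⟶ L → t ⟶ M
  ⟶-≡ s t L .L s≡t refl s⟶L ε 0<ε = proj₁ (s⟶L ε 0<ε) , λ n N≤n →
    ∣-∣<-≡ (s n) (t n) L ε (s≡t n) (proj₂ (s⟶L ε 0<ε) n N≤n)

  quotient-≡ : ∀ w i x z z#0 → w ≡ x → i ≡ inv z z#0 → w * i ≡ x Defs./ z [ z#0 ]
  quotient-≡ w .(inv z z#0) .w z z#0 refl refl = *≡ w (inv z z#0)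

  hasSum-≡ : ∀ (f g : ℕ → ℂ) S T → (∀ n → f n ≡ g n) → S ≡ T →
    (λ n → sum {n} (λ i → f (toℕ i))) ⟶ S → Defs.HasSum g T
  hasSum-≡ f g S T f≡g S≡T = ⟶-≡ (λ n → sum {n} (λ i → f (toℕ i))) (λ n → Defs.sum {n} (λ i → g (toℕ i))) S T
    (λ n → sum≡ n f g f≡g) S≡T

  -- The shape of the theorem with its expressions in q abstracted, so that the transport needs only
  -- termwise equations between sequences.
  Conclusion : (den num pa pb pc pd pe : ℕ → ℂ) (product₄ : ℂ → ℂ → ℂ → ℂ → ℂ) → Set
  Conclusion den num pa pb pc pd pe product₄ =
    Σ[ den#0 ∈ (∀ n → den n #0) ]
    ∃[ A ] ∃[ B ] ∃[ C ] ∃[ D ] ∃[ E ]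
      pa ⟶ A × pb ⟶ B × pc ⟶ C × pd ⟶ D × pe ⟶ E ×
      (Σ[ E#0 ∈ E #0 ]
        Defs.HasSum (λ n → num n Defs./ den n [ den#0 n ]) (product₄ A B C D Defs./ E [ E#0 ]))

  module _ (q : ℂ) (∣q∣<1 : ∣ q ∣< 1ℚ) (den num pa pb pc pd pe : ℕ → ℂ)
    (den≡ : ∀ n → denominator q n ≡ den n) (num≡ : ∀ n → numerator q n ≡ num n)
    (pa≡ : ∀ n → poch (- q) (q ^ 5) n ≡ pa n) (pb≡ : ∀ n → poch (- (q ^ 4)) (q ^ 5) n ≡ pb n)
    (pc≡ : ∀ n → poch (q ^ 5) (q ^ 5) n ≡ pc n) (pd≡ : ∀ n → poch q (q ^ 2) n ≡ pd n)
    (pe≡ : ∀ n → poch (q ^ 2) (q ^ 2) n ≡ pe n)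
    (product₄ : ℂ → ℂ → ℂ → ℂ → ℂ) (product₄≡ : ∀ A B C D → A * B * C * D ≡ product₄ A B C D) where

    module FromEvaluation (d : ∀ n → denominator q n #0) (den#0 : ∀ n → den n #0)
      (inv≡ : ∀ n → inv (denominator q n) (d n) ≡ inv (den n) (den#0 n)) where

      term term′ : ℕ → ℂ
      term n = numerator q n * inv (denominator q n) (d n)
      term′ n = num n Defs./ den n [ den#0 n ]

      term≡ : ∀ n → term n ≡ term′ n
      term≡ n = r
        where
        r = quotient-≡ (numerator q n) (inv (denominator q n) (d n)) (num n) (den n) (den#0 n) (num≡ n) (inv≡ n)

      module _ (A B C D E : ℂ) (E#0 : E #0) where
        value≡ : A * B * C * D * inv E E#0 ≡ product₄ A B C D Defs./ E [ E#0 ]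
        value≡ = r
          where
          prod≡ = product₄≡ A B C D
          r = quotient-≡ (A * B * C * D) (inv E E#0) (product₄ A B C D) E E#0 prod≡ refl

        hasSum : (λ n → sum {n} (λ i → term (toℕ i))) ⟶ A * B * C * D * inv E E#0 →
          Defs.HasSum term′ (product₄ A B C D Defs./ E [ E#0 ])
        hasSum = hasSum-≡ term term′ (A * B * C * D * inv E E#0) (product₄ A B C D Defs./ E [ E#0 ]) term≡ value≡

    conclusion : Conclusion den num pa pb pc pd pe product₄
    conclusion = from (series-evaluation q ∣q∣<1)
      where
      from : SeriesStatement q ∣q∣<1 → Conclusion den num pa pb pc pd pe product₄
      from (d , A , B , C , D , E , A⟶ , B⟶ , C⟶ , D⟶ , E⟶ , E#0 , series⟶) =
        (λ n → proj₁ (inverse n)) , A , B , C , D , E ,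
        ⟶-≡ (poch (- q) (q ^ 5)) pa A A pa≡ refl A⟶ , ⟶-≡ (poch (- (q ^ 4)) (q ^ 5)) pb B B pb≡ refl B⟶ ,
        ⟶-≡ (poch (q ^ 5) (q ^ 5)) pc C C pc≡ refl C⟶ , ⟶-≡ (poch q (q ^ 2)) pd D D pd≡ refl D⟶ ,
        ⟶-≡ (poch (q ^ 2) (q ^ 2)) pe E E pe≡ refl E⟶ , E#0 , hasSum A B C D E E#0 series⟶
        where
        inverse : ∀ n → Σ[ w#0 ∈ den n #0 ] inv (denominator q n) (d n) ≡ inv (den n) w#0
        inverse n = inv-≡ (denominator q n) (den n) (den≡ n) (d n)
        open FromEvaluation d (λ n → proj₁ (inverse n)) (λ n → proj₂ (inverse n))

  product₂ : ℂ → ℂ → ℂ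
  product₂ = mulᴰ

  product₃ : ℂ → ℂ → ℂ → ℂ
  product₃ A B C = mulᴰ (product₂ A B) C

  product₄ : ℂ → ℂ → ℂ → ℂ → ℂ
  product₄ A B C D = mulᴰ (product₃ A B C) D

  product₄≡ : ∀ A B C D → A * B * C * D ≡ product₄ A B C D
  product₄≡ A B C D = mul-≡ (A * B * C) D (product₃ A B C) D (mul-≡ (A * B) C (product₂ A B) C (*≡ A B) refl) refl

  -- The equations hold by refl; matching on them puts the expressions of the theorem in place of the variables.
  unfold : ∀ (q -q q² q⁴ q⁵ -q⁴ one -one : ℂ) (sign square power den num : ℕ → ℂ)
    (m₂ : ℂ → ℂ → ℂ) (m₃ : ℂ → ℂ → ℂ → ℂ) (m₄ : ℂ → ℂ → ℂ → ℂ → ℂ) →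
    -q ≡ Defs.- q → q² ≡ q Defs.^ 2 → q⁴ ≡ q Defs.^ 4 → q⁵ ≡ q Defs.^ 5 → -q⁴ ≡ Defs.- q⁴ →
    one ≡ Defs.1# → -one ≡ Defs.- one →
    sign ≡ (λ n → -one Defs.^ n) → square ≡ (λ n → q Defs.^ (n ℕ.^ 2 ℕ.+ 2 ℕ.* n)) → power ≡ (λ n → sign n Defs.* square n) →
    num ≡ (λ n → power n Defs.* Defs.poch q q² n) →
    den ≡ (λ n → Defs.poch -q q² n Defs.* Defs.poch q⁴ q⁴ n) →
    m₂ ≡ (λ A B → A Defs.* B) → m₃ ≡ (λ A B C → m₂ A B Defs.* C) → m₄ ≡ (λ A B C D → m₃ A B C Defs.* D) →
    Conclusion den num (Defs.poch -q q⁵) (Defs.poch -q⁴ q⁵) (Defs.poch q⁵ q⁵) (Defs.poch q q²) (Defs.poch q² q²) m₄ →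
      Σ[ den#0 ∈ (∀ n → (Defs.poch (Defs.- q) (q Defs.^ 2) n Defs.* Defs.poch (q Defs.^ 4) (q Defs.^ 4) n) #0) ]
      ∃[ A ] ∃[ B ] ∃[ C ] ∃[ D ] ∃[ E ]
      Defs.IsPoch∞ (Defs.- q) (q Defs.^ 5) A ×
      Defs.IsPoch∞ (Defs.- (q Defs.^ 4)) (q Defs.^ 5) B ×
      Defs.IsPoch∞ (q Defs.^ 5) (q Defs.^ 5) C ×
      Defs.IsPoch∞ q (q Defs.^ 2) D ×
      Defs.IsPoch∞ (q Defs.^ 2) (q Defs.^ 2) E ×
      (Σ[ E#0 ∈ E #0 ]
      Defs.HasSum
      (λ n → ((Defs.- Defs.1#) Defs.^ n Defs.* q Defs.^ (n ℕ.^ 2 ℕ.+ 2 ℕ.* n) Defs.* Defs.poch q (q Defs.^ 2) n)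
      Defs./ (Defs.poch (Defs.- q) (q Defs.^ 2) n Defs.* Defs.poch (q Defs.^ 4) (q Defs.^ 4) n) [ den#0 n ])
      (A Defs.* B Defs.* C Defs.* D Defs./ E [ E#0 ]))
  unfold q _ _ _ _ _ _ _ _ _ _ _ _ _ _ _ refl refl refl refl refl refl refl refl refl refl refl refl refl refl refl c = c

  module _ (q : ℂ) where
    pa≡ : ∀ n → poch (- q) (q ^ 5) n ≡ Defs.poch (negᴰ q) (powᴰ q 5) n
    pa≡ = poch≡ (- q) (negᴰ q) (q ^ 5) (powᴰ q 5) (neg≡ q) (^≡ q 5)

    pb≡ : ∀ n → poch (- (q ^ 4)) (q ^ 5) n ≡ Defs.poch (negᴰ (powᴰ q 4)) (powᴰ q 5) n
    pb≡ = poch≡ (- (q ^ 4)) (negᴰ (powᴰ q 4)) (q ^ 5) (powᴰ q 5) (neg-≡ (q ^ 4) (powᴰ q 4) (^≡ q 4)) (^≡ q 5)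

    pc≡ : ∀ n → poch (q ^ 5) (q ^ 5) n ≡ Defs.poch (powᴰ q 5) (powᴰ q 5) n
    pc≡ = poch≡ (q ^ 5) (powᴰ q 5) (q ^ 5) (powᴰ q 5) (^≡ q 5) (^≡ q 5)

    pd≡ : ∀ n → poch q (q ^ 2) n ≡ Defs.poch q (powᴰ q 2) n
    pd≡ = poch≡ q q (q ^ 2) (powᴰ q 2) refl (^≡ q 2)

    pe≡ : ∀ n → poch (q ^ 2) (q ^ 2) n ≡ Defs.poch (powᴰ q 2) (powᴰ q 2) n
    pe≡ = poch≡ (q ^ 2) (powᴰ q 2) (q ^ 2) (powᴰ q 2) (^≡ q 2) (^≡ q 2)

    conclusionᴰ : ∣ q ∣< 1ℚ → Conclusion (denominatorᴰ q) (numeratorᴰ q)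
      (Defs.poch (negᴰ q) (powᴰ q 5)) (Defs.poch (negᴰ (powᴰ q 4)) (powᴰ q 5)) (Defs.poch (powᴰ q 5) (powᴰ q 5))
      (Defs.poch q (powᴰ q 2)) (Defs.poch (powᴰ q 2) (powᴰ q 2)) product₄
    conclusionᴰ ∣q∣<1 = conclusion q ∣q∣<1 (denominatorᴰ q) (numeratorᴰ q)
      (Defs.poch (negᴰ q) (powᴰ q 5)) (Defs.poch (negᴰ (powᴰ q 4)) (powᴰ q 5)) (Defs.poch (powᴰ q 5) (powᴰ q 5))
      (Defs.poch q (powᴰ q 2)) (Defs.poch (powᴰ q 2) (powᴰ q 2))
      (denominator≡ q) (numerator≡ q) pa≡ pb≡ pc≡ pd≡ pe≡ product₄ product₄≡


open ComplexSeries using (unfold; negᴰ; powᴰ; oneᴰ; signᴰ; squareᴰ; powerᴰ; denominatorᴰ; numeratorᴰ; product₂; product₃; product₄; conclusionᴰ)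
open import Defs

theorem2p5 : ∀ (q : ℂ) → ∣ q ∣< 1ℚ →
    Σ[ den#0 ∈ (∀ n → (poch (- q) (q ^ 2) n * poch (q ^ 4) (q ^ 4) n) #0) ]
    ∃[ A ] ∃[ B ] ∃[ C ] ∃[ D ] ∃[ E ]
    IsPoch∞ (- q) (q ^ 5) A ×
    IsPoch∞ (- (q ^ 4)) (q ^ 5) B ×
    IsPoch∞ (q ^ 5) (q ^ 5) C ×
    IsPoch∞ q (q ^ 2) D ×
    IsPoch∞ (q ^ 2) (q ^ 2) E ×
    (Σ[ E#0 ∈ E #0 ]
    HasSum
    (λ n → ((- 1#) ^ n * q ^ (n ℕ.^ 2 ℕ.+ 2 ℕ.* n) * poch q (q ^ 2) n)
    / (poch (- q) (q ^ 2) n * poch (q ^ 4) (q ^ 4) n) [ den#0 n ])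
    (A * B * C * D / E [ E#0 ]))
theorem2p5 q ∣q∣<1 = unfold q (negᴰ q) (powᴰ q 2) (powᴰ q 4) (powᴰ q 5) (negᴰ (powᴰ q 4)) oneᴰ (negᴰ oneᴰ)
  signᴰ (squareᴰ q) (powerᴰ q) (denominatorᴰ q) (numeratorᴰ q) product₂ product₃ product₄
  ≡.refl ≡.refl ≡.refl ≡.refl ≡.refl ≡.refl ≡.refl ≡.refl ≡.refl ≡.refl ≡.refl ≡.refl ≡.refl ≡.refl ≡.refl
  (conclusionᴰ q ∣q∣<1)
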